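{- For every fixed integer $t\ge2$, every $n$-vertex graph $G$ satisfies $\mathrm{cov}_t(G)\le(1+o(1))\,\mathrm{cov}_t(T_{n,t})$, where the $o(1)$ term tends to $0$ as $n\to\infty$; that is, for every $\epsilon>0$ there is $n_0$ such that for all $n\ge n_0$ and every $n$-vertex graph $G$, $\mathrm{cov}_t(G)\le(1+\epsilon)\mathrm{cov}_t(T_{n,t})$.
   Context: All graphs are finite and simple. A clique of a graph $G$ is a nonempty set of pairwise adjacent vertices; $\mathcal{K}(G)$ denotes the set of cliques of $G$ and $\mathcal{K}_t(G)$ the set of cliques with exactly $t$ vertices. A $t$-clique cover of $G$ is a function $f:\mathcal{K}(G)\to\{0,1\}$ such that for every $T\in\mathcal{K}_t(G)$, $\sum_{K\in\mathcal{K}(G),\,T\subseteq K}f(K)\ge1$. $\mathrm{cov}_t(G)$ is the minimum of $\sum_{K}f(K)$ over all $t$-clique covers $f$ of $G$ (i.e. the minimum number of cliques of $G$ such that every $t$-clique of $G$ is contained in one of them). For $n\ge k$, $T_{n,k}$ denotes the Turán graph: the complete $k$-partite graph on $n$ vertices whose part sizes differ by at most one. -}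

module Defs where

open import Data.Nat using (ℕ; _≤_; _*_; _+_; NonZero)
open import Data.Nat.DivMod using (_%_)
open import Data.Fin using (Fin; toℕ)
open import Data.Fin.Subset using (Subset; _∈_; _⊆_; ∣_∣; Nonempty)
open import Data.List using (List; length)
open import Data.List.Relation.Unary.All using (All)
open import Data.List.Relation.Unary.Any using (Any)
open import Data.Product using (Σ; _×_; ∃)
open import Relation.Nullary using (¬_)
open import Relation.Binary.PropositionalEquality using (_≡_; _≢_)

record Graph (n : ℕ) : Set₁ where
  field
    Adj   : Fin n → Fin n → Set
    sym   : ∀ {x y} → Adj x y → Adj y x
    irrefl : ∀ {x} → ¬ Adj x x
open Graph public

IsClique : ∀ {n} → Graph n → Subset n → Set
IsClique G K = Nonempty K × (∀ {x y} → x ∈ K → y ∈ K → x ≢ y → Adj G x y)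

IsTClique : ∀ {n} → ℕ → Graph n → Subset n → Set
IsTClique t G T = IsClique G T × ∣ T ∣ ≡ t

-- A t-clique cover, given as the list of cliques K with f(K) = 1:
-- every member is a clique of G and every t-clique of G lies in some member.
IsTCliqueCover : ∀ {n} → ℕ → Graph n → List (Subset n) → Set
IsTCliqueCover t G C =
  All (IsClique G) C × (∀ T → IsTClique t G T → Any (λ K → T ⊆ K) C)

IsCov : ∀ {n} → ℕ → Graph n → ℕ → Set
IsCov t G m =
  (Σ (List (Subset _)) λ C → IsTCliqueCover t G C × length C ≡ m)
  × (∀ C → IsTCliqueCover t G C → m ≤ length C)

-- Turán graph T_{n,t}: vertex i lies in part (i mod t); adjacent iff in different parts.
-- Parts have sizes ⌊n/t⌋ or ⌈n/t⌉, so sizes differ by at most one.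
Turán : (n t : ℕ) → .{{_ : NonZero t}} → Graph n
Turán n t = record
  { Adj = λ i j → ¬ (toℕ i % t ≡ toℕ j % t)
  ; sym = λ ne eq → ne (Relation.Binary.PropositionalEquality.sym eq)
  ; irrefl = λ ne → ne Relation.Binary.PropositionalEquality.refl
  }

-- Grow a random clique greedily: pick v uniformly from the current vertex set A and continue inside A ∩ N(v).
-- By induction a t-clique T ⊆ A ends up in it with probability at least (t/|A|)^t: every vertex of A either
-- extends T or is non-adjacent to some u ∈ T, so the sizes |A ∩ N(u)|, u ∈ T, and the number c of common
-- neighbours satisfy Σ (|A| − |A ∩ N(u)|) + c ≥ |A|, and AM–GM turns this into the bound for A.  Scaled by
-- (n/t)^t, the random clique is a fractional t-clique cover of total weight (n/t)^t.  Stopping with a small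
-- bias and after boundedly many steps costs a factor 1 + o(1), but makes the cliques bounded and gives any two
-- t-cliques a common weight O(1/n); a Rödl nibble, derandomised by a potential function and choosing one clique
-- at a time, then produces an integral cover of size (1 + o(1)) (n/t)^t.  In the Turán graph a clique contains
-- at most one of the at least ⌊n/t⌋^t transversals, so at least that many cliques are needed.

module Submission where

open import Defs hiding (sym)
open import Data.Bool using (Bool; true; false; _∧_; _∨_; not; if_then_else_)
open import Data.Bool.ListAction using (any)
import Data.Bool.Properties as Bool
open import Data.Empty using (⊥-elim)
open import Data.Fin as Fin using (Fin; zero; suc; toℕ; fromℕ<)
import Data.Fin.Properties as Fin
open import Data.Fin.Subset as Subset using (Subset; ⊥; ∣_∣; Nonempty)
open import Data.Fin.Subset.Properties using (nonempty?; ∣p∣≤n)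
import Data.Integer as ℤ
import Data.Integer.Properties as ℤ
open import Data.List as List using (List; []; _∷_; _++_; map; concatMap; filter; foldr; length; allFin)
open import Data.List.Membership.Propositional using (_∈_; find; lose)
open import Data.List.Membership.Propositional.Properties
  using (∈-map⁺; ∈-map⁻; ∈-++⁺ˡ; ∈-++⁺ʳ; ∈-++⁻; ∈-filter⁺; ∈-filter⁻; ∈-concatMap⁻; ∈-allFin; ∈-tabulate⁺; ∈-tabulate⁻)
open import Data.List.Properties using (length-filter; length-map; length-++; length-tabulate; map-tabulate)
open import Data.List.Relation.Unary.All as All using ([]; _∷_)
open import Data.List.Relation.Unary.AllPairs using ([]; _∷_)
open import Data.List.Relation.Unary.Any using (Any; here; there; index; _─_)
open import Data.List.Relation.Unary.Any.Properties using (lookup-index)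
open import Data.List.Relation.Unary.Unique.Propositional using (Unique)
open import Data.List.Relation.Unary.Unique.Propositional.Properties using (map⁺; ++⁺; filter⁺; tabulate⁺; allFin⁺)
open import Data.Maybe as Maybe using ()
open import Data.Nat as ℕ using (ℕ; zero; suc; NonZero)
open import Data.Nat.DivMod using (_%_; m≡m%n+[m/n]*n; m%n<n; m*n/n≡m; /-monoˡ-≤; m/n*n≤m; [m+kn]%n≡m%n; m<n⇒m%n≡m)
import Data.Nat.Properties as ℕ
open import Data.Product using (Σ; ∃; _×_; _,_; proj₁; proj₂)
open import Data.Rational as ℚ
  using (ℚ; mkℚ; 0ℚ; 1ℚ; ½; _+_; _*_; _-_; -_; 1/_; _≤_; _<_; *≤*; *<*; positive; nonNegative; toℚᵘ)
open import Data.Rational.Properties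
import Data.Rational.Unnormalised as ℚᵘ
import Data.Rational.Unnormalised.Properties as ℚᵘ
open import Data.Sum as Sum using (_⊎_; inj₁; inj₂)
open import Data.Vec using ([]; _∷_; lookup; replicate; tabulate; _[_]≔_; here; there)
import Data.Vec.Properties as Vec
open import Data.Vec.Properties
  using (lookup∘update; lookup∘update′; lookup∘tabulate; []≔-lookup; []≔-idempotent; lookup-replicate; []=⇒lookup; lookup⇒[]=)
open import Function using (_∘_; id; case_of_; Injective)
open import Level using (0ℓ)
open import Relation.Binary.PropositionalEquality using (_≡_; _≢_; refl; sym; trans; cong; cong₂; subst; subst₂)
open import Relation.Nullary using (¬_; Dec; yes; no; does)
open import Relation.Nullary.Decidable
  using (dec⇒maybe; dec-true; dec-false; map′; _×-dec_; _→-dec_; ¬?; decidable-stable; ¬¬-excluded-middle)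
open import Tactic.RingSolver using (solve-∀)
open import Tactic.RingSolver.Core.AlmostCommutativeRing using (AlmostCommutativeRing; fromCommutativeRing)

-- The nibble needs blocks of bounded size with small codegrees. The unbiased greedy process
-- guarantees neither: it may add unboundedly many vertices, and once few candidates remain the next
-- vertex is nearly forced. A bias `q` proportional to `n` caps the chance of any given vertex at
-- each step by `1/q`; stopping after `r` steps caps the number of t-cliques in a block by `2 ^ r`.
-- The AM-GM induction survives the bias once |A| is replaced by |A| + j q, with j vertices still to
-- be caught, and truncation costs a loss that decays geometrically in `r`. The nibble controls all
-- degrees together, through the sum `Ψ` of their squared errors. This works because the interaction
-- between errors at different points is a semidefinite form of favourable sign, so that averaging
-- `W + α Ψ` yields a good block. The constants are fixed in the order ε, δ, r, k, κ, n₀, each from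
-- t and the earlier ones. Everything takes place in ℚ, with Bernoulli's inequality in place of
-- exponentials.

ring : AlmostCommutativeRing 0ℓ 0ℓ
ring = fromCommutativeRing +-*-commutativeRing λ x → Maybe.map sym (dec⇒maybe (x ≟ 0ℚ))

-- Ordered-field arithmetic

2ℚ : ℚ
2ℚ = 1ℚ + 1ℚ

0≤1 : 0ℚ ≤ 1ℚ
0≤1 = *≤* (ℤ.+≤+ ℕ.z≤n)

0<1 : 0ℚ < 1ℚ
0<1 = *<* (ℤ.+<+ (ℕ.s≤s ℕ.z≤n))

-- Every nontrivial inequality is certified by exhibiting the difference of its sides.
≤-cert : ∀ {p q} c → q ≡ p + c → 0ℚ ≤ c → p ≤ q
≤-cert {p} c eq 0≤c = subst₂ _≤_ (+-identityʳ p) (sym eq) (+-monoʳ-≤ p 0≤c)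

p≤q⇒0≤q-p : ∀ {p q} → p ≤ q → 0ℚ ≤ q - p
p≤q⇒0≤q-p {p} {q} p≤q = subst (_≤ q - p) (+-inverseʳ p) (+-monoˡ-≤ (- p) p≤q)

infixl 6 _⊹_
infixl 7 _⊛_

_⊹_ : ∀ {p q} → 0ℚ ≤ p → 0ℚ ≤ q → 0ℚ ≤ p + q
0≤p ⊹ 0≤q = +-mono-≤ 0≤p 0≤q

_⊛_ : ∀ {p q} → 0ℚ ≤ p → 0ℚ ≤ q → 0ℚ ≤ p * q
_⊛_ {p} {q} 0≤p 0≤q = nonNegative⁻¹ (p * q) {{nonNeg*nonNeg⇒nonNeg p {{nonNegative 0≤p}} q {{nonNegative 0≤q}}}}

0<p*q : ∀ {p q} → 0ℚ < p → 0ℚ < q → 0ℚ < p * q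
0<p*q {p} {q} 0<p 0<q = positive⁻¹ (p * q) {{pos*pos⇒pos p {{positive 0<p}} q {{positive 0<q}}}}

0<p+q : ∀ {p q} → 0ℚ < p → 0ℚ ≤ q → 0ℚ < p + q
0<p+q 0<p 0≤q = +-mono-<-≤ 0<p 0≤q

*-monoˡ : ∀ {p q r} → 0ℚ ≤ r → p ≤ q → r * p ≤ r * q
*-monoˡ {r = r} 0≤r p≤q = *-monoˡ-≤-nonNeg r {{nonNegative 0≤r}} p≤q

*-monoʳ : ∀ {p q r} → 0ℚ ≤ r → p ≤ q → p * r ≤ q * r
*-monoʳ {r = r} 0≤r p≤q = *-monoʳ-≤-nonNeg r {{nonNegative 0≤r}} p≤q

*-mono : ∀ {p q r s} → 0ℚ ≤ p → 0ℚ ≤ s → p ≤ q → r ≤ s → p * r ≤ q * s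
*-mono 0≤p 0≤s p≤q r≤s = ≤-trans (*-monoˡ 0≤p r≤s) (*-monoʳ 0≤s p≤q)

*-cancel : ∀ {p q r} → 0ℚ < r → r * p ≤ r * q → p ≤ q
*-cancel {r = r} 0<r = *-cancelˡ-≤-pos r {{positive 0<r}}

sq-nonneg : ∀ p → 0ℚ ≤ p * p
sq-nonneg p with ≤-total 0ℚ p
... | inj₁ 0≤p = 0≤p ⊛ 0≤p
... | inj₂ p≤0 = subst (0ℚ ≤_) (eq p) (neg-antimono-≤ p≤0 ⊛ neg-antimono-≤ p≤0)
  where
  eq : ∀ p → (- p) * (- p) ≡ p * p
  eq = solve-∀ ring

-- A polynomial identity cannot use a hypothesis `u ≡ 1ℚ`. Certificates therefore carry an extra
-- summand `(u - 1ℚ) * w`, which this lemma removes.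
absorb : ∀ {x w u} → u ≡ 1ℚ → x + (u - 1ℚ) * w ≡ x
absorb {x} {w} refl = eq x w
  where
  eq : ∀ x w → x + (1ℚ - 1ℚ) * w ≡ x
  eq = solve-∀ ring

abstract
  inverse : ∀ {p} → 0ℚ < p → ∃ λ i → 0ℚ < i × p * i ≡ 1ℚ
  inverse {p} 0<p = 1/ p , positive⁻¹ (1/ p) {{1/pos⇒pos p}} , *-inverseʳ p
    where instance
      p-pos : ℚ.Positive p
      p-pos = positive 0<p
      p-nonZero : ℚ.NonZero p
      p-nonZero = pos⇒nonZero p

-- Defined by recursion so that `ι (suc n)` unfolds to `1ℚ + ι n`, the form in which inductions and
-- ring identities consume it.
ι : ℕ → ℚ
ι zero    = 0ℚ
ι (suc n) = 1ℚ + ι n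

0≤ι : ∀ n → 0ℚ ≤ ι n
0≤ι zero    = ≤-refl
0≤ι (suc n) = 0≤1 ⊹ 0≤ι n

0<ι : ∀ n → 0ℚ < ι (suc n)
0<ι n = 0<p+q 0<1 (0≤ι n)

ι-+ : ∀ m n → ι (m ℕ.+ n) ≡ ι m + ι n
ι-+ zero    n = sym (+-identityˡ (ι n))
ι-+ (suc m) n = trans (cong (1ℚ +_) (ι-+ m n)) (sym (+-assoc 1ℚ (ι m) (ι n)))

ι-* : ∀ m n → ι (m ℕ.* n) ≡ ι m * ι n
ι-* zero    n = sym (*-zeroˡ (ι n))
ι-* (suc m) n = trans (ι-+ n (m ℕ.* n)) (trans (cong (λ z → ι n + z) (ι-* m n)) (eq (ι n) (ι m)))
  where
  eq : ∀ x y → x + y * x ≡ (1ℚ + y) * x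
  eq = solve-∀ ring

ι-mono : ∀ {m n} → m ℕ.≤ n → ι m ≤ ι n
ι-mono {n = n} ℕ.z≤n = 0≤ι n
ι-mono (ℕ.s≤s m≤n) = +-monoʳ-≤ 1ℚ (ι-mono m≤n)

ι-mono-< : ∀ {m n} → m ℕ.< n → ι m < ι n
ι-mono-< {m} m<n = <-≤-trans (subst (_< ι (suc m)) (+-identityˡ (ι m)) (+-monoˡ-< (ι m) 0<1)) (ι-mono m<n)

ι-cancel-≤ : ∀ {m n} → ι m ≤ ι n → m ℕ.≤ n
ι-cancel-≤ le = ℕ.≮⇒≥ λ n<m → <-irrefl refl (<-≤-trans (ι-mono-< n<m) le)

abstract
  archimedean : ∀ p → ∃ λ n → p ≤ ι n
  archimedean p@(mkℚ (ℤ.-[1+ _ ]) _ _) = 0 , nonPositive⁻¹ p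
  archimedean p@(mkℚ (ℤ.+ n) d _) = n , toℚᵘ-cancel-≤ (ℚᵘ.≤-trans (ℚᵘ.*≤* (le n d)) (ℚᵘ.≤-reflexive (ℚᵘ.≃-sym (toℚᵘ-ι n))))
    where
    toℚᵘ-ι : ∀ n → toℚᵘ (ι n) ℚᵘ.≃ ℚᵘ.mkℚᵘ (ℤ.+ n) 0
    toℚᵘ-ι zero = ℚᵘ.≃-refl
    toℚᵘ-ι (suc n) = ℚᵘ.≃-trans (toℚᵘ-homo-+ 1ℚ (ι n)) (ℚᵘ.≃-trans (ℚᵘ.+-congʳ ℚᵘ.1ℚᵘ (toℚᵘ-ι n))
      (ℚᵘ.*≡* (cong (λ z → ((ℤ.+ 1) ℤ.+ z) ℤ.* (ℤ.+ 1)) (ℤ.*-identityʳ (ℤ.+ n)))))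
    le : ∀ n d → (ℤ.+ n) ℤ.* (ℤ.+ 1) ℤ.≤ (ℤ.+ n) ℤ.* (ℤ.+ suc d)
    le n d = ℤ.*-monoˡ-≤-nonNeg (ℤ.+ n) (ℤ.+≤+ (ℕ.s≤s ℕ.z≤n))

infixr 8 _^_
_^_ : ℚ → ℕ → ℚ
p ^ zero  = 1ℚ
p ^ suc n = p * p ^ n

0≤^ : ∀ {p} n → 0ℚ ≤ p → 0ℚ ≤ p ^ n
0≤^ zero    0≤p = 0≤1
0≤^ (suc n) 0≤p = 0≤p ⊛ 0≤^ n 0≤p

0<^ : ∀ {p} n → 0ℚ < p → 0ℚ < p ^ n
0<^ zero    0<p = 0<1
0<^ (suc n) 0<p = 0<p*q 0<p (0<^ n 0<p)

^-mono : ∀ {p q} n → 0ℚ ≤ p → p ≤ q → p ^ n ≤ q ^ n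
^-mono zero    0≤p p≤q = ≤-refl
^-mono (suc n) 0≤p p≤q = *-mono 0≤p (0≤^ n (≤-trans 0≤p p≤q)) p≤q (^-mono n 0≤p p≤q)

*-^ : ∀ p q n → (p * q) ^ n ≡ p ^ n * q ^ n
*-^ p q zero    = refl
*-^ p q (suc n) = trans (cong (p * q *_) (*-^ p q n)) (eq p q (p ^ n) (q ^ n))
  where
  eq : ∀ p q x y → p * q * (x * y) ≡ p * x * (q * y)
  eq = solve-∀ ring

1^ : ∀ n → 1ℚ ^ n ≡ 1ℚ
1^ zero    = refl
1^ (suc n) = trans (*-identityˡ _) (1^ n)

ι-^ : ∀ m n → ι (m ℕ.^ n) ≡ ι m ^ n
ι-^ m zero    = refl
ι-^ m (suc n) = trans (ι-* m (m ℕ.^ n)) (cong (ι m *_) (ι-^ m n))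

1≤^ : ∀ {p} n → 1ℚ ≤ p → 1ℚ ≤ p ^ n
1≤^ {p} n 1≤p = subst (_≤ p ^ n) (1^ n) (^-mono n 0≤1 1≤p)

^≤1 : ∀ {p} n → 0ℚ ≤ p → p ≤ 1ℚ → p ^ n ≤ 1ℚ
^≤1 {p} n 0≤p p≤1 = subst (p ^ n ≤_) (1^ n) (^-mono n 0≤p p≤1)

-- Finite sums

χ : Bool → ℚ
χ b = if b then 1ℚ else 0ℚ

0≤χ : ∀ b → 0ℚ ≤ χ b
0≤χ true  = 0≤1
0≤χ false = ≤-refl

χ≤1 : ∀ b → χ b ≤ 1ℚ
χ≤1 true  = ≤-refl
χ≤1 false = 0≤1

χ² : ∀ b → χ b * χ b ≡ χ b
χ² true  = refl
χ² false = refl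

χ-∧ : ∀ a b → χ (a ∧ b) ≡ χ a * χ b
χ-∧ true  b = sym (*-identityˡ (χ b))
χ-∧ false b = sym (*-zeroˡ (χ b))

private variable
  I J : Set

∑ : List I → (I → ℚ) → ℚ
∑ []       f = 0ℚ
∑ (x ∷ xs) f = f x + ∑ xs f

syntax ∑ xs (λ x → e) = ∑[ x ∈ xs ] e
infixr 5 ∑

∑-cong : (xs : List I) {f g : I → ℚ} → (∀ {x} → x ∈ xs → f x ≡ g x) → ∑ xs f ≡ ∑ xs g
∑-cong []       eq = refl
∑-cong (x ∷ xs) eq = cong₂ _+_ (eq (here refl)) (∑-cong xs (eq ∘ there))

∑-mono : (xs : List I) {f g : I → ℚ} → (∀ {x} → x ∈ xs → f x ≤ g x) → ∑ xs f ≤ ∑ xs g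
∑-mono []       le = ≤-refl
∑-mono (x ∷ xs) le = +-mono-≤ (le (here refl)) (∑-mono xs (le ∘ there))

∑-zero : (xs : List I) → ∑ xs (λ _ → 0ℚ) ≡ 0ℚ
∑-zero []       = refl
∑-zero (x ∷ xs) = trans (+-identityˡ _) (∑-zero xs)

0≤∑ : (xs : List I) {f : I → ℚ} → (∀ {x} → x ∈ xs → 0ℚ ≤ f x) → 0ℚ ≤ ∑ xs f
0≤∑ xs {f} le = subst (_≤ ∑ xs f) (∑-zero xs) (∑-mono xs le)

∑-+ : (xs : List I) (f g : I → ℚ) → ∑ xs (λ x → f x + g x) ≡ ∑ xs f + ∑ xs g
∑-+ []       f g = refl
∑-+ (x ∷ xs) f g = trans (cong (f x + g x +_) (∑-+ xs f g)) (eq (f x) (g x) (∑ xs f) (∑ xs g))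
  where
  eq : ∀ a b c d → a + b + (c + d) ≡ a + c + (b + d)
  eq = solve-∀ ring

∑-* : (c : ℚ) (xs : List I) (f : I → ℚ) → ∑ xs (λ x → c * f x) ≡ c * ∑ xs f
∑-* c []       f = sym (*-zeroʳ c)
∑-* c (x ∷ xs) f = trans (cong (c * f x +_) (∑-* c xs f)) (sym (*-distribˡ-+ c (f x) (∑ xs f)))

∑-*ʳ : (c : ℚ) (xs : List I) (f : I → ℚ) → ∑ xs (λ x → f x * c) ≡ ∑ xs f * c
∑-*ʳ c xs f = trans (∑-cong xs λ {x} _ → *-comm (f x) c) (trans (∑-* c xs f) (*-comm c (∑ xs f)))

∑-- : (xs : List I) (f g : I → ℚ) → ∑ xs (λ x → f x - g x) ≡ ∑ xs f - ∑ xs g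
∑-- []       f g = refl
∑-- (x ∷ xs) f g = trans (cong (f x - g x +_) (∑-- xs f g)) (eq (f x) (g x) (∑ xs f) (∑ xs g))
  where
  eq : ∀ a b c d → a - b + (c - d) ≡ a + c - (b + d)
  eq = solve-∀ ring

∑-swap : (xs : List I) (ys : List J) (f : I → J → ℚ) →
  (∑[ x ∈ xs ] ∑[ y ∈ ys ] f x y) ≡ (∑[ y ∈ ys ] ∑[ x ∈ xs ] f x y)
∑-swap []       ys f = sym (∑-zero ys)
∑-swap (x ∷ xs) ys f = trans (cong (∑ ys (f x) +_) (∑-swap xs ys f)) (sym (∑-+ ys (f x) _))

∑-const : (c : ℚ) (xs : List I) → ∑ xs (λ _ → c) ≡ ι (length xs) * c
∑-const c []       = sym (*-zeroˡ c)
∑-const c (x ∷ xs) = trans (cong (c +_) (∑-const c xs)) (eq c (ι (length xs)))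
  where
  eq : ∀ c n → c + n * c ≡ (1ℚ + n) * c
  eq = solve-∀ ring

∑-++ : (xs ys : List I) (f : I → ℚ) → ∑ (xs ++ ys) f ≡ ∑ xs f + ∑ ys f
∑-++ []       ys f = sym (+-identityˡ _)
∑-++ (x ∷ xs) ys f = trans (cong (f x +_) (∑-++ xs ys f)) (sym (+-assoc (f x) _ _))

∑-map : (g : I → J) (xs : List I) (f : J → ℚ) → ∑ (map g xs) f ≡ ∑ xs (f ∘ g)
∑-map g []       f = refl
∑-map g (x ∷ xs) f = cong (f (g x) +_) (∑-map g xs f)

∑-concatMap : (g : I → List J) (xs : List I) (f : J → ℚ) →
  ∑ (concatMap g xs) f ≡ (∑[ x ∈ xs ] ∑ (g x) f)
∑-concatMap g []       f = refl
∑-concatMap g (x ∷ xs) f = trans (∑-++ (g x) (concatMap g xs) f) (cong (∑ (g x) f +_) (∑-concatMap g xs f))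

term≤∑ : (xs : List I) {f : I → ℚ} → (∀ {x} → x ∈ xs → 0ℚ ≤ f x) → ∀ {x} → x ∈ xs → f x ≤ ∑ xs f
term≤∑ (x ∷ xs) {f} 0≤f (here refl) = subst (_≤ f x + ∑ xs f) (+-identityʳ (f x)) (+-monoʳ-≤ (f x) (0≤∑ xs (0≤f ∘ there)))
term≤∑ (x ∷ xs) {f} 0≤f (there x∈xs) = ≤-trans (term≤∑ xs (0≤f ∘ there) x∈xs)
  (subst (_≤ f x + ∑ xs f) (+-identityˡ _) (+-monoˡ-≤ (∑ xs f) (0≤f (here refl))))

-- The first-moment method without probability: if every `Φ x` exceeded `c`, the weighted sum would
-- exceed `c` times the total weight, strictly because some weight is positive. The nibble picks its
-- blocks this way.
averaging : (xs : List I) (y Φ : I → ℚ) (c : ℚ) → (∀ {x} → x ∈ xs → 0ℚ ≤ y x) → 0ℚ < ∑ xs y →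
  (∑[ x ∈ xs ] y x * Φ x) ≤ ∑ xs y * c → ∃ λ x → x ∈ xs × Φ x ≤ c
averaging {I} xs y Φ c 0≤y 0<∑ le with search xs
  where
  search : (xs : List I) → (∃ λ x → x ∈ xs × Φ x ≤ c) ⊎ (∀ {x} → x ∈ xs → c < Φ x)
  search []       = inj₂ λ ()
  search (x ∷ xs) with Φ x ≤? c | search xs
  ... | yes p | _ = inj₁ (x , here refl , p)
  ... | no ¬p | inj₁ (z , z∈ , q) = inj₁ (z , there z∈ , q)
  ... | no ¬p | inj₂ all = inj₂ λ { (here refl) → ≰⇒> ¬p ; (there z∈) → all z∈ }
... | inj₁ found = found
... | inj₂ all = ⊥-elim (<-irrefl refl (<-≤-trans (strict xs 0≤y all 0<∑) le))
  where
  strict : (xs : List I) → (∀ {x} → x ∈ xs → 0ℚ ≤ y x) → (∀ {x} → x ∈ xs → c < Φ x) →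
    0ℚ < ∑ xs y → ∑ xs y * c < (∑[ x ∈ xs ] y x * Φ x)
  strict [] _ _ 0<0 = ⊥-elim (<-irrefl refl 0<0)
  strict (x ∷ xs) 0≤y all 0<∑ with 0ℚ <? y x
  ... | yes 0<y = subst (_< _) (sym (*-distribʳ-+ c (y x) (∑ xs y)))
          (+-mono-<-≤ (*-monoʳ-<-pos (y x) {{positive 0<y}} (all (here refl)))
            (subst (_≤ _) (∑-*ʳ c xs y) (∑-mono xs λ x∈ → *-monoˡ (0≤y (there x∈)) (<⇒≤ (all (there x∈))))))
  ... | no ¬p = subst₂ _<_ (eq₁ c) (eq₂ (Φ x)) (strict xs (0≤y ∘ there) (all ∘ there) (subst (0ℚ <_) (trans (cong (_+ ∑ xs y) yx≡0) (+-identityˡ (∑ xs y))) 0<∑))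
    where
    yx≡0 : y x ≡ 0ℚ
    yx≡0 = ≤-antisym (≮⇒≥ ¬p) (0≤y (here refl))
    eq₁ : ∀ d → ∑ xs y * d ≡ (y x + ∑ xs y) * d
    eq₁ d = cong (_* d) (sym (trans (cong (_+ ∑ xs y) yx≡0) (+-identityˡ (∑ xs y))))
    rest : ℚ
    rest = ∑[ z ∈ xs ] y z * Φ z
    eq₂ : ∀ d → rest ≡ y x * d + rest
    eq₂ d = sym (trans (cong (λ w → w * d + rest) yx≡0) (trans (cong (_+ rest) (*-zeroˡ d)) (+-identityˡ _)))

-- Power inequalities in place of the exponential function

bernoulli⁺ : ∀ {y} m → 0ℚ ≤ y → 1ℚ + ι m * y ≤ (1ℚ + y) ^ m
bernoulli⁺ {y} zero    0≤y = ≤-reflexive (eq y)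
  where
  eq : ∀ y → 1ℚ + 0ℚ * y ≡ 1ℚ
  eq = solve-∀ ring
bernoulli⁺ {y} (suc m) 0≤y = ≤-trans (≤-cert (ι m * (y * y)) (eq (ι m) y) (0≤ι m ⊛ sq-nonneg y))
  (*-monoˡ (0≤1 ⊹ 0≤y) (bernoulli⁺ m 0≤y))
  where
  eq : ∀ M y → (1ℚ + y) * (1ℚ + M * y) ≡ (1ℚ + (1ℚ + M) * y) + M * (y * y)
  eq = solve-∀ ring

bernoulli⁻ : ∀ {y} m → y ≤ 1ℚ → 1ℚ - ι m * y ≤ (1ℚ - y) ^ m
bernoulli⁻ {y} zero    y≤1 = ≤-reflexive (eq y)
  where
  eq : ∀ y → 1ℚ - 0ℚ * y ≡ 1ℚ
  eq = solve-∀ ring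
bernoulli⁻ {y} (suc m) y≤1 = ≤-trans (≤-cert (ι m * (y * y)) (eq (ι m) y) (0≤ι m ⊛ sq-nonneg y))
  (*-monoˡ (p≤q⇒0≤q-p y≤1) (bernoulli⁻ m y≤1))
  where
  eq : ∀ M y → (1ℚ - y) * (1ℚ - M * y) ≡ (1ℚ - (1ℚ + M) * y) + M * (y * y)
  eq = solve-∀ ring

-- Both factors multiply to a power of `1 - y²`. A Bernoulli lower bound for one of them thus
-- becomes an upper bound for the other, which gives the next two lemmas.
conjugate-powers : ∀ {y} m → 0ℚ ≤ y → y ≤ 1ℚ → (1ℚ - y) ^ m * (1ℚ + y) ^ m ≤ 1ℚ
conjugate-powers {y} m 0≤y y≤1 = subst (_≤ 1ℚ) (*-^ (1ℚ - y) (1ℚ + y) m)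
  (^≤1 m (p≤q⇒0≤q-p y≤1 ⊛ (0≤1 ⊹ 0≤y)) (≤-cert (y * y) (eq y) (sq-nonneg y)))
  where
  eq : ∀ y → 1ℚ ≡ (1ℚ - y) * (1ℚ + y) + y * y
  eq = solve-∀ ring

growth-bernoulli : ∀ {y} m → 0ℚ ≤ y → y ≤ 1ℚ → (1ℚ - ι m * y) * (1ℚ + y) ^ m ≤ 1ℚ
growth-bernoulli m 0≤y y≤1 = ≤-trans (*-monoʳ (0≤^ m (0≤1 ⊹ 0≤y)) (bernoulli⁻ m y≤1)) (conjugate-powers m 0≤y y≤1)

decay-bernoulli : ∀ {y} m → 0ℚ ≤ y → y ≤ 1ℚ → (1ℚ - y) ^ m * (1ℚ + ι m * y) ≤ 1ℚ
decay-bernoulli m 0≤y y≤1 = ≤-trans (*-monoˡ (0≤^ m (p≤q⇒0≤q-p y≤1)) (bernoulli⁺ m 0≤y)) (conjugate-powers m 0≤y y≤1)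

growth≤2 : ∀ {y} m → 0ℚ ≤ y → 2ℚ * (ι m * y) ≤ 1ℚ → (1ℚ + y) ^ m ≤ 2ℚ
growth≤2 zero 0≤y le = ≤-cert 1ℚ refl 0≤1
growth≤2 {y} m@(suc m-1) 0≤y le = begin
  (1ℚ + y) ^ m                                  ≤⟨ ≤-cert _ (eq₁ P (ι m * y)) (p≤q⇒0≤q-p le ⊛ 0≤P) ⟩
  2ℚ * ((1ℚ - ι m * y) * (1ℚ + y) ^ m)          ≤⟨ *-monoˡ (0≤1 ⊹ 0≤1) (growth-bernoulli m 0≤y y≤1) ⟩
  2ℚ * 1ℚ                                       ≡⟨ *-identityʳ 2ℚ ⟩
  2ℚ                                            ∎
  where
  open ≤-Reasoning
  P : ℚ
  P = (1ℚ + y) ^ m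
  0≤P : 0ℚ ≤ P
  0≤P = 0≤^ m (0≤1 ⊹ 0≤y)
  eq₁ : ∀ P z → 2ℚ * ((1ℚ - z) * P) ≡ P + (1ℚ - 2ℚ * z) * P
  eq₁ = solve-∀ ring
  eq₂ : ∀ M y → 1ℚ ≡ y + ((1ℚ - 2ℚ * ((1ℚ + M) * y)) + (y + 2ℚ * (M * y)))
  eq₂ = solve-∀ ring
  y≤1 : y ≤ 1ℚ
  y≤1 = ≤-cert _ (eq₂ (ι m-1) y) (p≤q⇒0≤q-p le ⊹ (0≤y ⊹ (0≤1 ⊹ 0≤1) ⊛ (0≤ι m-1 ⊛ 0≤y)))

^-swap : ∀ p a b → (p ^ a) ^ b ≡ (p ^ b) ^ a
^-swap p a zero    = sym (1^ a)
^-swap p a (suc b) = trans (cong (p ^ a *_) (^-swap p a b)) (sym (*-^ p (p ^ b) a))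

-- Since `1 + y ≤ (1 + y/(J+1))^(J+1)`, exchanging the two exponents reduces the claim to `growth≤2`
-- at the smaller rate `y/(J+1)`.
growth≤2^ : ∀ {y} m J → 0ℚ ≤ y → 2ℚ * (ι m * y) ≤ ι (suc J) → (1ℚ + y) ^ m ≤ 2ℚ ^ suc J
growth≤2^ {y} m J 0≤y le with inverse (0<ι J)
... | i , 0<i , Ji≡1 = ≤-trans
  (^-mono m (0≤1 ⊹ 0≤y) (subst (λ z → 1ℚ + z ≤ (1ℚ + y * i) ^ suc J) Jyi≡y (bernoulli⁺ (suc J) 0≤yi)))
  (subst (_≤ 2ℚ ^ suc J) (^-swap (1ℚ + y * i) m (suc J))
    (^-mono (suc J) (0≤^ m (0≤1 ⊹ 0≤yi)) (growth≤2 m 0≤yi (subst₂ _≤_ (eq₂ (ι m) y i) Ji≡1 (*-monoʳ (<⇒≤ 0<i) le)))))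
  where
  0≤yi : 0ℚ ≤ y * i
  0≤yi = 0≤y ⊛ <⇒≤ 0<i
  eq₁ : ∀ J y i → J * (y * i) ≡ y * (J * i)
  eq₁ = solve-∀ ring
  eq₂ : ∀ M y i → 2ℚ * (M * y) * i ≡ 2ℚ * (M * (y * i))
  eq₂ = solve-∀ ring
  Jyi≡y : ι (suc J) * (y * i) ≡ y
  Jyi≡y = trans (eq₁ (ι (suc J)) y i) (trans (cong (y *_) Ji≡1) (*-identityʳ y))

-- Any `r ≥ 1/(η y)` works: then `η (1 + r y) ≥ 1`, while `decay-bernoulli` bounds the power by
-- `1/(1 + r y)`.
geometric-decay : ∀ {y η} → 0ℚ < y → y ≤ 1ℚ → 0ℚ < η → ∃ λ r → (1ℚ - y) ^ r ≤ η
geometric-decay {y} {η} 0<y y≤1 0<η with inverse (0<p*q 0<η 0<y)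
... | i , 0<i , ηyi≡1 with archimedean i
... | r , i≤r = r , (begin
  (1ℚ - y) ^ r                                ≤⟨ ≤-cert _ (eq (ι r) y η ((1ℚ - y) ^ r)) (<⇒≤ 0<η ⊛ 0≤P ⊹ p≤q⇒0≤q-p 1≤ηyr ⊛ 0≤P) ⟩
  η * ((1ℚ - y) ^ r * (1ℚ + ι r * y))         ≤⟨ *-monoˡ (<⇒≤ 0<η) (decay-bernoulli r (<⇒≤ 0<y) y≤1) ⟩
  η * 1ℚ                                      ≡⟨ *-identityʳ η ⟩
  η                                           ∎)
  where
  open ≤-Reasoning
  0≤P : 0ℚ ≤ (1ℚ - y) ^ r
  0≤P = 0≤^ r (p≤q⇒0≤q-p y≤1)
  1≤ηyr : 1ℚ ≤ η * y * ι r
  1≤ηyr = subst (_≤ η * y * ι r) ηyi≡1 (*-monoˡ (<⇒≤ (0<p*q 0<η 0<y)) i≤r)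
  eq : ∀ R y η P → η * (P * (1ℚ + R * y)) ≡ P + (η * P + (η * y * R - 1ℚ) * P)
  eq = solve-∀ ring

-- The power `x ^ suc j` lies above its tangent at `b`. In the induction the new defect is `a` times
-- the old one plus a nonnegative multiple of `(a - b)²`.
weighted-AM-GM : ∀ {a b} j → 0ℚ ≤ a → 0ℚ ≤ b → ι (suc j) * (b ^ j * a) ≤ a ^ suc j + ι j * b ^ suc j
weighted-AM-GM {a} {b} zero    0≤a 0≤b = ≤-reflexive (eq a b)
  where
  eq : ∀ a b → (1ℚ + 0ℚ) * (1ℚ * a) ≡ a * 1ℚ + 0ℚ * (b * 1ℚ)
  eq = solve-∀ ring
weighted-AM-GM {a} {b} (suc j) 0≤a 0≤b = ≤-cert _ (eq a b (ι j) (a ^ suc j) (b ^ j))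
  (0≤a ⊛ p≤q⇒0≤q-p (weighted-AM-GM j 0≤a 0≤b) ⊹ 0≤ι (suc j) ⊛ 0≤^ j 0≤b ⊛ sq-nonneg (a - b))
  where
  eq : ∀ a b J A B → a * A + (1ℚ + J) * (b * (b * B)) ≡
    (1ℚ + (1ℚ + J)) * (b * B * a) + (a * (A + J * (b * B) - (1ℚ + J) * (B * a)) + (1ℚ + J) * B * ((a - b) * (a - b)))
  eq = solve-∀ ring

-- This closes the induction over the number of steps in `Pr-upper`.
two-binomial-terms : ∀ {R} j → 0ℚ ≤ R → R ^ suc j + ι (suc j) * R ^ j ≤ (1ℚ + R) ^ suc j
two-binomial-terms {R} zero    0≤R = ≤-reflexive (eq R)
  where
  eq : ∀ R → R * 1ℚ + (1ℚ + 0ℚ) * 1ℚ ≡ (1ℚ + R) * 1ℚ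
  eq = solve-∀ ring
two-binomial-terms {R} (suc j) 0≤R = ≤-trans
  (≤-cert _ (eq R (ι j) (R ^ j)) (0≤ι (suc j) ⊛ 0≤^ j 0≤R))
  (*-monoˡ (0≤1 ⊹ 0≤R) (two-binomial-terms j 0≤R))
  where
  eq : ∀ R J X → (1ℚ + R) * (R * X + (1ℚ + J) * X) ≡
    (R * (R * X) + (1ℚ + (1ℚ + J)) * (R * X)) + (1ℚ + J) * X
  eq = solve-∀ ring

-- Near-perfect covers of hypergraphs with small codegrees

module _ {P : Set} where

  ∑-─ : (ps : List P) {x : P} (x∈ps : x ∈ ps) (f : P → ℚ) → ∑ ps f ≡ f x + ∑ (ps ─ x∈ps) f
  ∑-─ (x ∷ ps) (here refl) f = refl
  ∑-─ (p ∷ ps) {x} (there x∈ps) f = trans (cong (f p +_) (∑-─ ps x∈ps f)) (eq (f p) (f x) (∑ (ps ─ x∈ps) f))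
    where
    eq : ∀ a b c → a + (b + c) ≡ b + (a + c)
    eq = solve-∀ ring

  any-─ : (q : P → Bool) (ps : List P) {x : P} (x∈ps : x ∈ ps) → q x ≡ false → any q ps ≡ any q (ps ─ x∈ps)
  any-─ q (x ∷ ps) (here refl) qx≡f = cong (_∨ any q ps) qx≡f
  any-─ q (p ∷ ps) (there x∈ps) qx≡f = cong (q p ∨_) (any-─ q ps x∈ps qx≡f)

  ∈-─⁻ : (ps : List P) {x z : P} (x∈ps : x ∈ ps) → z ∈ (ps ─ x∈ps) → z ∈ ps
  ∈-─⁻ (x ∷ ps) (here refl) z∈ = there z∈
  ∈-─⁻ (p ∷ ps) (there x∈ps) (here refl) = here refl
  ∈-─⁻ (p ∷ ps) (there x∈ps) (there z∈) = there (∈-─⁻ ps x∈ps z∈)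

  ─-≢ : {ps : List P} → Unique ps → {x z : P} (x∈ps : x ∈ ps) → z ∈ (ps ─ x∈ps) → z ≢ x
  ─-≢ (x∉ ∷ _) (here refl) z∈ refl = All.lookup x∉ z∈ refl
  ─-≢ (p∉ ∷ _) (there x∈ps) (here refl) refl = All.lookup p∉ x∈ps refl
  ─-≢ (_ ∷ uniq) (there x∈ps) (there z∈) = ─-≢ uniq x∈ps z∈

  ─-unique : {ps : List P} → Unique ps → {x : P} (x∈ps : x ∈ ps) → Unique (ps ─ x∈ps)
  ─-unique (_ ∷ uniq) (here refl) = uniq
  ─-unique {p ∷ ps} (p∉ ∷ uniq) (there x∈ps) = All.tabulate (λ z∈ → All.lookup p∉ (∈-─⁻ ps x∈ps z∈)) ∷ ─-unique uniq x∈ps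

  any⇒1≤∑ : (q : P → Bool) (ps : List P) → χ (any q ps) ≤ ∑ ps (χ ∘ q)
  any⇒1≤∑ q []       = ≤-refl
  any⇒1≤∑ q (p ∷ ps) with q p
  ... | true  = subst (_≤ 1ℚ + ∑ ps (χ ∘ q)) (+-identityʳ 1ℚ) (+-monoʳ-≤ 1ℚ (0≤∑ ps λ {x} _ → 0≤χ (q x)))
  ... | false = subst (χ (any q ps) ≤_) (sym (+-identityˡ (∑ ps (χ ∘ q)))) (any⇒1≤∑ q ps)

  ¬any⇒∑≡0 : (q : P → Bool) (ps : List P) → any q ps ≡ false → ∑ ps (χ ∘ q) ≡ 0ℚ
  ¬any⇒∑≡0 q []       _ = refl
  ¬any⇒∑≡0 q (p ∷ ps) none with q p
  ... | false = trans (+-identityˡ (∑ ps (χ ∘ q))) (¬any⇒∑≡0 q ps none)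

  -- Bonferroni, in the form 2c − c² ≤ [c ≥ 1].
  2c-c²≤any : (q : P → Bool) (ps : List P) → let c = ∑ ps (χ ∘ q) in 2ℚ * c - c * c ≤ χ (any q ps)
  2c-c²≤any q ps with any q ps in eq
  ... | true  = ≤-cert _ (id₁ (∑ ps (χ ∘ q))) (sq-nonneg (1ℚ - ∑ ps (χ ∘ q)))
    where
    id₁ : ∀ c → 1ℚ ≡ (2ℚ * c - c * c) + (1ℚ - c) * (1ℚ - c)
    id₁ = solve-∀ ring
  ... | false = ≤-reflexive (trans (cong (λ c → 2ℚ * c - c * c) (¬any⇒∑≡0 q ps eq)) refl)

  ∑-filter-false : (q : P → Bool) (ps : List P) (f : P → ℚ) →
    ∑ (filter (λ p → q p Bool.≟ false) ps) f ≡ (∑[ p ∈ ps ] (1ℚ - χ (q p)) * f p)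
  ∑-filter-false q []       f = refl
  ∑-filter-false q (p ∷ ps) f with q p
  ... | true  = trans (∑-filter-false q ps f) (eq (f p) _)
    where
    eq : ∀ a b → b ≡ (1ℚ - 1ℚ) * a + b
    eq = solve-∀ ring
  ... | false = trans (cong (f p +_) (∑-filter-false q ps f)) (eq (f p) _)
    where
    eq : ∀ a b → a + b ≡ (1ℚ - 0ℚ) * a + b
    eq = solve-∀ ring

module System {P I : Set} (mem : I → P → Bool) (xs : List I) where

  m : I → P → ℚ
  m A T = χ (mem A T)

  size : List P → I → ℚ
  size ps A = ∑ ps (m A)

  deg : (I → ℚ) → P → ℚ
  deg y T = ∑[ A ∈ xs ] y A * m A T

  codeg : (I → ℚ) → P → P → ℚ
  codeg y T T′ = ∑[ A ∈ xs ] y A * (m A T * m A T′)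

  meets : List P → I → I → Bool
  meets ps A B = any (λ T → mem A T ∧ mem B T) ps

  0≤m : ∀ A T → 0ℚ ≤ m A T
  0≤m A T = 0≤χ (mem A T)

  -- Both quantities weigh the blocks that meet `A`: `H` counts each once, `Q` once per common
  -- point. Small codegrees make them nearly equal, so the degrees predict how much weight is
  -- discarded.
  module Meeting (y : I → ℚ) (0≤y : ∀ {A} → A ∈ xs → 0ℚ ≤ y A) (qs : List P) (A : I) where

    H : ℚ
    H = ∑[ B ∈ xs ] y B * χ (meets qs A B)

    Q : ℚ
    Q = ∑[ T ∈ qs ] m A T * deg y T

    common : I → ℚ
    common B = ∑[ T ∈ qs ] χ (mem A T ∧ mem B T)

    ∑-common : (∑[ B ∈ xs ] y B * common B) ≡ Q
    ∑-common = trans (∑-cong xs λ {B} _ → sym (∑-* (y B) qs _))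
      (trans (∑-swap xs qs (λ B T → y B * χ (mem A T ∧ mem B T))) (∑-cong qs λ {T} _ → trans
        (∑-cong xs λ {B} _ → trans (cong (y B *_) (χ-∧ (mem A T) (mem B T))) (eq (y B) (m A T) (m B T)))
        (∑-* (m A T) xs _)))
      where
      eq : ∀ a b c → a * (b * c) ≡ b * (a * c)
      eq = solve-∀ ring

    0≤H : 0ℚ ≤ H
    0≤H = 0≤∑ xs λ {B} B∈ → 0≤y B∈ ⊛ 0≤χ (meets qs A B)

    H≤Q : H ≤ Q
    H≤Q = subst (H ≤_) ∑-common (∑-mono xs λ {B} B∈ → *-monoˡ (0≤y B∈) (any⇒1≤∑ (λ T → mem A T ∧ mem B T) qs))

    -- By Bonferroni the overcount is at most the weight of ordered pairs of distinct common points.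
    -- At most k² such pairs lie in `A`, and each lies in blocks of weight at most `κ`.
    Q≤H+κk² : ∀ {κ k} → Unique qs → 0ℚ ≤ κ → 0ℚ ≤ k → size qs A ≤ k →
      (∀ {T T′} → T ∈ qs → T′ ∈ qs → T′ ≢ T → codeg y T T′ ≤ κ) → Q ≤ H + κ * (k * k)
    Q≤H+κk² {κ} {k} uniq 0≤κ 0≤k size≤k codeg≤κ = begin
      Q                ≤⟨ Q≤H+E ⟩
      H + E            ≤⟨ +-monoʳ-≤ H E≤ ⟩
      H + κ * (k * k)  ∎
      where
      open ≤-Reasoning
      a : P → I → ℚ
      a T B = χ (mem A T ∧ mem B T)
      E : ℚ
      E = ∑[ B ∈ xs ] y B * (common B * common B - common B)
      eq₂ : ∀ y c h → y * h + y * (c * c - c) ≡ y * c + y * (h - (2ℚ * c - c * c))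
      eq₂ = solve-∀ ring
      Q≤H+E : Q ≤ H + E
      Q≤H+E = subst₂ _≤_ ∑-common (∑-+ xs _ _) (∑-mono xs λ {B} B∈ →
        ≤-cert _ (eq₂ (y B) (common B) (χ (meets qs A B)))
          (0≤y B∈ ⊛ p≤q⇒0≤q-p (2c-c²≤any (λ T → mem A T ∧ mem B T) qs)))
      pair : ∀ {T} → T ∈ qs → (∑[ B ∈ xs ] y B * (a T B * common B - a T B)) ≤ m A T * (κ * k)
      pair {T} T∈ = begin
        (∑[ B ∈ xs ] y B * (a T B * common B - a T B))
          -- The term `T′ = T` of the product is `a T B` by idempotence of indicators, so
          -- subtracting `a T B` leaves exactly the pairs with `T′ ≢ T`.
          ≡⟨ ∑-cong xs (λ {B} _ → trans (trans (cong (λ c → y B * (a T B * c - a T B)) (∑-─ qs T∈ (λ T′ → a T′ B)))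
               (trans (cong (λ z → y B * z) (trans (eq₃ (a T B) (∑ rest (λ T′ → a T′ B)))
                 (trans (cong (λ z → z - a T B + a T B * ∑ rest (λ T′ → a T′ B)) (χ² (mem A T ∧ mem B T))) (eq₄ (a T B) (∑ rest (λ T′ → a T′ B))))))
                 (sym (*-assoc (y B) (a T B) _)))) (sym (∑-* (y B * a T B) rest (λ T′ → a T′ B)))) ⟩
        (∑[ B ∈ xs ] ∑[ T′ ∈ rest ] y B * a T B * a T′ B)
          ≡⟨ ∑-swap xs rest _ ⟩
        (∑[ T′ ∈ rest ] ∑[ B ∈ xs ] y B * a T B * a T′ B)
          ≡⟨ ∑-cong rest (λ {T′} _ → trans (∑-cong xs λ {B} _ → trans
               (cong₂ (λ p q → y B * p * q) (χ-∧ (mem A T) (mem B T)) (χ-∧ (mem A T′) (mem B T′)))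
               (eq₅ (y B) (m A T) (m B T) (m A T′) (m B T′))) (∑-* (m A T * m A T′) xs _)) ⟩
        (∑[ T′ ∈ rest ] m A T * m A T′ * codeg y T T′)
          ≤⟨ ∑-mono rest (λ {T′} T′∈ → *-monoˡ (0≤m A T ⊛ 0≤m A T′) (codeg≤κ T∈ (∈-─⁻ qs T∈ T′∈) (─-≢ uniq T∈ T′∈))) ⟩
        (∑[ T′ ∈ rest ] m A T * m A T′ * κ)
          ≡⟨ trans (∑-cong rest λ {T′} _ → eq₆ (m A T) (m A T′) κ) (∑-* (m A T * κ) rest (m A)) ⟩
        m A T * κ * size rest A
          ≤⟨ *-monoˡ (0≤m A T ⊛ 0≤κ) (≤-trans (≤-cert (m A T) (trans (∑-─ qs T∈ (m A)) (+-comm (m A T) _)) (0≤m A T)) size≤k) ⟩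
        m A T * κ * k
          ≡⟨ *-assoc (m A T) κ k ⟩
        m A T * (κ * k) ∎
        where
        rest : List P
        rest = qs ─ T∈
        eq₃ : ∀ a c → a * (a + c) - a ≡ a * a - a + a * c
        eq₃ = solve-∀ ring
        eq₄ : ∀ a c → a - a + a * c ≡ a * c
        eq₄ = solve-∀ ring
        eq₅ : ∀ y a b c d → y * (a * b) * (c * d) ≡ a * c * (y * (b * d))
        eq₅ = solve-∀ ring
        eq₆ : ∀ a b c → a * b * c ≡ a * c * b
        eq₆ = solve-∀ ring
      E≤ : E ≤ κ * (k * k)
      E≤ = begin
        E
          ≡⟨ ∑-cong xs (λ {B} _ → trans (cong (y B *_) (trans (cong (_- common B) (sym (∑-*ʳ (common B) qs _))) (sym (∑-- qs _ _)))) (sym (∑-* (y B) qs _))) ⟩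
        (∑[ B ∈ xs ] ∑[ T ∈ qs ] y B * (a T B * common B - a T B))
          ≡⟨ ∑-swap xs qs _ ⟩
        (∑[ T ∈ qs ] ∑[ B ∈ xs ] y B * (a T B * common B - a T B))
          ≤⟨ ∑-mono qs pair ⟩
        (∑[ T ∈ qs ] m A T * (κ * k))
          ≡⟨ ∑-*ʳ (κ * k) qs (m A) ⟩
        size qs A * (κ * k)
          ≤⟨ *-monoʳ (0≤κ ⊛ 0≤k) size≤k ⟩
        k * (κ * k)
          ≡⟨ eq₇ k κ ⟩
        κ * (k * k) ∎
        where
        eq₇ : ∀ k κ → k * (κ * k) ≡ κ * (k * k)
        eq₇ = solve-∀ ring

-- One step of the nibble: block B is added to the cover, the blocks meeting it are discarded, and the
-- weight of a block A is rescaled by 1 + (|A| − 1)/W, the inverse of its survival probability to first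
-- order when B is chosen with probability y B / W.
module Step {P I : Set} (mem : I → P → Bool) (xs : List I) (ps : List P) (uniq : Unique ps)
  (y : I → ℚ) (0≤y : ∀ {A} → A ∈ xs → 0ℚ ≤ y A) (lam k S κ : ℚ) where

  open System mem xs public

  W : ℚ
  W = ∑ xs y

  error : (I → ℚ) → P → ℚ
  error y T = deg y T - 1ℚ

  -- It vanishes exactly when the weights form a perfect fractional matching of the surviving
  -- points, which is the situation at the start.
  Ψ : List P → (I → ℚ) → ℚ
  Ψ ps y = ∑[ T ∈ ps ] error y T * error y T

  z : I → ℚ
  z A = y A * (1ℚ + lam * (size ps A - 1ℚ))

  survivors : I → List P
  survivors B = filter (λ T → mem B T Bool.≟ false) ps

  updated : I → I → ℚ
  updated B A = z A * (1ℚ - χ (meets ps A B))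

  module Bounds (W*lam≡1 : W * lam ≡ 1ℚ) (0≤lam : 0ℚ ≤ lam) (1≤k : 1ℚ ≤ k) (1≤S : 1ℚ ≤ S) (0≤κ : 0ℚ ≤ κ)
    (k*lam≤1 : k * lam ≤ 1ℚ)
    (size≤k : ∀ {A} → A ∈ xs → size ps A ≤ k)
    (deg≤S : ∀ {T} → T ∈ ps → deg y T ≤ S)
    (codeg≤κ : ∀ {T T′} → T ∈ ps → T′ ∈ ps → T′ ≢ T → codeg y T T′ ≤ κ) where

    0≤k : 0ℚ ≤ k
    0≤k = ≤-trans 0≤1 1≤k

    0≤S : 0ℚ ≤ S
    0≤S = ≤-trans 0≤1 1≤S

    0≤size : ∀ qs A → 0ℚ ≤ size qs A
    0≤size qs A = 0≤∑ qs λ {T} _ → 0≤m A T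

    0≤deg : ∀ T → 0ℚ ≤ deg y T
    0≤deg T = 0≤∑ xs λ {A} A∈ → 0≤y A∈ ⊛ 0≤m A T

    lam≤1 : lam ≤ 1ℚ
    lam≤1 = ≤-trans (subst (_≤ k * lam) (*-identityˡ lam) (*-monoʳ 0≤lam 1≤k)) k*lam≤1

    0≤z : ∀ {A} → A ∈ xs → 0ℚ ≤ z A
    0≤z {A} A∈ = 0≤y A∈ ⊛ subst (0ℚ ≤_) (eq lam (size ps A)) (p≤q⇒0≤q-p lam≤1 ⊹ 0≤lam ⊛ 0≤size ps A)
      where
      eq : ∀ l s → (1ℚ - l) + l * s ≡ 1ℚ + l * (s - 1ℚ)
      eq = solve-∀ ring

    z≤[1+k*lam]y : ∀ {A} → A ∈ xs → z A ≤ (1ℚ + k * lam) * y A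
    z≤[1+k*lam]y {A} A∈ = ≤-cert _ (eq (y A) lam (size ps A) k) (0≤y A∈ ⊛ 0≤lam ⊛ (p≤q⇒0≤q-p (size≤k A∈) ⊹ 0≤1))
      where
      eq : ∀ y l s k → (1ℚ + k * l) * y ≡ y * (1ℚ + l * (s - 1ℚ)) + y * l * ((k - s) + 1ℚ)
      eq = solve-∀ ring

    z≤2y : ∀ {A} → A ∈ xs → z A ≤ 2ℚ * y A
    z≤2y A∈ = ≤-trans (z≤[1+k*lam]y A∈) (*-monoʳ (0≤y A∈) (+-monoʳ-≤ 1ℚ k*lam≤1))

    deg≡ : ∀ T → deg y T ≡ 1ℚ + error y T
    deg≡ T = eq (deg y T)
      where
      eq : ∀ d → d ≡ 1ℚ + (d - 1ℚ)
      eq = solve-∀ ring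

    -- Only a block `B` avoiding `T` leaves `T` alive, and it meets `A` in `ps` exactly when it
    -- meets `A` in `qs`. Defining the loss `L B` through `qs` for every `B` lets it be averaged
    -- over all blocks, without conditioning on the survival of `T`. `G` is the gain from rescaling.
    module Point {T : P} (T∈ : T ∈ ps) where

      qs : List P
      qs = ps ─ T∈

      module M A = Meeting y 0≤y qs A
      open M using (H; Q)

      q : I → ℚ
      q A = size qs A

      e G ρ : ℚ
      e = error y T
      G = lam * (∑[ A ∈ xs ] y A * m A T * q A)
      ρ = k * k * (S * S) * (κ + lam)

      L : I → ℚ
      L B = ∑[ A ∈ xs ] z A * m A T * χ (meets qs A B)

      size≡ : ∀ A → size ps A ≡ m A T + q A
      size≡ A = ∑-─ ps T∈ (m A)

      q≤k : ∀ {A} → A ∈ xs → q A ≤ k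
      q≤k {A} A∈ = ≤-trans (≤-cert (m A T) (trans (size≡ A) (+-comm (m A T) (q A))) (0≤m A T)) (size≤k A∈)

      0≤q : ∀ A → 0ℚ ≤ q A
      0≤q = 0≤size qs

      -- For a block through `T` the factor `size ps A - 1ℚ` is the number `q A` of its other
      -- points; the remaining blocks vanish.
      zm≡ : ∀ A → z A * m A T ≡ y A * m A T + lam * (y A * m A T * q A)
      zm≡ A = trans (cong (λ s → y A * (1ℚ + lam * (s - 1ℚ)) * m A T) (size≡ A))
        (trans (eq₁ (y A) lam (m A T) (q A)) (trans (cong (λ c → y A * (m A T + lam * (c + m A T * q A - m A T))) (χ² (mem A T)))
          (eq₂ (y A) lam (m A T) (q A))))
        where
        eq₁ : ∀ y l m q → y * (1ℚ + l * (m + q - 1ℚ)) * m ≡ y * (m + l * (m * m + m * q - m))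
        eq₁ = solve-∀ ring
        eq₂ : ∀ y l m q → y * (m + l * (m + m * q - m)) ≡ y * m + l * (y * m * q)
        eq₂ = solve-∀ ring

      degz≡ : (∑[ A ∈ xs ] z A * m A T) ≡ deg y T + G
      degz≡ = trans (∑-cong xs λ {A} _ → zm≡ A) (trans (∑-+ xs _ _) (cong (deg y T +_) (∑-* lam xs _)))

      ymq≤kS : (∑[ A ∈ xs ] y A * m A T * q A) ≤ k * S
      ymq≤kS = ≤-trans (∑-mono xs λ {A} A∈ → *-monoˡ (0≤y A∈ ⊛ 0≤m A T) (q≤k A∈))
        (subst (_≤ k * S) (trans (*-comm k (deg y T)) (sym (∑-*ʳ k xs _))) (*-monoˡ 0≤k (deg≤S T∈)))

      0≤ymq : 0ℚ ≤ (∑[ A ∈ xs ] y A * m A T * q A)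
      0≤ymq = 0≤∑ xs λ {A} A∈ → 0≤y A∈ ⊛ 0≤m A T ⊛ 0≤q A

      0≤G : 0ℚ ≤ G
      0≤G = 0≤lam ⊛ 0≤ymq

      WG≡ : W * G ≡ (∑[ A ∈ xs ] y A * m A T * q A)
      WG≡ = trans (sym (*-assoc W lam _)) (trans (cong (_* (∑[ A ∈ xs ] y A * m A T * q A)) W*lam≡1) (*-identityˡ _))

      WG²≤ : W * (G * G) ≤ lam * (k * k * (S * S))
      WG²≤ = subst₂ _≤_ (trans (cong (λ w → lam * (w * w)) (sym WG≡)) (trans (eq₁ lam W G) (trans (cong (λ u → u * (W * (G * G))) W*lam≡1) (*-identityˡ _)))) (eq₂ lam k S)
        (*-monoˡ 0≤lam (*-mono 0≤ymq (0≤k ⊛ 0≤S) ymq≤kS ymq≤kS))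
        where
        eq₁ : ∀ l w g → l * (w * g * (w * g)) ≡ w * l * (w * (g * g))
        eq₁ = solve-∀ ring
        eq₂ : ∀ l k s → l * (k * s * (k * s)) ≡ l * (k * k * (s * s))
        eq₂ = solve-∀ ring

      0≤zm : ∀ {A} → A ∈ xs → 0ℚ ≤ z A * m A T
      0≤zm {A} A∈ = 0≤z A∈ ⊛ 0≤m A T

      0≤L : ∀ B → 0ℚ ≤ L B
      0≤L B = 0≤∑ xs λ {A} A∈ → 0≤zm A∈ ⊛ 0≤χ (meets qs A B)

      ∑yL≡ : (∑[ B ∈ xs ] y B * L B) ≡ (∑[ A ∈ xs ] z A * m A T * H A)
      ∑yL≡ = trans (∑-cong xs λ {B} _ → sym (∑-* (y B) xs _)) (trans (∑-swap xs xs _)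
        (∑-cong xs λ {A} _ → trans (∑-cong xs λ {B} _ → eq (y B) (z A * m A T) (χ (meets qs A B))) (∑-* (z A * m A T) xs _)))
        where
        eq : ∀ a b c → a * (b * c) ≡ b * (a * c)
        eq = solve-∀ ring

      codeg≤ : ∀ {T′} → T′ ∈ qs → codeg y T T′ ≤ κ
      codeg≤ T′∈ = codeg≤κ T∈ (∈-─⁻ ps T∈ T′∈) (─-≢ uniq T∈ T′∈)

      Q≤kS : ∀ {A} → A ∈ xs → Q A ≤ k * S
      Q≤kS {A} A∈ = ≤-trans (∑-mono qs λ {T′} T′∈ → *-monoˡ (0≤m A T′) (deg≤S (∈-─⁻ ps T∈ T′∈)))
        (subst (_≤ k * S) (sym (∑-*ʳ S qs (m A))) (*-monoʳ 0≤S (q≤k A∈)))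

      H≤kS : ∀ {A} → A ∈ xs → H A ≤ k * S
      H≤kS {A} A∈ = ≤-trans (M.H≤Q A) (Q≤kS A∈)

      -- `B` has at most `k` points, each sharing blocks of weight at most `κ` with `T`; the factor
      -- 2 accounts for the rescaling.
      L≤ : ∀ {B} → B ∈ xs → L B ≤ 2ℚ * κ * k
      L≤ {B} B∈ = begin
        L B
          ≤⟨ ∑-mono xs (λ {A} A∈ → *-mono (0≤zm A∈) (0≤∑ qs λ {T′} _ → 0≤χ _) (*-monoʳ (0≤m A T) (z≤2y A∈)) (any⇒1≤∑ _ qs)) ⟩
        (∑[ A ∈ xs ] 2ℚ * y A * m A T * M.common A B)
          ≡⟨ trans (∑-cong xs λ {A} _ → sym (∑-* (2ℚ * y A * m A T) qs _)) (∑-swap xs qs _) ⟩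
        (∑[ T′ ∈ qs ] ∑[ A ∈ xs ] 2ℚ * y A * m A T * χ (mem A T′ ∧ mem B T′))
          ≡⟨ ∑-cong qs (λ {T′} _ → trans (∑-cong xs λ {A} _ → trans (cong (2ℚ * y A * m A T *_) (χ-∧ (mem A T′) (mem B T′)))
               (eq₁ (y A) (m A T) (m A T′) (m B T′))) (∑-* (2ℚ * m B T′) xs _)) ⟩
        (∑[ T′ ∈ qs ] 2ℚ * m B T′ * codeg y T T′)
          ≤⟨ ∑-mono qs (λ {T′} T′∈ → *-monoˡ ((0≤1 ⊹ 0≤1) ⊛ 0≤m B T′) (codeg≤ T′∈)) ⟩
        (∑[ T′ ∈ qs ] 2ℚ * m B T′ * κ)
          ≡⟨ trans (∑-cong qs λ {T′} _ → eq₂ (m B T′) κ) (∑-* (2ℚ * κ) qs (m B)) ⟩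
        2ℚ * κ * q B
          ≤⟨ *-monoˡ ((0≤1 ⊹ 0≤1) ⊛ 0≤κ) (q≤k B∈) ⟩
        2ℚ * κ * k ∎
        where
        open ≤-Reasoning
        eq₁ : ∀ a b c d → 2ℚ * a * b * (c * d) ≡ 2ℚ * d * (a * (b * c))
        eq₁ = solve-∀ ring
        eq₂ : ∀ a b → 2ℚ * a * b ≡ 2ℚ * b * a
        eq₂ = solve-∀ ring

      ∑yL≤ : (∑[ B ∈ xs ] y B * L B) ≤ 2ℚ * (k * (S * S))
      ∑yL≤ = begin
        (∑[ B ∈ xs ] y B * L B)                 ≡⟨ ∑yL≡ ⟩
        (∑[ A ∈ xs ] z A * m A T * H A)         ≤⟨ ∑-mono xs (λ {A} A∈ → *-mono (0≤zm A∈) (0≤k ⊛ 0≤S) (*-monoʳ (0≤m A T) (z≤2y A∈)) (H≤kS A∈)) ⟩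
        (∑[ A ∈ xs ] 2ℚ * y A * m A T * (k * S)) ≡⟨ trans (∑-cong xs λ {A} _ → eq₁ (y A) (m A T) (k * S)) (∑-*ʳ (2ℚ * (k * S)) xs _) ⟩
        deg y T * (2ℚ * (k * S))                ≤⟨ *-monoʳ ((0≤1 ⊹ 0≤1) ⊛ (0≤k ⊛ 0≤S)) (deg≤S T∈) ⟩
        S * (2ℚ * (k * S))                      ≡⟨ eq₂ S k ⟩
        2ℚ * (k * (S * S))                      ∎
        where
        open ≤-Reasoning
        eq₁ : ∀ a b c → 2ℚ * a * b * c ≡ a * b * (2ℚ * c)
        eq₁ = solve-∀ ring
        eq₂ : ∀ s k → s * (2ℚ * (k * s)) ≡ 2ℚ * (k * (s * s))
        eq₂ = solve-∀ ring

      -- Maximum times mean. The maximum is of order `κ`, so the second moment is too.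
      ∑yL²≤ : (∑[ B ∈ xs ] y B * (L B * L B)) ≤ 2ℚ * 2ℚ * κ * (k * k * (S * S))
      ∑yL²≤ = begin
        (∑[ B ∈ xs ] y B * (L B * L B))         ≤⟨ ∑-mono xs (λ {B} B∈ → *-monoˡ (0≤y B∈) (*-monoˡ (0≤L B) (L≤ B∈))) ⟩
        (∑[ B ∈ xs ] y B * (L B * (2ℚ * κ * k)))  ≡⟨ trans (∑-cong xs λ {B} _ → sym (*-assoc (y B) (L B) _)) (∑-*ʳ (2ℚ * κ * k) xs _) ⟩
        (∑[ B ∈ xs ] y B * L B) * (2ℚ * κ * k)  ≤⟨ *-monoʳ ((0≤1 ⊹ 0≤1) ⊛ 0≤κ ⊛ 0≤k) ∑yL≤ ⟩
        2ℚ * (k * (S * S)) * (2ℚ * κ * k)       ≡⟨ eq k S κ ⟩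
        2ℚ * 2ℚ * κ * (k * k * (S * S))         ∎
        where
        open ≤-Reasoning
        eq : ∀ k s c → 2ℚ * (k * (s * s)) * (2ℚ * c * k) ≡ 2ℚ * 2ℚ * c * (k * k * (s * s))
        eq = solve-∀ ring

      -- The drift of the error at T, apart from the quadratic form in the errors.
      R : ℚ
      R = ∑[ A ∈ xs ] (y A * m A T * Q A - z A * m A T * H A)

      private
        drift : I → ℚ
        drift A = y A * m A T * Q A - z A * m A T * H A

        drift≡ : ∀ A → drift A ≡ y A * m A T * (Q A - H A) - lam * (y A * m A T * q A * H A)
        drift≡ A = trans (cong (λ w → y A * m A T * Q A - w * H A) (zm≡ A)) (eq (y A * m A T) (Q A) (H A) lam (q A))
          where
          eq : ∀ a Q H l q → a * Q - (a + l * (a * q)) * H ≡ a * (Q - H) - l * (a * q * H)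
          eq = solve-∀ ring

      -- Only the overcount `Q - H` pushes `R` up. The lower bound below comes instead from the
      -- second-order effect of rescaling, the term with `lam`.
      R≤ρ : R ≤ ρ
      R≤ρ = begin
        R                                     ≤⟨ ∑-mono xs upper ⟩
        (∑[ A ∈ xs ] y A * m A T * (κ * (k * k)))  ≡⟨ ∑-*ʳ (κ * (k * k)) xs _ ⟩
        deg y T * (κ * (k * k))               ≤⟨ *-monoʳ (0≤κ ⊛ (0≤k ⊛ 0≤k)) (deg≤S T∈) ⟩
        S * (κ * (k * k))                     ≤⟨ ≤-cert _ (eq S κ k lam) (0≤k ⊛ 0≤k ⊛ 0≤S ⊛ (p≤q⇒0≤q-p 1≤S ⊛ 0≤κ ⊹ 0≤S ⊛ 0≤lam)) ⟩
        ρ                                     ∎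
        where
        open ≤-Reasoning
        eq : ∀ s c k l → k * k * (s * s) * (c + l) ≡ s * (c * (k * k)) + k * k * s * ((s - 1ℚ) * c + s * l)
        eq = solve-∀ ring
        eq′ : ∀ a c Q H d → a * c ≡ (a * (Q - H) - d) + (a * ((H + c) - Q) + d)
        eq′ = solve-∀ ring
        upper : ∀ {A} → A ∈ xs → drift A ≤ y A * m A T * (κ * (k * k))
        upper {A} A∈ = subst (_≤ y A * m A T * (κ * (k * k))) (sym (drift≡ A))
          (≤-cert _ (eq′ (y A * m A T) (κ * (k * k)) (Q A) (H A) (lam * (y A * m A T * q A * H A)))
            (0≤y A∈ ⊛ 0≤m A T ⊛ p≤q⇒0≤q-p (M.Q≤H+κk² A (─-unique uniq T∈) 0≤κ 0≤k (q≤k A∈)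
              λ a b → codeg≤κ (∈-─⁻ ps T∈ a) (∈-─⁻ ps T∈ b)) ⊹ 0≤lam ⊛ (0≤y A∈ ⊛ 0≤m A T ⊛ 0≤q A ⊛ M.0≤H A)))

      -ρ≤R : - ρ ≤ R
      -ρ≤R = begin
        - ρ                                   ≤⟨ ≤-cert _ (eq S κ k lam) (0≤k ⊛ 0≤k ⊛ (0≤S ⊛ 0≤S) ⊛ 0≤κ) ⟩
        S * (- (lam * (k * (k * S))))         ≤⟨ ≤-cert _ (eq″ S (deg y T) (lam * (k * (k * S)))) (p≤q⇒0≤q-p (deg≤S T∈) ⊛ (0≤lam ⊛ (0≤k ⊛ (0≤k ⊛ 0≤S)))) ⟩
        deg y T * (- (lam * (k * (k * S))))   ≡⟨ sym (∑-*ʳ _ xs _) ⟩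
        (∑[ A ∈ xs ] y A * m A T * (- (lam * (k * (k * S)))))  ≤⟨ ∑-mono xs lower ⟩
        R                                     ∎
        where
        open ≤-Reasoning
        eq : ∀ s c k l → s * (- (l * (k * (k * s)))) ≡ - (k * k * (s * s) * (c + l)) + k * k * (s * s) * c
        eq = solve-∀ ring
        eq″ : ∀ s d c → d * (- c) ≡ s * (- c) + (s - d) * c
        eq″ = solve-∀ ring
        eq′ : ∀ a l c Q H q → a * (Q - H) - l * (a * q * H) ≡ a * (- (l * c)) + (a * (Q - H) + l * (a * (c - q * H)))
        eq′ = solve-∀ ring
        lower : ∀ {A} → A ∈ xs → y A * m A T * (- (lam * (k * (k * S)))) ≤ drift A
        lower {A} A∈ = subst (y A * m A T * (- (lam * (k * (k * S)))) ≤_) (sym (drift≡ A))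
          (≤-cert _ (eq′ (y A * m A T) lam (k * (k * S)) (Q A) (H A) (q A))
            (0≤y A∈ ⊛ 0≤m A T ⊛ p≤q⇒0≤q-p (M.H≤Q A) ⊹ 0≤lam ⊛ (0≤y A∈ ⊛ 0≤m A T ⊛ p≤q⇒0≤q-p (*-mono (0≤q A) (0≤k ⊛ 0≤S) (q≤k A∈) (H≤kS A∈)))))

      D : ℚ
      D = ∑[ T′ ∈ ps ] codeg y T T′ * error y T′

      -- W (G − E[L]) is R − D, up to the diagonal term of D.
      drift-identity : W * G - (∑[ B ∈ xs ] y B * L B) ≡ R - (D - deg y T * e)
      drift-identity = trans (cong₂ _-_ WG≡ ∑yL≡) (trans (eq₁ (∑[ A ∈ xs ] y A * m A T * q A) _ (∑[ A ∈ xs ] y A * m A T * Q A))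
        (cong₂ _-_ (sym (∑-- xs _ _)) (trans (sym (∑-- xs _ _)) (trans ∑cd≡ D≡))))
        where
        eq₁ : ∀ a b c → a - b ≡ (c - b) - (c - a)
        eq₁ = solve-∀ ring
        eq₂ : ∀ a Q q → a * Q - a * q ≡ a * (Q - q)
        eq₂ = solve-∀ ring
        eq₃ : ∀ y a b f → y * a * (b * f) ≡ y * (a * b) * f
        eq₃ = solve-∀ ring
        eq₄ : ∀ a b → a * b - a ≡ a * (b - 1ℚ)
        eq₄ = solve-∀ ring
        eq₅ : ∀ a b c → c ≡ a + b → b ≡ c - a
        eq₅ a b c refl = eq₅′ a b
          where
          eq₅′ : ∀ a b → b ≡ a + b - a
          eq₅′ = solve-∀ ring
        diag : codeg y T T ≡ deg y T
        diag = ∑-cong xs λ {A} _ → cong (y A *_) (χ² (mem A T))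
        D≡ : (∑[ T′ ∈ qs ] codeg y T T′ * error y T′) ≡ D - deg y T * e
        D≡ = trans (eq₅ _ _ D (∑-─ ps T∈ _)) (cong (λ c → D - c * e) diag)
        ∑cd≡ : (∑[ A ∈ xs ] (y A * m A T * Q A - y A * m A T * q A)) ≡ (∑[ T′ ∈ qs ] codeg y T T′ * error y T′)
        ∑cd≡ = trans (∑-cong xs λ {A} _ → trans (eq₂ (y A * m A T) (Q A) (q A)) (trans (cong (y A * m A T *_)
            (trans (sym (∑-- qs _ _)) (∑-cong qs λ {T′} _ → eq₄ (m A T′) (deg y T′)))) (sym (∑-* (y A * m A T) qs _))))
          (trans (∑-swap xs qs _) (∑-cong qs λ {T′} _ → trans (∑-cong xs λ {A} _ → eq₃ (y A) (m A T) (m A T′) (error y T′)) (∑-*ʳ (error y T′) xs _)))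

      -- The interaction `e * D` is kept unestimated because it has a sign only after summation over
      -- `T`. Its diagonal part was separated by `drift-identity` and costs `2ℚ * S * (e * e)`.
      expected-square : (∑[ B ∈ xs ] y B * ((e + G - L B) * (e + G - L B))) ≤
        W * (e * e) + 2ℚ * S * (e * e) - 2ℚ * (e * D) + ρ * (1ℚ + e * e) + k * k * (S * S) * (lam + 2ℚ * 2ℚ * κ)
      expected-square = begin
        (∑[ B ∈ xs ] y B * ((e + G - L B) * (e + G - L B)))
          -- Gain and loss are both nonnegative, so the cross term `- 2 G L` of the square may be
          -- dropped.
          ≤⟨ ∑-mono xs (λ {B} B∈ → ≤-cert _ (eq₁ (y B) e G (L B)) (0≤y B∈ ⊛ ((0≤1 ⊹ 0≤1) ⊛ (0≤G ⊛ 0≤L B)))) ⟩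
        (∑[ B ∈ xs ] (y B * (e * e + 2ℚ * (e * G) + G * G) - 2ℚ * e * (y B * L B) + y B * (L B * L B)))
          ≡⟨ trans (∑-+ xs _ _) (cong (_+ (∑[ B ∈ xs ] y B * (L B * L B))) (trans (∑-- xs _ _) (cong₂ _-_ (∑-*ʳ _ xs y) (∑-* (2ℚ * e) xs _)))) ⟩
        W * (e * e + 2ℚ * (e * G) + G * G) - 2ℚ * e * (∑[ B ∈ xs ] y B * L B) + (∑[ B ∈ xs ] y B * (L B * L B))
          ≡⟨ eq₂ W e G (∑[ B ∈ xs ] y B * L B) _ ⟩
        W * (e * e) + 2ℚ * e * (W * G - (∑[ B ∈ xs ] y B * L B)) + W * (G * G) + (∑[ B ∈ xs ] y B * (L B * L B))
          ≡⟨ cong (λ d → W * (e * e) + 2ℚ * e * d + W * (G * G) + (∑[ B ∈ xs ] y B * (L B * L B))) drift-identity ⟩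
        W * (e * e) + 2ℚ * e * (R - (D - deg y T * e)) + W * (G * G) + (∑[ B ∈ xs ] y B * (L B * L B))
          ≤⟨ +-mono-≤ (+-monoʳ-≤ (W * (e * e) + 2ℚ * e * (R - (D - deg y T * e))) WG²≤) ∑yL²≤ ⟩
        W * (e * e) + 2ℚ * e * (R - (D - deg y T * e)) + lam * (k * k * (S * S)) + 2ℚ * 2ℚ * κ * (k * k * (S * S))
          -- Here `2 e R ≤ ρ (1 + e²)` encodes `|R| ≤ ρ`: the difference is half of
          -- `(ρ + R)(1 - e)² + (ρ - R)(1 + e)²`.
          ≤⟨ ≤-cert _ (eq₃ (W * (e * e)) e R D (deg y T) S ρ lam (k * k * (S * S)) κ)
               ((0≤1 ⊹ 0≤1) ⊛ (p≤q⇒0≤q-p (deg≤S T∈) ⊛ sq-nonneg e) ⊹ 0≤½ ⊛ (0≤ρ+R ⊛ sq-nonneg (1ℚ - e) ⊹ p≤q⇒0≤q-p R≤ρ ⊛ sq-nonneg (1ℚ + e))) ⟩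
        W * (e * e) + 2ℚ * S * (e * e) - 2ℚ * (e * D) + ρ * (1ℚ + e * e) + k * k * (S * S) * (lam + 2ℚ * 2ℚ * κ) ∎
        where
        open ≤-Reasoning
        0≤½ : 0ℚ ≤ ½
        0≤½ = nonNegative⁻¹ ½
        0≤ρ+R : 0ℚ ≤ ρ + R
        0≤ρ+R = subst (0ℚ ≤_) (eq R ρ) (p≤q⇒0≤q-p -ρ≤R)
          where
          eq : ∀ r p → r - (- p) ≡ p + r
          eq = solve-∀ ring
        eq₁ : ∀ y e G L → y * (e * e + 2ℚ * (e * G) + G * G) - 2ℚ * e * (y * L) + y * (L * L) ≡
          y * ((e + G - L) * (e + G - L)) + y * (2ℚ * (G * L))
        eq₁ = solve-∀ ring
        eq₂ : ∀ w e G s t → w * (e * e + 2ℚ * (e * G) + G * G) - 2ℚ * e * s + t ≡ w * (e * e) + 2ℚ * e * (w * G - s) + w * (G * G) + t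
        eq₂ = solve-∀ ring
        eq₃ : ∀ w e R D d S ρ l c κ → w + 2ℚ * S * (e * e) - 2ℚ * (e * D) + ρ * (1ℚ + e * e) + c * (l + 2ℚ * 2ℚ * κ) ≡
          (w + 2ℚ * e * (R - (D - d * e)) + l * c + 2ℚ * 2ℚ * κ * c) +
          (2ℚ * ((S - d) * (e * e)) + ½ * ((ρ + R) * ((1ℚ - e) * (1ℚ - e)) + (ρ - R) * ((1ℚ + e) * (1ℚ + e))))
        eq₃ = solve-∀ ring

    n : ℚ
    n = ι (length ps)

    ρ c : ℚ
    ρ = k * k * (S * S) * (κ + lam)
    c = ρ + k * k * (S * S) * (lam + 2ℚ * 2ℚ * κ)

    D : P → ℚ
    D T = ∑[ T′ ∈ ps ] codeg y T T′ * error y T′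

    -- The interaction of the errors at different points is minus the positive semidefinite form
    -- Σ_A y A (Σ_T m A T e_T)², so it does not increase Ψ.
    0≤∑eD : 0ℚ ≤ (∑[ T ∈ ps ] error y T * D T)
    0≤∑eD = subst (0ℚ ≤_) ∑ye²≡ (0≤∑ xs λ {A} A∈ → 0≤y A∈ ⊛ sq-nonneg (∑ ps (λ T → m A T * error y T)))
      where
      v : I → ℚ
      v A = ∑[ T ∈ ps ] m A T * error y T
      eq : ∀ a b c d e → e * (b * (c * d) * a) ≡ b * ((c * e) * (d * a))
      eq = solve-∀ ring
      ∑ye²≡ : (∑[ A ∈ xs ] y A * (v A * v A)) ≡ (∑[ T ∈ ps ] error y T * D T)
      ∑ye²≡ = sym (trans (∑-cong ps λ {T} _ → trans (trans (sym (∑-* (error y T) ps _)) (∑-cong ps λ {T′} _ →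
            trans (cong (error y T *_) (sym (∑-*ʳ (error y T′) xs _))) (trans (sym (∑-* (error y T) xs _))
              (∑-cong xs λ {A} _ → eq (error y T′) (y A) (m A T) (m A T′) (error y T)))))
          (∑-swap ps xs _)) (trans (∑-swap ps xs _) (∑-cong xs λ {A} _ →
          trans (∑-cong ps λ {T} _ → ∑-* (y A) ps _) (trans (∑-* (y A) ps _) (cong (y A *_)
            (trans (∑-cong ps λ {T} _ → ∑-* (m A T * error y T) ps _) (∑-*ʳ (v A) ps _)))))))

    deg-updated : ∀ {T} (T∈ : T ∈ ps) {B} → mem B T ≡ false → error (updated B) T ≡ Point.e T∈ + Point.G T∈ - Point.L T∈ B
    deg-updated {T} T∈ {B} T∉B = trans (cong (_- 1ℚ) (trans (∑-cong xs λ {A} _ →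
          trans (cong (λ b → z A * (1ℚ - χ b) * m A T) (any-─ _ ps T∈ (trans (cong (mem A T ∧_) T∉B) (Bool.∧-zeroʳ (mem A T)))))
            (eq₁ (z A) (χ (meets qs A B)) (m A T)))
        (trans (∑-- xs _ _) (cong (_- L B) degz≡)))) (eq₂ (deg y T) G (L B))
      where
      open Point T∈
      eq₁ : ∀ z h m → z * (1ℚ - h) * m ≡ z * m - z * m * h
      eq₁ = solve-∀ ring
      eq₂ : ∀ d G L → d + G - L - 1ℚ ≡ d - 1ℚ + G - L
      eq₂ = solve-∀ ring

    expected-Ψ : (∑[ B ∈ xs ] y B * Ψ (survivors B) (updated B)) ≤ W * Ψ ps y + (2ℚ * S + ρ) * Ψ ps y + n * c
    expected-Ψ = begin
      (∑[ B ∈ xs ] y B * Ψ (survivors B) (updated B))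
        ≡⟨ trans (∑-cong xs λ {B} _ → trans (cong (y B *_) (∑-filter-false (mem B) ps _)) (sym (∑-* (y B) ps _))) (∑-swap xs ps _) ⟩
      (∑[ T ∈ ps ] ∑[ B ∈ xs ] y B * ((1ℚ - m B T) * (error (updated B) T * error (updated B) T)))
        ≤⟨ ∑-mono ps (λ T∈ → ≤-trans (∑-mono xs λ B∈ → *-monoˡ (0≤y B∈) (dead-or-updated T∈)) (Point.expected-square T∈)) ⟩
      (∑[ T ∈ ps ] (W * (e² T) + 2ℚ * S * e² T - 2ℚ * (error y T * D T) + ρ * (1ℚ + e² T) + k * k * (S * S) * (lam + 2ℚ * 2ℚ * κ)))
        ≡⟨ ∑-cong ps (λ {T} _ → eq₁ W S ρ (k * k * (S * S) * (lam + 2ℚ * 2ℚ * κ)) (e² T) (error y T * D T)) ⟩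
      (∑[ T ∈ ps ] ((W + (2ℚ * S + ρ)) * e² T - 2ℚ * (error y T * D T) + c))
        ≡⟨ trans (∑-+ ps _ _) (cong₂ _+_ (trans (∑-- ps _ _) (cong₂ _-_ (∑-* (W + (2ℚ * S + ρ)) ps e²) (∑-* 2ℚ ps _))) (∑-const c ps)) ⟩
      (W + (2ℚ * S + ρ)) * Ψ ps y - 2ℚ * (∑[ T ∈ ps ] error y T * D T) + n * c
        ≤⟨ ≤-cert _ (eq₂ W (2ℚ * S + ρ) (Ψ ps y) (∑[ T ∈ ps ] error y T * D T) (n * c)) ((0≤1 ⊹ 0≤1) ⊛ 0≤∑eD) ⟩
      W * Ψ ps y + (2ℚ * S + ρ) * Ψ ps y + n * c ∎
      where
      open ≤-Reasoning
      e² : P → ℚ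
      e² T = error y T * error y T
      eq₁ : ∀ W S ρ g e d → W * e + 2ℚ * S * e - 2ℚ * d + ρ * (1ℚ + e) + g ≡ (W + (2ℚ * S + ρ)) * e - 2ℚ * d + (ρ + g)
      eq₁ = solve-∀ ring
      eq₂ : ∀ W s Ψ d t → W * Ψ + s * Ψ + t ≡ ((W + s) * Ψ - 2ℚ * d + t) + 2ℚ * d
      eq₂ = solve-∀ ring
      eq₃ : ∀ x → (1ℚ - 1ℚ) * x ≡ 0ℚ
      eq₃ = solve-∀ ring
      eq₄ : ∀ x → (1ℚ - 0ℚ) * x ≡ x
      eq₄ = solve-∀ ring
      -- A point of `B` leaves the system and contributes zero, which is trivially at most the
      -- square.
      dead-or-updated : ∀ {T B} (T∈ : T ∈ ps) → (1ℚ - m B T) * (error (updated B) T * error (updated B) T) ≤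
        (Point.e T∈ + Point.G T∈ - Point.L T∈ B) * (Point.e T∈ + Point.G T∈ - Point.L T∈ B)
      dead-or-updated {T} {B} T∈ with mem B T in memBT
      ... | true  = subst (_≤ sq) (sym (eq₃ (error (updated B) T * error (updated B) T))) (sq-nonneg (Point.e T∈ + Point.G T∈ - Point.L T∈ B))
        where
        sq : ℚ
        sq = (Point.e T∈ + Point.G T∈ - Point.L T∈ B) * (Point.e T∈ + Point.G T∈ - Point.L T∈ B)
      ... | false = ≤-reflexive (trans (eq₄ (error (updated B) T * error (updated B) T)) (cong (λ w → w * w) (deg-updated T∈ memBT)))

    -- Per unit of weight, rescaling adds about `size - 1` and discarding removes about `size`, so
    -- the total weight drops by about 1. The deviation is linear in the errors; `b = 1/β` is a free
    -- parameter trading it for a constant plus a multiple of `Ψ`.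
    expected-W : ∀ {b β} → 0ℚ ≤ b → 0ℚ ≤ β → b * β ≡ 1ℚ →
      (∑[ B ∈ xs ] y B * ∑ xs (updated B)) ≤ W * (W - 1ℚ + 2ℚ * (κ * (k * k))) + (n * β + b * Ψ ps y)
    expected-W {b} {β} 0≤b 0≤β b*β≡1 = begin
      (∑[ B ∈ xs ] y B * ∑ xs (updated B))
        ≡⟨ trans (∑-cong xs λ {B} _ → sym (∑-* (y B) xs _)) (trans (∑-swap xs xs _) (∑-cong xs λ {A} _ →
             trans (∑-cong xs λ {B} _ → eq₁ (y B) (z A) (χ (meets ps A B))) (trans (∑-* (z A) xs _) (cong (z A *_) (∑-- xs _ _))))) ⟩
      (∑[ A ∈ xs ] z A * (W - H A))
        ≤⟨ ∑-mono xs discarded ⟩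
      (∑[ A ∈ xs ] (y A * (W - 1ℚ + 2ℚ * (κ * (k * k))) + y A * (size ps A - Q A)))
        ≡⟨ trans (∑-+ xs _ _) (cong₂ _+_ (∑-*ʳ _ xs y) size-Q) ⟩
      W * (W - 1ℚ + 2ℚ * (κ * (k * k))) + (∑[ T ∈ ps ] deg y T * (- error y T))
        ≤⟨ +-monoʳ-≤ (W * (W - 1ℚ + 2ℚ * (κ * (k * k)))) (∑-mono ps λ {T} _ → linear≤square T) ⟩
      W * (W - 1ℚ + 2ℚ * (κ * (k * k))) + (∑[ T ∈ ps ] (β + b * (error y T * error y T)))
        ≡⟨ cong (λ w → W * (W - 1ℚ + 2ℚ * (κ * (k * k))) + w) (trans (∑-+ ps _ _) (cong₂ _+_ (∑-const β ps) (∑-* b ps _))) ⟩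
      W * (W - 1ℚ + 2ℚ * (κ * (k * k))) + (n * β + b * Ψ ps y) ∎
      where
      open ≤-Reasoning
      module M A = Meeting y 0≤y ps A
      open M using (H; Q)
      eq₁ : ∀ y z h → y * (z * (1ℚ - h)) ≡ z * (y - y * h)
      eq₁ = solve-∀ ring
      eq₂ : ∀ b i e → i + b * (e * e) ≡ (- e + (b * ((e + ½ * i) * (e + ½ * i)) + (½ + ½ * ½) * i)) + (b * i - 1ℚ) * (- (e + ½ * ½ * i))
      eq₂ = solve-∀ ring
      eq₄ : ∀ e → - e ≡ (1ℚ + e) * (- e) + e * e
      eq₄ = solve-∀ ring
      linear≤square : ∀ T → deg y T * (- error y T) ≤ β + b * (error y T * error y T)
      linear≤square T = ≤-trans (subst (λ d → d * (- e) ≤ - e) (sym (deg≡ T)) (≤-cert _ (eq₄ e) (sq-nonneg e)))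
        (≤-cert _ (trans (eq₂ b β e) (absorb b*β≡1))
          (0≤b ⊛ sq-nonneg (e + ½ * β) ⊹ nonNegative⁻¹ (½ + ½ * ½) ⊛ 0≤β))
        where
        e : ℚ
        e = error y T
      size-Q : (∑[ A ∈ xs ] y A * (size ps A - Q A)) ≡ (∑[ T ∈ ps ] deg y T * (- error y T))
      size-Q = trans (∑-cong xs λ {A} _ → trans (cong (y A *_) (sym (∑-- ps _ _))) (sym (∑-* (y A) ps _)))
        (trans (∑-swap xs ps _) (∑-cong ps λ {T} _ → trans (∑-cong xs λ {A} _ → eq (y A) (m A T) (deg y T)) (∑-*ʳ (- error y T) xs _)))
        where
        eq : ∀ y m d → y * (m - m * d) ≡ y * m * (- (d - 1ℚ))
        eq = solve-∀ ring
      -- The first factor is negative for a block without points, but then `Q A` vanishes; termwise,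
      -- each point of `A` guarantees size at least 1.
      0≤[size-1]Q : ∀ A → 0ℚ ≤ (size ps A - 1ℚ) * Q A
      0≤[size-1]Q A = subst (0ℚ ≤_) (∑-* (size ps A - 1ℚ) ps _) (0≤∑ ps λ {T} T∈ →
        subst (0ℚ ≤_) (sym (trans (cong (λ s → (s - 1ℚ) * (m A T * deg y T)) (Point.size≡ T∈ A))
          (trans (eq₅ (m A T) (Point.q T∈ A) (deg y T)) (trans (cong (λ u → (u + m A T * Point.q T∈ A - m A T) * deg y T) (χ² (mem A T))) (eq₆ (m A T) (Point.q T∈ A) (deg y T))))))
          (0≤m A T ⊛ Point.0≤q T∈ A ⊛ 0≤deg T))
        where
        eq₅ : ∀ m q d → (m + q - 1ℚ) * (m * d) ≡ (m * m + m * q - m) * d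
        eq₅ = solve-∀ ring
        eq₆ : ∀ m q d → (m + m * q - m) * d ≡ m * q * d
        eq₆ = solve-∀ ring
      discarded : ∀ {A} → A ∈ xs → z A * (W - H A) ≤ y A * (W - 1ℚ + 2ℚ * (κ * (k * k))) + y A * (size ps A - Q A)
      discarded {A} A∈ = ≤-cert (z A * (H A + κk² - Q A) + (2ℚ * y A - z A) * κk² + lam * (y A * ((size ps A - 1ℚ) * Q A)))
        (sym (trans (eq₇ (y A) W lam (size ps A) (H A) (Q A) κk²) (absorb W*lam≡1)))
        (0≤z A∈ ⊛ p≤q⇒0≤q-p (M.Q≤H+κk² A uniq 0≤κ 0≤k (size≤k A∈) codeg≤κ)
          ⊹ p≤q⇒0≤q-p (z≤2y A∈) ⊛ (0≤κ ⊛ (0≤k ⊛ 0≤k)) ⊹ 0≤lam ⊛ (0≤y A∈ ⊛ 0≤[size-1]Q A))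
        where
        κk² : ℚ
        κk² = κ * (k * k)
        eq₇ : ∀ y W l s H Q κ → y * (1ℚ + l * (s - 1ℚ)) * (W - H) + (y * (1ℚ + l * (s - 1ℚ)) * (H + κ - Q) + (2ℚ * y - y * (1ℚ + l * (s - 1ℚ))) * κ + l * (y * ((s - 1ℚ) * Q))) ≡
          (y * (W - 1ℚ + 2ℚ * κ) + y * (s - Q)) + (W * l - 1ℚ) * (y * (s - 1ℚ))
        eq₇ = solve-∀ ring

    0≤Ψ : ∀ qs w → 0ℚ ≤ Ψ qs w
    0≤Ψ qs w = 0≤∑ qs λ {T} _ → sq-nonneg (error w T)

    -- Weight and squared error are averaged with the same block weights, so a single block can be
    -- good for their combination even when no block is known to be good for each separately.
    good-block : ∀ {b β α ω} → 0ℚ ≤ b → 0ℚ ≤ β → b * β ≡ 1ℚ → 0ℚ ≤ α → 0ℚ < W → n ≤ ω * W →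
      ∃ λ B → B ∈ xs × ∑ xs (updated B) + α * Ψ (survivors B) (updated B) ≤
        W - 1ℚ + (2ℚ * (κ * (k * k)) + ω * β + α * (ω * c)) + (b * lam + α * (1ℚ + lam * (2ℚ * S + ρ))) * Ψ ps y
    good-block {b} {β} {α} {ω} 0≤b 0≤β b*β≡1 0≤α 0<W n≤ωW = averaging xs y _ _ 0≤y 0<W (begin
      (∑[ B ∈ xs ] y B * (∑ xs (updated B) + α * Ψ (survivors B) (updated B)))
        ≡⟨ trans (∑-cong xs λ {B} _ → eq₁ (y B) (∑ xs (updated B)) α (Ψ (survivors B) (updated B))) (trans (∑-+ xs _ (λ B → α * (y B * Ψ (survivors B) (updated B)))) (cong ((∑[ B ∈ xs ] y B * ∑ xs (updated B)) +_) (∑-* α xs (λ B → y B * Ψ (survivors B) (updated B))))) ⟩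
      (∑[ B ∈ xs ] y B * ∑ xs (updated B)) + α * (∑[ B ∈ xs ] y B * Ψ (survivors B) (updated B))
        ≤⟨ +-mono-≤ (expected-W 0≤b 0≤β b*β≡1) (*-monoˡ 0≤α expected-Ψ) ⟩
      W * (W - 1ℚ + K) + (n * β + b * X) + α * (W * X + (2ℚ * S + ρ) * X + n * c)
        ≤⟨ ≤-cert _ (eq₂ W K n β b X α (2ℚ * S + ρ) c ω) (p≤q⇒0≤q-p n≤ωW ⊛ (0≤β ⊹ 0≤α ⊛ 0≤c)) ⟩
      W * (W - 1ℚ + (K + ω * β + α * (ω * c)) + α * X) + 1ℚ * ((b + α * (2ℚ * S + ρ)) * X)
        ≡⟨ cong (λ u → W * (W - 1ℚ + (K + ω * β + α * (ω * c)) + α * X) + u * ((b + α * (2ℚ * S + ρ)) * X)) (sym W*lam≡1) ⟩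
      W * (W - 1ℚ + (K + ω * β + α * (ω * c)) + α * X) + W * lam * ((b + α * (2ℚ * S + ρ)) * X)
        ≡⟨ eq₃ W (W - 1ℚ + (K + ω * β + α * (ω * c))) α X lam b (2ℚ * S + ρ) ⟩
      W * (W - 1ℚ + (K + ω * β + α * (ω * c)) + (b * lam + α * (1ℚ + lam * (2ℚ * S + ρ))) * X) ∎)
      where
      open ≤-Reasoning
      X K : ℚ
      X = Ψ ps y
      K = 2ℚ * (κ * (k * k))
      0≤c : 0ℚ ≤ c
      0≤c = 0≤k ⊛ 0≤k ⊛ (0≤S ⊛ 0≤S) ⊛ (0≤κ ⊹ 0≤lam) ⊹ 0≤k ⊛ 0≤k ⊛ (0≤S ⊛ 0≤S) ⊛ (0≤lam ⊹ (0≤1 ⊹ 0≤1) ⊛ (0≤1 ⊹ 0≤1) ⊛ 0≤κ)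
      eq₁ : ∀ y w a p → y * (w + a * p) ≡ y * w + a * (y * p)
      eq₁ = solve-∀ ring
      eq₂ : ∀ W K n β b X α s c ω → W * (W - 1ℚ + (K + ω * β + α * (ω * c)) + α * X) + 1ℚ * ((b + α * s) * X) ≡
        (W * (W - 1ℚ + K) + (n * β + b * X) + α * (W * X + s * X + n * c)) + (ω * W - n) * (β + α * c)
      eq₂ = solve-∀ ring
      eq₃ : ∀ W w α X l b s → W * (w + α * X) + W * l * ((b + α * s) * X) ≡ W * (w + (b * l + α * (1ℚ + l * s)) * X)
      eq₃ = solve-∀ ring

    0≤updated : ∀ B {A} → A ∈ xs → 0ℚ ≤ updated B A
    0≤updated B {A} A∈ = 0≤z A∈ ⊛ p≤q⇒0≤q-p (χ≤1 (meets ps A B))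

    updated≤ : ∀ B {A} → A ∈ xs → updated B A ≤ (1ℚ + k * lam) * y A
    updated≤ B {A} A∈ = ≤-trans (≤-cert _ (eq (z A) (χ (meets ps A B))) (0≤z A∈ ⊛ 0≤χ (meets ps A B))) (z≤[1+k*lam]y A∈)
      where
      eq : ∀ z h → z ≡ z * (1ℚ - h) + z * h
      eq = solve-∀ ring

∑-filter-≤ : {P : Set} (q : P → Bool) (ps : List P) {f : P → ℚ} → (∀ {p} → p ∈ ps → 0ℚ ≤ f p) →
  ∑ (filter (λ p → q p Bool.≟ false) ps) f ≤ ∑ ps f
∑-filter-≤ q ps {f} 0≤f = subst (_≤ ∑ ps f) (sym (∑-filter-false q ps f)) (∑-mono ps λ {p} p∈ →
  ≤-cert _ (eq (f p) (χ (q p))) (0≤χ (q p) ⊛ 0≤f p∈))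
  where
  eq : ∀ f h → f ≡ (1ℚ - h) * f + h * f
  eq = solve-∀ ring

-- The nibble is run until the remaining weight drops below ε W₀.  The potential of a state with j steps
-- to go is W + α j Ψ, where α j decreases along the run fast enough to absorb the growth of Ψ.
module Loop {P I : Set} (mem : I → P → Bool) (xs : List I) (k ε W₀ lam₀ r Γ κ b β : ℚ)
  (1≤k : 1ℚ ≤ k) (0<ε : 0ℚ < ε) (0≤W₀ : 0ℚ ≤ W₀) (0≤lam₀ : 0ℚ ≤ lam₀) (ε*W₀*lam₀≡1 : ε * W₀ * lam₀ ≡ 1ℚ) (ε*r≡1 : ε * r ≡ 1ℚ)
  (1≤Γ : 1ℚ ≤ Γ) (0≤κ : 0ℚ ≤ κ) (0≤b : 0ℚ ≤ b) (0≤β : 0ℚ ≤ β) (b*β≡1 : b * β ≡ 1ℚ) (k*lam₀≤1 : k * lam₀ ≤ 1ℚ) where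

  open System mem xs using (deg; codeg; size; 0≤m; m)

  0≤k : 0ℚ ≤ k
  0≤k = ≤-trans 0≤1 1≤k

  0≤Γ : 0ℚ ≤ Γ
  0≤Γ = ≤-trans 0≤1 1≤Γ

  0≤r : 0ℚ ≤ r
  0≤r = *-cancel 0<ε (subst₂ _≤_ (sym (*-zeroʳ ε)) (sym ε*r≡1) 0≤1)

  -- Worst cases over the run, where `lam ≤ lam₀`: `g` is the growth factor of a block weight in one
  -- step, `h` that of the coefficient of `Ψ`.
  g h ρ₀ c₀ : ℚ
  ρ₀ = k * k * (Γ * Γ) * (κ + lam₀)
  c₀ = ρ₀ + k * k * (Γ * Γ) * (lam₀ + 2ℚ * 2ℚ * κ)
  g = 1ℚ + k * lam₀
  h = 1ℚ + lam₀ * (1ℚ + (2ℚ * Γ + ρ₀))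

  0≤ρ₀ : 0ℚ ≤ ρ₀
  0≤ρ₀ = 0≤k ⊛ 0≤k ⊛ (0≤Γ ⊛ 0≤Γ) ⊛ (0≤κ ⊹ 0≤lam₀)

  1≤g : 1ℚ ≤ g
  1≤g = ≤-cert _ refl (0≤k ⊛ 0≤lam₀)

  1≤h : 1ℚ ≤ h
  1≤h = ≤-cert _ refl (0≤lam₀ ⊛ (0≤1 ⊹ ((0≤1 ⊹ 0≤1) ⊛ 0≤Γ ⊹ 0≤ρ₀)))

  α : ℕ → ℚ
  α j = b * h ^ j

  b≤α : ∀ j → b ≤ α j
  b≤α j = subst (_≤ α j) (*-identityʳ b) (*-monoˡ 0≤b (1≤^ j 1≤h))

  -- With `j` steps to go, weights may still grow by `g ^ j`. Degrees and codegrees are therefore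
  -- bounded with this growth already charged, which makes the invariant pass to the next step.
  record State (j : ℕ) (ps : List P) (y : I → ℚ) : Set where
    field
      uniq     : Unique ps
      nonneg   : ∀ {A} → A ∈ xs → 0ℚ ≤ y A
      size≤k   : ∀ {A} → A ∈ xs → size ps A ≤ k
      few      : ι (length ps) ≤ k * W₀
      deg≤     : ∀ {T} → T ∈ ps → deg y T * g ^ j ≤ Γ
      codeg≤   : ∀ {T T′} → T ∈ ps → T′ ∈ ps → T′ ≢ T → codeg y T T′ * g ^ j ≤ κ

  Ψ : List P → (I → ℚ) → ℚ
  Ψ ps y = ∑[ T ∈ ps ] (deg y T - 1ℚ) * (deg y T - 1ℚ)

  0≤Ψ : ∀ qs w → 0ℚ ≤ Ψ qs w
  0≤Ψ qs w = 0≤∑ qs λ {T} _ → sq-nonneg (deg w T - 1ℚ)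

  Covered : List I → List P → List P → Set
  Covered L rest ps = ∀ {T} → T ∈ ps → T ∈ rest ⊎ (∃ λ B → B ∈ L × mem B T ≡ true)

  -- A chosen block is charged `1 - ε`, the amount by which its step is sure to lower the potential.
  -- Leftover points are paid for one by one.
  cost : List I → List P → ℚ
  cost L rest = (1ℚ - ε) * ι (length L) + ι (length rest)

  stop-cost : ℚ
  stop-cost = (k * ε + k * β) * W₀

  -- Writing 1 as `deg + (1 - deg)`, the first part sums to at most `k` times the small remaining
  -- weight, and the second is bounded by the squared errors in `Ψ`.
  few-left : ∀ {j ps y} → State j ps y → ∑ xs y ≤ ε * W₀ → ι (length ps) ≤ ∑ xs y + α j * Ψ ps y + stop-cost
  few-left {j} {ps} {y} st W≤εW₀ = begin
    ι (length ps)
      ≡⟨ sym (trans (∑-cong ps λ {T} _ → eq₁ (deg y T)) (trans (∑-const 1ℚ ps) (*-identityʳ _))) ⟩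
    (∑[ T ∈ ps ] (deg y T + (1ℚ - deg y T)))
      ≤⟨ ∑-mono ps (λ {T} _ → +-monoʳ-≤ (deg y T) (≤-cert _ (trans (eq₂ b β (deg y T)) (absorb b*β≡1))
           (0≤b ⊛ sq-nonneg (deg y T - 1ℚ + ½ * β) ⊹ nonNegative⁻¹ (½ + ½ * ½) ⊛ 0≤β))) ⟩
    (∑[ T ∈ ps ] (deg y T + (β + b * ((deg y T - 1ℚ) * (deg y T - 1ℚ)))))
      ≡⟨ trans (∑-+ ps _ _) (cong₂ _+_ ∑deg≡ (trans (∑-+ ps _ _) (cong₂ _+_ (∑-const β ps) (∑-* b ps _)))) ⟩
    (∑[ A ∈ xs ] y A * size ps A) + (ι (length ps) * β + b * Ψ ps y)
      ≤⟨ +-mono-≤ (≤-trans (∑-mono xs λ A∈ → *-monoˡ (nonneg A∈) (size≤k A∈)) (≤-trans (≤-reflexive (∑-*ʳ k xs y)) (*-monoʳ 0≤k W≤εW₀)))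
           (+-mono-≤ (*-monoʳ 0≤β few) (*-monoʳ (0≤Ψ ps y) (b≤α j))) ⟩
    ε * W₀ * k + (k * W₀ * β + α j * Ψ ps y)
      ≤⟨ ≤-cert _ (eq₃ ε W₀ k β (α j * Ψ ps y) (∑ xs y)) (0≤∑ xs nonneg) ⟩
    ∑ xs y + α j * Ψ ps y + stop-cost ∎
    where
    open ≤-Reasoning
    open State st
    eq₁ : ∀ d → d + (1ℚ - d) ≡ 1ℚ
    eq₁ = solve-∀ ring
    eq₂ : ∀ b i d → i + b * ((d - 1ℚ) * (d - 1ℚ)) ≡
      ((1ℚ - d) + (b * ((d - 1ℚ + ½ * i) * (d - 1ℚ + ½ * i)) + (½ + ½ * ½) * i)) + (b * i - 1ℚ) * (- (d - 1ℚ + ½ * ½ * i))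
    eq₂ = solve-∀ ring
    eq₃ : ∀ e w k β p W → W + p + (k * e + k * β) * w ≡ (e * w * k + (k * w * β + p)) + W
    eq₃ = solve-∀ ring
    ∑deg≡ : ∑ ps (deg y) ≡ (∑[ A ∈ xs ] y A * size ps A)
    ∑deg≡ = trans (∑-swap ps xs _) (∑-cong xs λ {A} _ → ∑-* (y A) ps _)

  module _ (N : ℕ) (A : ℚ) (α≤A : α N ≤ A) (err≤ε : 2ℚ * (κ * (k * k)) + k * r * β + A * (k * r * c₀) ≤ ε) where

    α≤ : ∀ {j} → j ℕ.≤ N → α j ≤ A
    α≤ {j} j≤N = ≤-trans (*-monoˡ 0≤b (h^-mono j≤N)) α≤A
      where
      h^-mono : ∀ {i j} → i ℕ.≤ j → h ^ i ≤ h ^ j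
      h^-mono {j = j} ℕ.z≤n = 1≤^ j 1≤h
      h^-mono (ℕ.s≤s i≤j) = *-monoˡ (≤-trans 0≤1 1≤h) (h^-mono i≤j)

    covered-by-B : ∀ {B L rest ps} → Covered L rest (filter (λ T → mem B T Bool.≟ false) ps) → Covered (B ∷ L) rest ps
    covered-by-B {B} {L} {rest} covered {T} T∈ = split (mem B T) refl
      where
      split : ∀ v → mem B T ≡ v → T ∈ rest ⊎ (∃ λ B′ → B′ ∈ B ∷ L × mem B′ T ≡ true)
      split true  memBT = inj₂ (B , here refl , memBT)
      split false memBT = Sum.map₂ (λ { (B′ , B′∈ , memB′T) → B′ , there B′∈ , memB′T })
        (covered (∈-filter⁺ (λ T → mem B T Bool.≟ false) T∈ memBT))

    run : ∀ j → j ℕ.≤ N → ∀ ps y → State j ps y → ∑ xs y + α j * Ψ ps y ≤ ι j * (1ℚ - ε) →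
      Σ (List I) λ L → Σ (List P) λ rest → (∀ {B} → B ∈ L → B ∈ xs) × Covered L rest ps ×
        cost L rest ≤ ∑ xs y + α j * Ψ ps y + stop-cost
    run j j≤N ps y st F≤ with ∑ xs y ≤? ε * W₀
    ... | yes W≤εW₀ = [] , ps , (λ ()) , inj₁ ,
      subst (_≤ ∑ xs y + α j * Ψ ps y + stop-cost) (eq ε (ι (length ps))) (few-left st W≤εW₀)
      where
      eq : ∀ e n → n ≡ (1ℚ - e) * 0ℚ + n
      eq = solve-∀ ring
    -- With no steps left the potential is at most 0, hence so is the weight, and the stopping rule
    -- would have applied.
    run zero j≤N ps y st F≤ | no W≰εW₀ = ⊥-elim (W≰εW₀ (≤-trans (≤-trans
      (≤-cert (α 0 * Ψ ps y) refl ((0≤b ⊛ 0≤1) ⊛ 0≤Ψ ps y)) (subst (∑ xs y + α 0 * Ψ ps y ≤_) (*-zeroˡ (1ℚ - ε)) F≤)) (<⇒≤ 0<ε ⊛ 0≤W₀)))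
    run (suc j) j<N ps y st F≤ | no W≰εW₀ = extend (good-block {ω = k * r} 0≤b 0≤β b*β≡1 0≤α 0<W few≤)
      where
      open State st
      j≤N : j ℕ.≤ N
      j≤N = ℕ.≤-trans (ℕ.n≤1+n j) j<N
      0≤α : 0ℚ ≤ α j
      0≤α = ≤-trans 0≤b (b≤α j)
      εW₀≤W : ε * W₀ ≤ ∑ xs y
      εW₀≤W = <⇒≤ (≰⇒> W≰εW₀)
      0<W : 0ℚ < ∑ xs y
      0<W = ≤-<-trans (<⇒≤ 0<ε ⊛ 0≤W₀) (≰⇒> W≰εW₀)
      lam : ℚ
      lam = proj₁ (inverse 0<W)
      0≤lam : 0ℚ ≤ lam
      0≤lam = <⇒≤ (proj₁ (proj₂ (inverse 0<W)))
      W*lam≡1 : ∑ xs y * lam ≡ 1ℚ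
      W*lam≡1 = proj₂ (proj₂ (inverse 0<W))
      lam≤lam₀ : lam ≤ lam₀
      lam≤lam₀ = subst₂ _≤_ (trans (cong (_* lam) ε*W₀*lam₀≡1) (*-identityˡ lam))
        (trans (eq (∑ xs y) lam₀ lam) (trans (cong (_* lam₀) W*lam≡1) (*-identityˡ lam₀)))
        (*-monoʳ 0≤lam (*-monoʳ 0≤lam₀ εW₀≤W))
        where
        eq : ∀ a b c → a * b * c ≡ a * c * b
        eq = solve-∀ ring
      0≤deg : ∀ T → 0ℚ ≤ deg y T
      0≤deg T = 0≤∑ xs λ {A} A∈ → nonneg A∈ ⊛ 0≤m A T
      0≤codeg : ∀ T T′ → 0ℚ ≤ codeg y T T′
      0≤codeg T T′ = 0≤∑ xs λ {A} A∈ → nonneg A∈ ⊛ (0≤m A T ⊛ 0≤m A T′)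
      ungrown : ∀ {p q} → 0ℚ ≤ p → p * g ^ suc j ≤ q → p ≤ q
      ungrown {p} {q} 0≤p le = ≤-trans (subst (_≤ p * g ^ suc j) (*-identityʳ p) (*-monoˡ 0≤p (1≤^ (suc j) 1≤g))) le
      open Step mem xs ps uniq y nonneg lam k Γ κ using (updated; survivors; module Bounds)
      open Bounds W*lam≡1 0≤lam 1≤k 1≤Γ 0≤κ (≤-trans (*-monoˡ 0≤k lam≤lam₀) k*lam₀≤1) size≤k
        (λ {T} T∈ → ungrown (0≤deg T) (deg≤ T∈)) (λ {T} {T′} T∈ T′∈ T′≢T → ungrown (0≤codeg T T′) (codeg≤ T∈ T′∈ T′≢T))
        using (good-block; 0≤updated; updated≤; ρ; c)
      few≤ : ι (length ps) ≤ k * r * ∑ xs y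
      few≤ = ≤-trans few (subst (_≤ k * r * ∑ xs y) (trans (eq k r ε W₀) (trans (cong (λ u → k * W₀ * u) ε*r≡1) (*-identityʳ (k * W₀))))
        (*-monoˡ (0≤k ⊛ 0≤r) εW₀≤W))
        where
        eq : ∀ k r e w → k * r * (e * w) ≡ k * w * (e * r)
        eq = solve-∀ ring
      regrown : ∀ {p q} → q ≤ (1ℚ + k * lam) * p → 0ℚ ≤ p → q * g ^ j ≤ p * g ^ suc j
      regrown {p} {q} q≤ 0≤p = ≤-trans (*-monoʳ (0≤^ j (≤-trans 0≤1 1≤g)) (≤-trans q≤ (*-monoʳ 0≤p (+-monoʳ-≤ 1ℚ (*-monoˡ 0≤k lam≤lam₀)))))
        (≤-reflexive (eq g p (g ^ j)))
        where
        eq : ∀ g p x → g * p * x ≡ p * (g * x)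
        eq = solve-∀ ring
      ρ≤ρ₀ : ρ ≤ ρ₀
      ρ≤ρ₀ = *-monoˡ (0≤k ⊛ 0≤k ⊛ (0≤Γ ⊛ 0≤Γ)) (+-monoʳ-≤ κ lam≤lam₀)
      c≤c₀ : c ≤ c₀
      c≤c₀ = +-mono-≤ ρ≤ρ₀ (*-monoˡ (0≤k ⊛ 0≤k ⊛ (0≤Γ ⊛ 0≤Γ)) (+-monoˡ-≤ (2ℚ * 2ℚ * κ) lam≤lam₀))
      0≤c₀ : 0ℚ ≤ c₀
      0≤c₀ = 0≤ρ₀ ⊹ 0≤k ⊛ 0≤k ⊛ (0≤Γ ⊛ 0≤Γ) ⊛ (0≤lam₀ ⊹ (0≤1 ⊹ 0≤1) ⊛ (0≤1 ⊹ 0≤1) ⊛ 0≤κ)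
      -- The summand 1 next to `2ℚ * Γ + ρ₀` in `h` pays for `b * lam`, because `b ≤ α j`.
      α-step : b * lam + α j * (1ℚ + lam * (2ℚ * Γ + ρ)) ≤ α (suc j)
      α-step = begin
        b * lam + α j * (1ℚ + lam * (2ℚ * Γ + ρ))
          ≤⟨ +-mono-≤ (*-mono 0≤b 0≤lam₀ (b≤α j) lam≤lam₀)
               (*-monoˡ 0≤α (+-monoʳ-≤ 1ℚ (*-mono 0≤lam ((0≤1 ⊹ 0≤1) ⊛ 0≤Γ ⊹ 0≤ρ₀) lam≤lam₀ (+-monoʳ-≤ (2ℚ * Γ) ρ≤ρ₀)))) ⟩
        α j * lam₀ + α j * (1ℚ + lam₀ * (2ℚ * Γ + ρ₀))
          ≡⟨ eq b (h ^ j) lam₀ (2ℚ * Γ + ρ₀) ⟩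
        α (suc j) ∎
        where
        open ≤-Reasoning
        eq : ∀ b x l s → b * x * l + b * x * (1ℚ + l * s) ≡ b * ((1ℚ + l * (1ℚ + s)) * x)
        eq = solve-∀ ring
      potential-drop : ∀ {F} → F ≤ ∑ xs y - 1ℚ + (2ℚ * (κ * (k * k)) + k * r * β + α j * (k * r * c)) + (b * lam + α j * (1ℚ + lam * (2ℚ * Γ + ρ))) * Ψ ps y →
        F ≤ (∑ xs y + α (suc j) * Ψ ps y) - (1ℚ - ε)
      potential-drop {F} F≤ = begin
        F ≤⟨ F≤ ⟩
        ∑ xs y - 1ℚ + (2ℚ * (κ * (k * k)) + k * r * β + α j * (k * r * c)) + (b * lam + α j * (1ℚ + lam * (2ℚ * Γ + ρ))) * Ψ ps y
          ≤⟨ +-mono-≤ (+-monoʳ-≤ (∑ xs y - 1ℚ) (≤-trans (+-monoʳ-≤ (2ℚ * (κ * (k * k)) + k * r * β)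
               (*-mono 0≤α (0≤k ⊛ 0≤r ⊛ 0≤c₀) (α≤ j≤N) (*-monoˡ (0≤k ⊛ 0≤r) c≤c₀))) err≤ε)) (*-monoʳ (0≤Ψ ps y) α-step) ⟩
        ∑ xs y - 1ℚ + ε + α (suc j) * Ψ ps y
          ≡⟨ eq (∑ xs y) ε (α (suc j) * Ψ ps y) ⟩
        (∑ xs y + α (suc j) * Ψ ps y) - (1ℚ - ε) ∎
        where
        open ≤-Reasoning
        eq : ∀ w e p → w - 1ℚ + e + p ≡ (w + p) - (1ℚ - e)
        eq = solve-∀ ring
      next : ∀ B → State j (survivors B) (updated B)
      next B = record
        { uniq   = filter⁺ _ uniq
        ; nonneg = 0≤updated B
        ; size≤k = λ {A} A∈ → ≤-trans (∑-filter-≤ (mem B) ps λ {T} _ → 0≤m A T) (size≤k A∈)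
        ; few    = ≤-trans (ι-mono (length-filter _ ps)) few
        ; deg≤   = λ {T} T∈ → ≤-trans (regrown (deg-grown T) (0≤deg T)) (deg≤ (old T∈))
        ; codeg≤ = λ {T} {T′} T∈ T′∈ T′≢T → ≤-trans (regrown (codeg-grown T T′) (0≤codeg T T′)) (codeg≤ (old T∈) (old T′∈) T′≢T)
        }
        where
        old : ∀ {T} → T ∈ survivors B → T ∈ ps
        old T∈ = proj₁ (∈-filter⁻ _ T∈)
        grown : (u : I → ℚ) → (∀ A → 0ℚ ≤ u A) → (∑[ A ∈ xs ] updated B A * u A) ≤ (1ℚ + k * lam) * (∑[ A ∈ xs ] y A * u A)
        grown u 0≤u = ≤-trans (∑-mono xs λ {A} A∈ → ≤-trans (*-monoʳ (0≤u A) (updated≤ B A∈)) (≤-reflexive (*-assoc (1ℚ + k * lam) (y A) (u A))))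
          (≤-reflexive (∑-* (1ℚ + k * lam) xs _))
        deg-grown : ∀ T → deg (updated B) T ≤ (1ℚ + k * lam) * deg y T
        deg-grown T = grown (λ A → m A T) λ A → 0≤m A T
        codeg-grown : ∀ T T′ → codeg (updated B) T T′ ≤ (1ℚ + k * lam) * codeg y T T′
        codeg-grown T T′ = grown (λ A → m A T * m A T′) λ A → 0≤m A T ⊛ 0≤m A T′
      extend : (∃ λ B → B ∈ xs × ∑ xs (updated B) + α j * Ψ (survivors B) (updated B) ≤
          ∑ xs y - 1ℚ + (2ℚ * (κ * (k * k)) + k * r * β + α j * (k * r * c)) + (b * lam + α j * (1ℚ + lam * (2ℚ * Γ + ρ))) * Ψ ps y) →
        Σ (List I) λ L → Σ (List P) λ rest → (∀ {B} → B ∈ L → B ∈ xs) × Covered L rest ps ×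
          cost L rest ≤ ∑ xs y + α (suc j) * Ψ ps y + stop-cost
      extend (B , B∈xs , F′≤) = include (run j j≤N (survivors B) (updated B) (next B)
          (≤-trans (potential-drop F′≤) (≤-cert _ (eq (ι j) ε (∑ xs y + α (suc j) * Ψ ps y)) (p≤q⇒0≤q-p F≤))))
        where
        eq : ∀ j e f → j * (1ℚ - e) ≡ (f - (1ℚ - e)) + ((1ℚ + j) * (1ℚ - e) - f)
        eq = solve-∀ ring
        eq₁ : ∀ e l r → (1ℚ - e) * (1ℚ + l) + r ≡ ((1ℚ - e) * l + r) + (1ℚ - e)
        eq₁ = solve-∀ ring
        eq₂ : ∀ f e s → f - (1ℚ - e) + s + (1ℚ - e) ≡ f + s
        eq₂ = solve-∀ ring
        include : (Σ (List I) λ L → Σ (List P) λ rest → (∀ {B} → B ∈ L → B ∈ xs) × Covered L rest (survivors B) ×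
            cost L rest ≤ ∑ xs (updated B) + α j * Ψ (survivors B) (updated B) + stop-cost) →
          Σ (List I) λ L → Σ (List P) λ rest → (∀ {B} → B ∈ L → B ∈ xs) × Covered L rest ps ×
            cost L rest ≤ ∑ xs y + α (suc j) * Ψ ps y + stop-cost
        include (L , rest , L⊆xs , covered , cost≤) = B ∷ L , rest , (λ { (here refl) → B∈xs ; (there B∈) → L⊆xs B∈ }) , covered-by-B covered ,
          ≤-trans (≤-reflexive (eq₁ ε (ι (length L)) (ι (length rest)))) (≤-trans (+-monoˡ-≤ (1ℚ - ε) (≤-trans cost≤ (+-monoˡ-≤ stop-cost (potential-drop F′≤))))
            (≤-reflexive (eq₂ (∑ xs y + α (suc j) * Ψ ps y) ε stop-cost)))

abstract
  round-up : ∀ p → 0ℚ ≤ p → ∃ λ n → p ≤ ι n × ι n ≤ 1ℚ + p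
  round-up p 0≤p = descend (proj₁ (archimedean p)) (proj₂ (archimedean p))
    where
    descend : ∀ n → p ≤ ι n → ∃ λ n → p ≤ ι n × ι n ≤ 1ℚ + p
    descend zero    p≤0 = 0 , p≤0 , (0≤1 ⊹ 0≤p)
    descend (suc n) p≤  with p ≤? ι n
    ... | yes p≤n = descend n p≤n
    ... | no p≰n  = suc n , p≤ , +-monoʳ-≤ 1ℚ (<⇒≤ (≰⇒> p≰n))

≤-component : ∀ {c} p q → 0ℚ ≤ c → 0ℚ ≤ q → c * p ≤ c * (p + q)
≤-component p q 0≤c 0≤q = *-monoˡ 0≤c (≤-cert q refl 0≤q)

≤-component′ : ∀ {c} p q → 0ℚ ≤ c → 0ℚ ≤ p → c * q ≤ c * (p + q)
≤-component′ p q 0≤c 0≤p = *-monoˡ 0≤c (≤-cert p (+-comm p q) 0≤p)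

abstract
  -- It matters that `κ` depends on `k` and `ε` alone: the hypergraph, whose size grows with `n`,
  -- comes afterwards. One `κ` serves both as codegree bound and as measure of how large the total
  -- weight must be.
  nibble : ∀ {k ε} → 1ℚ ≤ k → 0ℚ < ε → ∃ λ κ → 0ℚ < κ ×
    ({P I : Set} (mem : I → P → Bool) (xs : List I) (ps : List P) (w : I → ℚ) → let open System mem xs in
     Unique ps → (∀ {A} → A ∈ xs → 0ℚ ≤ w A) → (∀ {A} → A ∈ xs → size ps A ≤ k) →
     (∀ {T} → T ∈ ps → deg w T ≡ 1ℚ) →
     (∀ {T T′} → T ∈ ps → T′ ∈ ps → T′ ≢ T → codeg w T T′ ≤ κ) →
     1ℚ ≤ κ * ∑ xs w →
     Σ (List I) λ L → Σ (List P) λ rest → (∀ {B} → B ∈ L → B ∈ xs) ×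
       (∀ {T} → T ∈ ps → T ∈ rest ⊎ (∃ λ B → B ∈ L × mem B T ≡ true)) ×
       ι (length L) + ι (length rest) ≤ (1ℚ + ε) * ∑ xs w)
  nibble {k} {ε} 1≤k 0<ε = κ₀ , 0<κ₀ , cover
    where
    0≤2 : 0ℚ ≤ 2ℚ
    0≤2 = 0≤1 ⊹ 0≤1
    0<k : 0ℚ < k
    0<k = <-≤-trans 0<1 1≤k
    0≤k : 0ℚ ≤ k
    0≤k = <⇒≤ 0<k
    0≤ε : 0ℚ ≤ ε
    0≤ε = <⇒≤ 0<ε
    0<k+2+2ε : 0ℚ < k + 2ℚ + 2ℚ * ε
    0<k+2+2ε = 0<p+q (0<p+q 0<k 0≤2) (0≤2 ⊛ 0≤ε)
    ε₁ r b β Γ A C Y D κ₀ : ℚ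
    -- With this choice `(1 - ε₁)(1 + ε) = 1 + ε₁ (k + 1 + ε)`, which leaves room for the stopping
    -- cost `k ε₁ + k β`.
    ε₁ = ε * proj₁ (inverse 0<k+2+2ε)
    0<ε₁ : 0ℚ < ε₁
    0<ε₁ = 0<p*q 0<ε (proj₁ (proj₂ (inverse 0<k+2+2ε)))
    0≤ε₁ : 0ℚ ≤ ε₁
    0≤ε₁ = <⇒≤ 0<ε₁
    ε₁-spec : ε₁ * (k + 2ℚ + 2ℚ * ε) ≡ ε
    ε₁-spec = trans (eq ε (proj₁ (inverse 0<k+2+2ε)) (k + 2ℚ + 2ℚ * ε)) (trans (cong (ε *_) (proj₂ (proj₂ (inverse 0<k+2+2ε)))) (*-identityʳ ε))
      where
      eq : ∀ e i d → e * i * d ≡ e * (d * i)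
      eq = solve-∀ ring
    2ε₁≤1 : 2ℚ * ε₁ ≤ 1ℚ
    2ε₁≤1 = *-cancel 0<ε (≤-cert _ (trans (*-identityʳ ε) (trans (sym ε₁-spec) (eq ε₁ k ε))) (0≤ε₁ ⊛ (0≤k ⊹ 0≤2)))
      where
      eq : ∀ e k f → e * (k + 2ℚ + 2ℚ * f) ≡ f * (2ℚ * e) + e * (k + 2ℚ)
      eq = solve-∀ ring
    r = proj₁ (inverse 0<ε₁)
    0≤r : 0ℚ ≤ r
    0≤r = <⇒≤ (proj₁ (proj₂ (inverse 0<ε₁)))
    ε₁r≡1 : ε₁ * r ≡ 1ℚ
    ε₁r≡1 = proj₂ (proj₂ (inverse 0<ε₁))
    i : ℚ
    i = proj₁ (inverse 0<k)
    0<β : 0ℚ < ½ * ½ * (ε₁ * ε₁) * i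
    0<β = 0<p*q (0<p*q (positive⁻¹ (½ * ½)) (0<p*q 0<ε₁ 0<ε₁)) (proj₁ (proj₂ (inverse 0<k)))
    -- Makes the summand `k r β` of the error per step equal to a quarter of `ε₁`.
    β = ½ * ½ * (ε₁ * ε₁) * i
    kβ≡ : k * β ≡ ½ * ½ * (ε₁ * ε₁)
    kβ≡ = trans (eq k ε₁ i) (trans (cong (½ * ½ * (ε₁ * ε₁) *_) (proj₂ (proj₂ (inverse 0<k)))) (*-identityʳ _))
      where
      eq : ∀ k e i → k * (½ * ½ * (e * e) * i) ≡ ½ * ½ * (e * e) * (k * i)
      eq = solve-∀ ring
    b = proj₁ (inverse 0<β)
    0≤b : 0ℚ ≤ b
    0≤b = <⇒≤ (proj₁ (proj₂ (inverse 0<β)))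
    b*β≡1 : b * β ≡ 1ℚ
    b*β≡1 = trans (*-comm b β) (proj₂ (proj₂ (inverse 0<β)))
    J₁ J₂ : ℕ
    -- There are at most `3 W₀` steps at rate `k lam₀`, and `W₀ lam₀ = r`; twice the product is the
    -- quantity required by `growth≤2^`. `J₂` plays the same part for `h`, with `C` bounding its
    -- rate relative to `lam₀`.
    J₁ = proj₁ (archimedean (2ℚ * (1ℚ + 2ℚ) * (k * r)))
    Γ = 2ℚ ^ suc J₁
    1≤Γ : 1ℚ ≤ Γ
    1≤Γ = 1≤^ (suc J₁) (≤-cert 1ℚ refl 0≤1)
    0≤Γ : 0ℚ ≤ Γ
    0≤Γ = ≤-trans 0≤1 1≤Γ
    C = 1ℚ + (2ℚ * Γ + k * k * (Γ * Γ) * 2ℚ)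
    0≤C : 0ℚ ≤ C
    0≤C = 0≤1 ⊹ (0≤2 ⊛ 0≤Γ ⊹ 0≤k ⊛ 0≤k ⊛ (0≤Γ ⊛ 0≤Γ) ⊛ 0≤2)
    J₂ = proj₁ (archimedean (2ℚ * (1ℚ + 2ℚ) * (r * C)))
    A = b * 2ℚ ^ suc J₂
    0≤A : 0ℚ ≤ A
    0≤A = 0≤b ⊛ 0≤^ (suc J₂) 0≤2
    Y = 2ℚ * (Γ * (k * k)) + A * (k * r * (k * k * (Γ * Γ) * ((2ℚ + 2ℚ + 1ℚ) * Γ + 2ℚ * r)))
    0≤Y : 0ℚ ≤ Y
    0≤Y = 0≤2 ⊛ (0≤Γ ⊛ (0≤k ⊛ 0≤k)) ⊹ 0≤A ⊛ (0≤k ⊛ 0≤r ⊛ (0≤k ⊛ 0≤k ⊛ (0≤Γ ⊛ 0≤Γ) ⊛ ((0≤2 ⊹ 0≤2 ⊹ 0≤1) ⊛ 0≤Γ ⊹ 0≤2 ⊛ 0≤r)))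
    -- One sum of everything that `κ₀` has to beat: `κ₀ * Y` must be at most half of `ε₁`, and `κ₀`
    -- times each other summand at most 1.
    D = Y + (Γ + (r + (k * r + 1ℚ)))
    0<D : 0ℚ < D
    0<D = <-≤-trans 0<1 (≤-cert _ (eq Y Γ r (k * r)) (0≤Y ⊹ (0≤Γ ⊹ (0≤r ⊹ 0≤k ⊛ 0≤r))))
      where
      eq : ∀ a b c d → a + (b + (c + (d + 1ℚ))) ≡ 1ℚ + (a + (b + (c + d)))
      eq = solve-∀ ring
    κ₀ = ½ * ε₁ * proj₁ (inverse 0<D)
    0<κ₀ : 0ℚ < κ₀
    0<κ₀ = 0<p*q (0<p*q (positive⁻¹ ½) 0<ε₁) (proj₁ (proj₂ (inverse 0<D)))
    0≤κ₀ : 0ℚ ≤ κ₀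
    0≤κ₀ = <⇒≤ 0<κ₀
    κ₀D≡ : κ₀ * D ≡ ½ * ε₁
    κ₀D≡ = trans (eq (½ * ε₁) (proj₁ (inverse 0<D)) D) (trans (cong (½ * ε₁ *_) (proj₂ (proj₂ (inverse 0<D)))) (*-identityʳ _))
      where
      eq : ∀ a i d → a * i * d ≡ a * (d * i)
      eq = solve-∀ ring
    κ₀D≤1 : κ₀ * D ≤ 1ℚ
    κ₀D≤1 = subst (_≤ 1ℚ) (sym κ₀D≡) (≤-cert _ (eq ε₁) (nonNegative⁻¹ (½ * ½) ⊛ p≤q⇒0≤q-p 2ε₁≤1 ⊹ nonNegative⁻¹ (½ + ½ * ½)))
      where
      eq : ∀ e → 1ℚ ≡ ½ * e + (½ * ½ * (1ℚ - 2ℚ * e) + (½ + ½ * ½))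
      eq = solve-∀ ring
    0≤kr+1 : 0ℚ ≤ k * r + 1ℚ
    0≤kr+1 = 0≤k ⊛ 0≤r ⊹ 0≤1
    κ₀tail≤1 : κ₀ * (Γ + (r + (k * r + 1ℚ))) ≤ 1ℚ
    κ₀tail≤1 = ≤-trans (≤-component′ Y _ 0≤κ₀ 0≤Y) κ₀D≤1
    κ₀Y≤ : κ₀ * Y ≤ ½ * ε₁
    κ₀Y≤ = subst (κ₀ * Y ≤_) κ₀D≡ (≤-component Y (Γ + (r + (k * r + 1ℚ))) 0≤κ₀ (0≤Γ ⊹ (0≤r ⊹ 0≤kr+1)))
    κ₀Γ≤1 : κ₀ * Γ ≤ 1ℚ
    κ₀Γ≤1 = ≤-trans (≤-component Γ (r + (k * r + 1ℚ)) 0≤κ₀ (0≤r ⊹ 0≤kr+1)) κ₀tail≤1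
    κ₀tail′≤1 : κ₀ * (r + (k * r + 1ℚ)) ≤ 1ℚ
    κ₀tail′≤1 = ≤-trans (≤-component′ Γ _ 0≤κ₀ 0≤Γ) κ₀tail≤1
    κ₀r≤1 : κ₀ * r ≤ 1ℚ
    κ₀r≤1 = ≤-trans (≤-component r (k * r + 1ℚ) 0≤κ₀ 0≤kr+1) κ₀tail′≤1
    κ₀tail″≤1 : κ₀ * (k * r + 1ℚ) ≤ 1ℚ
    κ₀tail″≤1 = ≤-trans (≤-component′ r _ 0≤κ₀ 0≤r) κ₀tail′≤1
    κ₀kr≤1 : κ₀ * (k * r) ≤ 1ℚ
    κ₀kr≤1 = ≤-trans (≤-component (k * r) 1ℚ 0≤κ₀ 0≤1) κ₀tail″≤1
    κ₀≤1 : κ₀ ≤ 1ℚ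
    κ₀≤1 = ≤-trans (subst (_≤ κ₀ * (k * r + 1ℚ)) (*-identityʳ κ₀) (≤-component′ (k * r) 1ℚ 0≤κ₀ (0≤k ⊛ 0≤r))) κ₀tail″≤1

    cover : {P I : Set} (mem : I → P → Bool) (xs : List I) (ps : List P) (w : I → ℚ) → let open System mem xs in
      Unique ps → (∀ {A} → A ∈ xs → 0ℚ ≤ w A) → (∀ {A} → A ∈ xs → size ps A ≤ k) →
      (∀ {T} → T ∈ ps → deg w T ≡ 1ℚ) →
      (∀ {T T′} → T ∈ ps → T′ ∈ ps → T′ ≢ T → codeg w T T′ ≤ κ₀) →
      1ℚ ≤ κ₀ * ∑ xs w →
      Σ (List I) λ L → Σ (List P) λ rest → (∀ {B} → B ∈ L → B ∈ xs) ×
        (∀ {T} → T ∈ ps → T ∈ rest ⊎ (∃ λ B → B ∈ L × mem B T ≡ true)) ×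
        ι (length L) + ι (length rest) ≤ (1ℚ + ε) * ∑ xs w
    cover {P} {I} mem xs ps w uniq 0≤w size≤k deg≡1 codeg≤κ₀ 1≤κ₀W₀ =
      L , rest , L⊆xs , covered , *-cancel 0<1-ε₁ total
      where
      open System mem xs using (deg; codeg; size; m; 0≤m)
      W₀ : ℚ
      W₀ = ∑ xs w
      0≤W₀ : 0ℚ ≤ W₀
      0≤W₀ = 0≤∑ xs 0≤w
      1≤W₀ : 1ℚ ≤ W₀
      1≤W₀ = ≤-trans 1≤κ₀W₀ (subst (κ₀ * W₀ ≤_) (*-identityˡ W₀) (*-monoʳ 0≤W₀ κ₀≤1))
      0<ε₁W₀ : 0ℚ < ε₁ * W₀
      0<ε₁W₀ = 0<p*q 0<ε₁ (<-≤-trans 0<1 1≤W₀)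
      lam₀ κ : ℚ
      lam₀ = proj₁ (inverse 0<ε₁W₀)
      0≤lam₀ : 0ℚ ≤ lam₀
      0≤lam₀ = <⇒≤ (proj₁ (proj₂ (inverse 0<ε₁W₀)))
      lam₀-spec : ε₁ * W₀ * lam₀ ≡ 1ℚ
      lam₀-spec = proj₂ (proj₂ (inverse 0<ε₁W₀))
      W₀lam₀≡r : W₀ * lam₀ ≡ r
      W₀lam₀≡r = trans (sym (*-identityʳ _)) (trans (cong (W₀ * lam₀ *_) (sym ε₁r≡1)) (trans (eq W₀ lam₀ ε₁ r) (trans (cong (_* r) lam₀-spec) (*-identityˡ r))))
        where
        eq : ∀ w l e r → w * l * (e * r) ≡ e * w * l * r
        eq = solve-∀ ring
      lam₀≤κ₀r : lam₀ ≤ κ₀ * r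
      lam₀≤κ₀r = subst₂ _≤_ (*-identityˡ lam₀) (trans (*-assoc κ₀ W₀ lam₀) (cong (κ₀ *_) W₀lam₀≡r)) (*-monoʳ 0≤lam₀ 1≤κ₀W₀)
      -- Codegrees start below `κ₀` and grow by at most `g ^ N ≤ Γ` during the run.
      κ = κ₀ * Γ
      0≤κ : 0ℚ ≤ κ
      0≤κ = 0≤κ₀ ⊛ 0≤Γ
      k*lam₀≤1 : k * lam₀ ≤ 1ℚ
      k*lam₀≤1 = ≤-trans (*-monoˡ 0≤k lam₀≤κ₀r) (subst (_≤ 1ℚ) (eq κ₀ k r) κ₀kr≤1)
        where
        eq : ∀ a b c → a * (b * c) ≡ b * (a * c)
        eq = solve-∀ ring
      module Lp = Loop mem xs k ε₁ W₀ lam₀ r Γ κ b β 1≤k 0<ε₁ 0≤W₀ 0≤lam₀ lam₀-spec ε₁r≡1 1≤Γ 0≤κ 0≤b (<⇒≤ 0<β) b*β≡1 k*lam₀≤1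
      open Lp using (g; h; ρ₀; c₀; α; State; Ψ; cost; stop-cost)
      N : ℕ
      -- The potential starts at `W₀` and drops by `1 - ε₁ ≥ ½` per step, so `2 W₀` steps suffice.
      N = proj₁ (round-up (2ℚ * W₀) (0≤2 ⊛ 0≤W₀))
      2W₀≤N : 2ℚ * W₀ ≤ ι N
      2W₀≤N = proj₁ (proj₂ (round-up (2ℚ * W₀) (0≤2 ⊛ 0≤W₀)))
      N≤3W₀ : ι N ≤ (1ℚ + 2ℚ) * W₀
      N≤3W₀ = ≤-trans (proj₂ (proj₂ (round-up (2ℚ * W₀) (0≤2 ⊛ 0≤W₀)))) (≤-cert _ (eq W₀) (p≤q⇒0≤q-p 1≤W₀))
        where
        eq : ∀ w → (1ℚ + 2ℚ) * w ≡ (1ℚ + 2ℚ * w) + (w - 1ℚ)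
        eq = solve-∀ ring
      N*lam₀≤ : ∀ {u} → 0ℚ ≤ u → 2ℚ * (ι N * (u * lam₀)) ≤ 2ℚ * (1ℚ + 2ℚ) * (u * r)
      N*lam₀≤ {u} 0≤u = ≤-trans (*-monoˡ 0≤2 (*-monoʳ (0≤u ⊛ 0≤lam₀) N≤3W₀))
        (≤-reflexive (trans (eq W₀ u lam₀) (cong (λ v → 2ℚ * (1ℚ + 2ℚ) * (u * v)) W₀lam₀≡r)))
        where
        eq : ∀ w u l → 2ℚ * ((1ℚ + 2ℚ) * w * (u * l)) ≡ 2ℚ * (1ℚ + 2ℚ) * (u * (w * l))
        eq = solve-∀ ring
      g^N≤Γ : g ^ N ≤ Γ
      g^N≤Γ = growth≤2^ N J₁ (0≤k ⊛ 0≤lam₀) (≤-trans (N*lam₀≤ 0≤k)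
        (≤-trans (proj₂ (archimedean (2ℚ * (1ℚ + 2ℚ) * (k * r)))) (ι-mono (ℕ.n≤1+n J₁))))
      0≤k²Γ² : 0ℚ ≤ k * k * (Γ * Γ)
      0≤k²Γ² = 0≤k ⊛ 0≤k ⊛ (0≤Γ ⊛ 0≤Γ)
      ρ₀≤ : ρ₀ ≤ k * k * (Γ * Γ) * 2ℚ
      ρ₀≤ = *-monoˡ 0≤k²Γ² (+-mono-≤ κ₀Γ≤1 (≤-trans lam₀≤κ₀r κ₀r≤1))
      0≤ρ₀ : 0ℚ ≤ ρ₀
      0≤ρ₀ = 0≤k²Γ² ⊛ (0≤κ ⊹ 0≤lam₀)
      α≤A : α N ≤ A
      α≤A = *-monoˡ 0≤b (growth≤2^ N J₂ (0≤lam₀ ⊛ (0≤1 ⊹ (0≤2 ⊛ 0≤Γ ⊹ 0≤ρ₀))) (≤-trans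
        (*-monoˡ 0≤2 (*-monoˡ (0≤ι N) (≤-trans (*-monoˡ 0≤lam₀ (+-monoʳ-≤ 1ℚ (+-monoʳ-≤ (2ℚ * Γ) ρ₀≤))) (≤-reflexive (*-comm lam₀ C)))))
        (≤-trans (N*lam₀≤ 0≤C) (≤-trans (≤-reflexive (cong (2ℚ * (1ℚ + 2ℚ) *_) (*-comm C r)))
          (≤-trans (proj₂ (archimedean (2ℚ * (1ℚ + 2ℚ) * (r * C)))) (ι-mono (ℕ.n≤1+n J₂)))))))
      err≤ε₁ : 2ℚ * (κ * (k * k)) + k * r * β + A * (k * r * c₀) ≤ ε₁
      err≤ε₁ = begin
        2ℚ * (κ * (k * k)) + k * r * β + A * (k * r * c₀)
          ≤⟨ +-monoʳ-≤ (2ℚ * (κ * (k * k)) + k * r * β) (*-monoˡ 0≤A (*-monoˡ (0≤k ⊛ 0≤r) c₀≤)) ⟩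
        2ℚ * (κ * (k * k)) + k * r * β + A * (k * r * (k * k * (Γ * Γ) * (κ₀ * ((2ℚ + 2ℚ + 1ℚ) * Γ + 2ℚ * r))))
          ≡⟨ eq₁ κ₀ Γ k r β A ((2ℚ + 2ℚ + 1ℚ) * Γ + 2ℚ * r) ⟩
        κ₀ * Y + r * (k * β)
          ≤⟨ +-mono-≤ κ₀Y≤ (≤-reflexive (trans (cong (r *_) kβ≡) (trans (eq₂ r ε₁) (trans (cong (λ u → ½ * ½ * ε₁ * u) ε₁r≡1) (*-identityʳ _))))) ⟩
        ½ * ε₁ + ½ * ½ * ε₁
          ≤⟨ ≤-cert (½ * ½ * ε₁) (eq₃ ε₁) (nonNegative⁻¹ (½ * ½) ⊛ 0≤ε₁) ⟩
        ε₁ ∎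
        where
        open ≤-Reasoning
        eq₀ : ∀ c κ l Γ → c * (κ * Γ + l) + c * (l + 2ℚ * 2ℚ * (κ * Γ)) ≡ c * ((2ℚ + 2ℚ + 1ℚ) * (κ * Γ) + 2ℚ * l)
        eq₀ = solve-∀ ring
        eq₀′ : ∀ κ Γ r → (2ℚ + 2ℚ + 1ℚ) * (κ * Γ) + 2ℚ * (κ * r) ≡ κ * ((2ℚ + 2ℚ + 1ℚ) * Γ + 2ℚ * r)
        eq₀′ = solve-∀ ring
        c₀≤ : c₀ ≤ k * k * (Γ * Γ) * (κ₀ * ((2ℚ + 2ℚ + 1ℚ) * Γ + 2ℚ * r))
        c₀≤ = ≤-trans (≤-reflexive (eq₀ (k * k * (Γ * Γ)) κ₀ lam₀ Γ)) (*-monoˡ 0≤k²Γ²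
          (≤-trans (+-monoʳ-≤ ((2ℚ + 2ℚ + 1ℚ) * (κ₀ * Γ)) (*-monoˡ 0≤2 lam₀≤κ₀r)) (≤-reflexive (eq₀′ κ₀ Γ r))))
        eq₁ : ∀ κ Γ k r β A s → 2ℚ * (κ * Γ * (k * k)) + k * r * β + A * (k * r * (k * k * (Γ * Γ) * (κ * s))) ≡
          κ * (2ℚ * (Γ * (k * k)) + A * (k * r * (k * k * (Γ * Γ) * s))) + r * (k * β)
        eq₁ = solve-∀ ring
        eq₂ : ∀ r e → r * (½ * ½ * (e * e)) ≡ ½ * ½ * e * (e * r)
        eq₂ = solve-∀ ring
        eq₃ : ∀ e → e ≡ (½ * e + ½ * ½ * e) + ½ * ½ * e
        eq₃ = solve-∀ ring
      few : ι (length ps) ≤ k * W₀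
      few = begin
        ι (length ps)                      ≡⟨ sym (trans (∑-cong ps deg≡1) (trans (∑-const 1ℚ ps) (*-identityʳ _))) ⟩
        ∑ ps (deg w)                       ≡⟨ trans (∑-swap ps xs _) (∑-cong xs λ {B} _ → ∑-* (w B) ps _) ⟩
        (∑[ B ∈ xs ] w B * size ps B)      ≤⟨ ∑-mono xs (λ B∈ → *-monoˡ (0≤w B∈) (size≤k B∈)) ⟩
        (∑[ B ∈ xs ] w B * k)              ≡⟨ trans (∑-*ʳ k xs w) (*-comm W₀ k) ⟩
        k * W₀                             ∎
        where open ≤-Reasoning
      start : State N ps w
      start = record
        { uniq   = uniq
        ; nonneg = 0≤w
        ; size≤k = size≤k
        ; few    = few
        ; deg≤   = λ {T} T∈ → subst (_≤ Γ) (sym (trans (cong (_* g ^ N) (deg≡1 T∈)) (*-identityˡ _))) g^N≤Γ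
        ; codeg≤ = λ {T} {T′} T∈ T′∈ T′≢T → *-mono (0≤∑ xs λ {B} B∈ → 0≤w B∈ ⊛ (0≤m B T ⊛ 0≤m B T′)) 0≤Γ (codeg≤κ₀ T∈ T′∈ T′≢T) g^N≤Γ
        }
      F≡W₀ : W₀ + α N * Ψ ps w ≡ W₀
      F≡W₀ = trans (cong (λ p → W₀ + α N * p) (trans (∑-cong ps λ T∈ → cong (λ d → (d - 1ℚ) * (d - 1ℚ)) (deg≡1 T∈)) (∑-zero ps)))
        (trans (cong (W₀ +_) (*-zeroʳ (α N))) (+-identityʳ W₀))
      F≤ : W₀ + α N * Ψ ps w ≤ ι N * (1ℚ - ε₁)
      F≤ = subst (_≤ ι N * (1ℚ - ε₁)) (sym F≡W₀) (≤-cert _ (eq W₀ (ι N) ε₁)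
        (p≤q⇒0≤q-p 2W₀≤N ⊛ (nonNegative⁻¹ ½ ⊹ nonNegative⁻¹ ½ ⊛ p≤q⇒0≤q-p 2ε₁≤1) ⊹ 0≤W₀ ⊛ p≤q⇒0≤q-p 2ε₁≤1))
        where
        eq : ∀ w n e → n * (1ℚ - e) ≡ w + ((n - 2ℚ * w) * (½ + ½ * (1ℚ - 2ℚ * e)) + w * (1ℚ - 2ℚ * e))
        eq = solve-∀ ring
      result : Σ (List I) λ L → Σ (List P) λ rest → (∀ {B} → B ∈ L → B ∈ xs) × Lp.Covered L rest ps × cost L rest ≤ W₀ + α N * Ψ ps w + stop-cost
      result = Lp.run N A α≤A err≤ε₁ N ℕ.≤-refl ps w start F≤
      L : List I
      L = proj₁ result
      rest : List P
      rest = proj₁ (proj₂ result)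
      L⊆xs : ∀ {B} → B ∈ L → B ∈ xs
      L⊆xs = proj₁ (proj₂ (proj₂ result))
      covered : ∀ {T} → T ∈ ps → T ∈ rest ⊎ (∃ λ B → B ∈ L × mem B T ≡ true)
      covered = proj₁ (proj₂ (proj₂ (proj₂ result)))
      cost≤ : cost L rest ≤ W₀ + α N * Ψ ps w + stop-cost
      cost≤ = proj₂ (proj₂ (proj₂ (proj₂ result)))
      0<1-ε₁ : 0ℚ < 1ℚ - ε₁
      0<1-ε₁ = subst (0ℚ <_) (eq ε₁) (0<p+q (positive⁻¹ ½) (nonNegative⁻¹ ½ ⊛ p≤q⇒0≤q-p 2ε₁≤1))
        where
        eq : ∀ e → ½ + ½ * (1ℚ - 2ℚ * e) ≡ 1ℚ - e
        eq = solve-∀ ring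
      total : (1ℚ - ε₁) * (ι (length L) + ι (length rest)) ≤ (1ℚ - ε₁) * ((1ℚ + ε) * W₀)
      total = begin
        (1ℚ - ε₁) * (ι (length L) + ι (length rest))
          ≤⟨ ≤-cert _ (eq₁ ε₁ (ι (length L)) (ι (length rest))) (0≤ε₁ ⊛ 0≤ι (length rest)) ⟩
        cost L rest
          ≤⟨ cost≤ ⟩
        W₀ + α N * Ψ ps w + stop-cost
          ≡⟨ cong₂ (λ f s → f + (k * ε₁ + s) * W₀) F≡W₀ kβ≡ ⟩
        W₀ + (k * ε₁ + ½ * ½ * (ε₁ * ε₁)) * W₀
          ≤⟨ ≤-cert _ (eq₂ ε₁ k W₀ ε) ((0≤ε₁ ⊛ (nonNegative⁻¹ (½ * ½ * ½) ⊛ p≤q⇒0≤q-p 2ε₁≤1 ⊹ (nonNegative⁻¹ (½ + ½ * ½ + ½ * ½ * ½) ⊹ 0≤ε)) ⊛ 0≤W₀)) ⟩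
        W₀ + (ε₁ * (k + 2ℚ + 2ℚ * ε) - ε₁ * (1ℚ + ε)) * W₀
          ≡⟨ cong (λ u → W₀ + (u - ε₁ * (1ℚ + ε)) * W₀) ε₁-spec ⟩
        W₀ + (ε - ε₁ * (1ℚ + ε)) * W₀
          ≡⟨ eq₃ ε₁ W₀ ε ⟩
        (1ℚ - ε₁) * ((1ℚ + ε) * W₀) ∎
        where
        open ≤-Reasoning
        eq₁ : ∀ e l r → (1ℚ - e) * l + r ≡ (1ℚ - e) * (l + r) + e * r
        eq₁ = solve-∀ ring
        eq₂ : ∀ e k w f → w + (e * (k + 2ℚ + 2ℚ * f) - e * (1ℚ + f)) * w ≡
          (w + (k * e + ½ * ½ * (e * e)) * w) + e * (½ * ½ * ½ * (1ℚ - 2ℚ * e) + (½ + ½ * ½ + ½ * ½ * ½ + f)) * w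
        eq₂ = solve-∀ ring
        eq₃ : ∀ e w f → w + (f - e * (1ℚ + f)) * w ≡ (1ℚ - e) * ((1ℚ + f) * w)
        eq₃ = solve-∀ ring

-- A block carries its weight, a tag and its set of points.  To lower the degree of a point T from
-- d ≥ 1 to 1, every block B is split into B with weight w/d and B ∖ {T} with weight w (1 − 1/d).
module Thinning {P C : Set} (_≟ₚ_ : (T T′ : P) → Dec (T ≡ T′)) where

  Block : Set
  Block = ℚ × C × (P → Bool)

  weight : Block → ℚ
  weight = proj₁

  tag : Block → C
  tag = proj₁ ∘ proj₂

  mem : Block → P → Bool
  mem = proj₂ ∘ proj₂

  open System mem using (size; deg; codeg; m; 0≤m)

  without : P → (P → Bool) → P → Bool
  without T B T′ = B T′ ∧ not (does (T′ ≟ₚ T))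

  split : ℚ → P → Block → List Block
  split p T (w , c , B) = (w * p , c , B) ∷ (w * (1ℚ - p) , c , without T B) ∷ []

  ∑-split : ∀ p T xs (u : (P → Bool) → ℚ) → (∑[ A ∈ concatMap (split p T) xs ] weight A * u (mem A)) ≡
    (∑[ A ∈ xs ] weight A * (p * u (mem A) + (1ℚ - p) * u (without T (mem A))))
  ∑-split p T xs u = trans (∑-concatMap (split p T) xs _) (∑-cong xs λ {A} _ → eq (weight A) p (u (mem A)) (u (without T (mem A))))
    where
    eq : ∀ w p a b → w * p * a + (w * (1ℚ - p) * b + 0ℚ) ≡ w * (p * a + (1ℚ - p) * b)
    eq = solve-∀ ring

  without-self : ∀ T B → without T B T ≡ false
  without-self T B rewrite dec-true (T ≟ₚ T) refl with B T
  ... | true  = refl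
  ... | false = refl

  without-other : ∀ {T T′} B → T′ ≢ T → without T B T′ ≡ B T′
  without-other {T} {T′} B T′≢T rewrite dec-false (T′ ≟ₚ T) T′≢T with B T′
  ... | true  = refl
  ... | false = refl

  without-≤ : ∀ T B T′ → χ (without T B T′) ≤ χ (B T′)
  without-≤ T B T′ with B T′ | does (T′ ≟ₚ T)
  ... | true  | true  = 0≤1
  ... | true  | false = ≤-refl
  ... | false | _     = ≤-refl

  without-⊆ : ∀ T B T′ → without T B T′ ≡ true → B T′ ≡ true
  without-⊆ T B T′ eq with B T′
  ... | true = refl

  -- In the application `Q` says that the tag is a clique and `R` that a point is contained in it. A
  -- thinned block loses points but not its tag, so the whole clique remains available for the final
  -- cover.
  record Admissible (Q : C → Set) (R : C → P → Set) (ps : List P) (k κ W : ℚ) (xs : List Block) : Set where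
    field
      nonneg  : ∀ {A} → A ∈ xs → 0ℚ ≤ weight A
      size≤k  : ∀ {A} → A ∈ xs → size [] ps A ≤ k
      codeg≤κ : ∀ {T T′} → T ∈ ps → T′ ∈ ps → T′ ≢ T → codeg xs weight T T′ ≤ κ
      support : ∀ {A} → A ∈ xs → ∀ {T} → mem A T ≡ true → R (tag A) T
      tagged  : ∀ {A} → A ∈ xs → Q (tag A)
      total   : ∑ xs weight ≡ W

  module _ {Q : C → Set} {R : C → P → Set} {ps : List P} {k κ W : ℚ} where

    split-admissible : ∀ {xs p} T → 0ℚ ≤ p → p ≤ 1ℚ → Admissible Q R ps k κ W xs → Admissible Q R ps k κ W (concatMap (split p T) xs)
    split-admissible {xs} {p} T 0≤p p≤1 adm = record
      { nonneg  = λ A∈ → proj₁ (pointwise A∈)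
      ; size≤k  = λ A∈ → proj₁ (proj₂ (pointwise A∈))
      ; codeg≤κ = λ {T₁} {T₂} T₁∈ T₂∈ T₂≢T₁ → ≤-trans (≤-reflexive (∑-split p T xs (λ B → χ (B T₁) * χ (B T₂))))
          (≤-trans (∑-mono xs λ {A} A∈ → *-monoˡ (nonneg A∈) (≤-trans (+-monoʳ-≤ (p * (m [] A T₁ * m [] A T₂))
            (*-monoˡ (p≤q⇒0≤q-p p≤1) (*-mono (0≤χ (without T (mem A) T₁)) (0≤m [] A T₂) (without-≤ T (mem A) T₁) (without-≤ T (mem A) T₂))))
            (≤-reflexive (eq₁ p (m [] A T₁ * m [] A T₂))))) (codeg≤κ T₁∈ T₂∈ T₂≢T₁))
      ; support = λ A∈ → proj₁ (proj₂ (proj₂ (pointwise A∈)))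
      ; tagged  = λ A∈ → proj₂ (proj₂ (proj₂ (pointwise A∈)))
      ; total   = trans (trans (∑-cong (concatMap (split p T) xs) λ {A} _ → sym (*-identityʳ (weight A))) (trans (∑-split p T xs (λ _ → 1ℚ))
          (∑-cong xs λ {A} _ → eq₂ (weight A) p))) total
      }
      where
      open Admissible adm
      eq₁ : ∀ p a → p * a + (1ℚ - p) * a ≡ a
      eq₁ = solve-∀ ring
      eq₂ : ∀ w p → w * (p * 1ℚ + (1ℚ - p) * 1ℚ) ≡ w
      eq₂ = solve-∀ ring
      from : ∀ {xs A} → A ∈ concatMap (split p T) xs → ∃ λ A₀ → A₀ ∈ xs × A ∈ split p T A₀
      from {xs} A∈ = let (A₀ , A₀∈ , A∈split) = find (∈-concatMap⁻ (split p T) {xs = xs} A∈) in A₀ , A₀∈ , A∈split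
      pointwise : ∀ {A} → A ∈ concatMap (split p T) xs → 0ℚ ≤ weight A × size [] ps A ≤ k × (∀ {T} → mem A T ≡ true → R (tag A) T) × Q (tag A)
      pointwise A∈ with from {xs} A∈
      ... | A₀ , A₀∈ , here refl = nonneg A₀∈ ⊛ 0≤p , size≤k A₀∈ , support A₀∈ , tagged A₀∈
      ... | A₀ , A₀∈ , there (here refl) = nonneg A₀∈ ⊛ p≤q⇒0≤q-p p≤1 , ≤-trans (∑-mono ps λ {T′} _ → without-≤ T (mem A₀) T′) (size≤k A₀∈) ,
              (λ {T′} eq → support A₀∈ (without-⊆ T (mem A₀) T′ eq)) , tagged A₀∈

    split-deg-self : ∀ xs p T → deg (concatMap (split p T) xs) weight T ≡ p * deg xs weight T
    split-deg-self xs p T = trans (∑-split p T xs (λ B → χ (B T))) (trans (∑-cong xs λ {A} _ →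
      trans (cong (λ v → weight A * (p * m [] A T + (1ℚ - p) * χ v)) (without-self T (mem A))) (eq (weight A) p (m [] A T))) (∑-* p xs _))
      where
      eq : ∀ w p a → w * (p * a + (1ℚ - p) * 0ℚ) ≡ p * (w * a)
      eq = solve-∀ ring

    split-deg-other : ∀ xs p {T T′} → T′ ≢ T → deg (concatMap (split p T) xs) weight T′ ≡ deg xs weight T′
    split-deg-other xs p {T} {T′} T′≢T = trans (∑-split p T xs (λ B → χ (B T′))) (∑-cong xs λ {A} _ →
      trans (cong (λ v → weight A * (p * m [] A T′ + (1ℚ - p) * χ v)) (without-other (mem A) T′≢T)) (eq (weight A) p (m [] A T′)))
      where
      eq : ∀ w p a → w * (p * a + (1ℚ - p) * a) ≡ w * a
      eq = solve-∀ ring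

    -- Splitting at `T` leaves all other degrees unchanged, so the points can be treated one after
    -- another. The degrees become exactly 1, as `nibble` requires.
    thin : ∀ xs → Admissible Q R ps k κ W xs → (∀ {T} → T ∈ ps → 1ℚ ≤ deg xs weight T) →
      Σ (List Block) λ xs′ → Admissible Q R ps k κ W xs′ × (∀ {T} → T ∈ ps → deg xs′ weight T ≡ 1ℚ)
    thin xs adm 1≤deg = let (xs′ , adm′ , exact , _) = go ps (λ T∈ → T∈) xs adm 1≤deg in xs′ , adm′ , exact
      where
      go : ∀ qs → (∀ {T} → T ∈ qs → T ∈ ps) → ∀ xs → Admissible Q R ps k κ W xs → (∀ {T} → T ∈ ps → 1ℚ ≤ deg xs weight T) →
        Σ (List Block) λ xs′ → Admissible Q R ps k κ W xs′ × (∀ {T} → T ∈ qs → deg xs′ weight T ≡ 1ℚ) ×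
          (∀ {T} → deg xs weight T ≡ 1ℚ → deg xs′ weight T ≡ 1ℚ)
      go [] qs⊆ xs adm 1≤deg = xs , adm , (λ ()) , λ eq → eq
      go (T ∷ qs) qs⊆ xs adm 1≤deg =
        let (ys , adm′ , exact , kept) = go qs (qs⊆ ∘ there) xs′ (split-admissible T 0≤p p≤1 adm) 1≤deg′
        in ys , adm′ , (λ { (here refl) → kept degT≡1 ; (there T∈) → exact T∈ }) , λ eq → kept (preserved eq)
        where
        1≤d : 1ℚ ≤ deg xs weight T
        1≤d = 1≤deg (qs⊆ (here refl))
        inv : ∃ λ i → 0ℚ < i × deg xs weight T * i ≡ 1ℚ
        inv = inverse (<-≤-trans 0<1 1≤d)
        p : ℚ
        p = proj₁ inv
        0≤p : 0ℚ ≤ p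
        0≤p = <⇒≤ (proj₁ (proj₂ inv))
        p≤1 : p ≤ 1ℚ
        p≤1 = subst₂ _≤_ (*-identityˡ p) (proj₂ (proj₂ inv)) (*-monoʳ 0≤p 1≤d)
        xs′ : List Block
        xs′ = concatMap (split p T) xs
        degT≡1 : deg xs′ weight T ≡ 1ℚ
        degT≡1 = trans (split-deg-self xs p T) (trans (*-comm p _) (proj₂ (proj₂ inv)))
        1≤deg′ : ∀ {T′} → T′ ∈ ps → 1ℚ ≤ deg xs′ weight T′
        1≤deg′ {T′} T′∈ with T′ ≟ₚ T
        ... | yes refl = ≤-reflexive (sym degT≡1)
        ... | no T′≢T  = ≤-trans (1≤deg T′∈) (≤-reflexive (sym (split-deg-other xs p T′≢T)))
        preserved : ∀ {T′} → deg xs weight T′ ≡ 1ℚ → deg xs′ weight T′ ≡ 1ℚ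
        preserved {T′} eq with T′ ≟ₚ T
        ... | yes refl = degT≡1
        ... | no T′≢T  = trans (split-deg-other xs p T′≢T) eq

-- Subsets of Fin n

within : ∀ {n} → Subset n → Subset n → Bool
within []      []      = true
within (a ∷ T) (b ∷ K) = (not a ∨ b) ∧ within T K

within-lookup : ∀ {n} (T K : Subset n) → within T K ≡ true → ∀ v → lookup T v ≡ true → lookup K v ≡ true
within-lookup (true ∷ T) (true ∷ K) w zero    refl = refl
within-lookup (a ∷ T)    (b ∷ K)    w (suc v) v∈T with not a ∨ b
... | true = within-lookup T K w v v∈T

lookup-within : ∀ {n} (T K : Subset n) → (∀ v → lookup T v ≡ true → lookup K v ≡ true) → within T K ≡ true
lookup-within []          []      T⊆K = refl
lookup-within (false ∷ T) (b ∷ K) T⊆K = lookup-within T K (T⊆K ∘ suc)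
lookup-within (true ∷ T)  (b ∷ K) T⊆K rewrite T⊆K zero refl = lookup-within T K (T⊆K ∘ suc)

not-within : ∀ {n} (T K : Subset n) → within T K ≡ false → ∃ λ v → lookup T v ≡ true × lookup K v ≡ false
not-within []          []          ()
not-within (true ∷ T)  (false ∷ K) w = zero , refl , refl
not-within (true ∷ T)  (true ∷ K)  w = let (v , p , q) = not-within T K w in suc v , p , q
not-within (false ∷ T) (b ∷ K)     w = let (v , p , q) = not-within T K w in suc v , p , q

-- This conditions on the vertex just added: catching `T` with `v` chosen means catching the rest of
-- `T` afterwards.
within-insert : ∀ {n} (T K : Subset n) v → within T (K [ v ]≔ true) ≡ within (T [ v ]≔ false) K
within-insert (a ∷ T) (b ∷ K) zero    = cong (_∧ within T K) (Bool.∨-zeroʳ (not a))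
within-insert (a ∷ T) (b ∷ K) (suc v) = cong ((not a ∨ b) ∧_) (within-insert T K v)

subsets : ∀ n → List (Subset n)
subsets zero    = [] ∷ []
subsets (suc n) = map (false ∷_) (subsets n) ++ map (true ∷_) (subsets n)

-- The number 2 ^ |K|, as a crude bound for the number of t-cliques inside `K`. In this form it at
-- most doubles when a vertex is added.
count : ∀ {n} → Subset n → ℚ
count {n} K = ∑[ T ∈ subsets n ] χ (within T K)

count-∷ : ∀ {n} b (K : Subset n) → count (b ∷ K) ≡ (1ℚ + χ b) * count K
count-∷ {n} b K = trans (∑-++ (map (false ∷_) (subsets n)) _ _) (trans (cong₂ _+_ (∑-map (false ∷_) (subsets n) _)
    (trans (∑-map (true ∷_) (subsets n) _) (trans (∑-cong (subsets n) λ {T} _ → χ-∧ b (within T K)) (∑-* (χ b) (subsets n) _))))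
  (eq (count K) (χ b)))
  where
  eq : ∀ c x → c + x * c ≡ (1ℚ + x) * c
  eq = solve-∀ ring

0≤count : ∀ {n} (K : Subset n) → 0ℚ ≤ count K
0≤count {n} K = 0≤∑ (subsets n) λ {T} _ → 0≤χ (within T K)

count-∅ : ∀ n → count {n} ⊥ ≡ 1ℚ
count-∅ zero    = refl
count-∅ (suc n) = trans (count-∷ false (⊥ {n})) (trans (cong ((1ℚ + 0ℚ) *_) (count-∅ n)) refl)

count-insert : ∀ {n} (K : Subset n) v → count (K [ v ]≔ true) ≤ 2ℚ * count K
count-insert (b ∷ K) zero = subst₂ _≤_ (sym (count-∷ true K)) (cong (2ℚ *_) (sym (count-∷ b K)))
  (≤-cert _ (eq (count K) (χ b)) ((0≤1 ⊹ 0≤1) ⊛ (0≤χ b ⊛ 0≤count K)))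
  where
  eq : ∀ c x → 2ℚ * ((1ℚ + x) * c) ≡ (1ℚ + 1ℚ) * c + 2ℚ * (x * c)
  eq = solve-∀ ring
count-insert (b ∷ K) (suc v) = subst₂ _≤_ (sym (count-∷ b (K [ v ]≔ true))) (trans (eq (count K) (χ b)) (cong (2ℚ *_) (sym (count-∷ b K))))
  (*-monoˡ (0≤1 ⊹ 0≤χ b) (count-insert K v))
  where
  eq : ∀ c x → (1ℚ + x) * (2ℚ * c) ≡ 2ℚ * ((1ℚ + x) * c)
  eq = solve-∀ ring

card : ∀ {n} → Subset n → ℚ
card {n} A = ∑[ v ∈ allFin n ] χ (lookup A v)

0≤card : ∀ {n} (A : Subset n) → 0ℚ ≤ card A
0≤card {n} A = 0≤∑ (allFin n) λ {v} _ → 0≤χ (lookup A v)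

card-∅ : ∀ {n} (T : Subset n) → card T ≡ 0ℚ → ∀ v → lookup T v ≡ false
card-∅ {n} T card≡0 v = Bool.¬-not λ v∈T → <-irrefl refl (<-≤-trans 0<1 (subst₂ _≤_ (cong χ v∈T) card≡0
  (term≤∑ (allFin n) (λ {u} _ → 0≤χ (lookup T u)) (∈-allFin v))))

card-delete : ∀ {n} (T : Subset n) v → lookup T v ≡ true → card T ≡ 1ℚ + card (T [ v ]≔ false)
card-delete {n} T v v∈T = trans (∑-─ (allFin n) (∈-allFin v) _) (cong₂ _+_ (cong χ v∈T) (sym
  (trans (∑-─ (allFin n) (∈-allFin v) _) (trans (cong₂ _+_ (cong χ (lookup∘update v T false))
    (∑-cong (allFin n ─ ∈-allFin v) λ u∈ → cong χ (lookup∘update′ (─-≢ (allFin⁺ n) (∈-allFin v) u∈) T false))) (+-identityˡ _)))))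

card-delete′ : ∀ {n c} (T : Subset n) v → lookup T v ≡ true → card T ≡ 1ℚ + c → card (T [ v ]≔ false) ≡ c
card-delete′ {c = c} T v v∈T eq = +-cancelˡ′ (trans (sym (card-delete T v v∈T)) eq)
  where
  +-cancelˡ′ : ∀ {a b} → 1ℚ + a ≡ 1ℚ + b → a ≡ b
  +-cancelˡ′ {a} {b} eq = trans (sym (eq′ a)) (trans (cong (_- 1ℚ) eq) (eq′ b))
    where
    eq′ : ∀ a → 1ℚ + a - 1ℚ ≡ a
    eq′ = solve-∀ ring

delete-absent : ∀ {n} (T : Subset n) v → lookup T v ≡ false → T [ v ]≔ false ≡ T
delete-absent T v v∉T = trans (cong (T [ v ]≔_) (sym v∉T)) ([]≔-lookup T v)

∈-delete : ∀ {n} (T : Subset n) v u → lookup (T [ v ]≔ false) u ≡ true → lookup T u ≡ true × u ≢ v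
∈-delete T v u eq with u Fin.≟ v
... | yes refl with () ← trans (sym eq) (lookup∘update u T false)
... | no u≢v = trans (sym (lookup∘update′ u≢v T false)) eq , u≢v

card-mono : ∀ {n} (A B : Subset n) → (∀ v → lookup A v ≡ true → lookup B v ≡ true) → card A ≤ card B
card-mono {n} A B A⊆B = ∑-mono (allFin n) λ {v} _ → pointwise (lookup A v) (lookup B v) (A⊆B v)
  where
  pointwise : ∀ a b → (a ≡ true → b ≡ true) → χ a ≤ χ b
  pointwise false b _ = 0≤χ b
  pointwise true  b f = ≤-reflexive (cong χ (sym (f refl)))

∑-filter-true : {P : Set} (q : P → Bool) (ps : List P) (f : P → ℚ) →
  ∑ (filter (λ p → q p Bool.≟ true) ps) f ≡ (∑[ p ∈ ps ] χ (q p) * f p)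
∑-filter-true q []       f = refl
∑-filter-true q (p ∷ ps) f with q p
... | true  = cong₂ _+_ (sym (*-identityˡ (f p))) (∑-filter-true q ps f)
... | false = trans (∑-filter-true q ps f) (eq (f p) _)
  where
  eq : ∀ a b → b ≡ 0ℚ * a + b
  eq = solve-∀ ring

-- The constant in front of ρ ^ r q ^ -j in the loss caused by stopping the greedy process after r steps.
hc : ℕ → ℚ
hc zero    = 1ℚ
hc (suc j) = 2ℚ * ι (suc j) * hc j

1≤hc : ∀ j → 1ℚ ≤ hc j
1≤hc zero    = ≤-refl
1≤hc (suc j) = *-mono {1ℚ} {2ℚ * ι (suc j)} {1ℚ} {hc j} 0≤1 (≤-trans 0≤1 (1≤hc j))
  (≤-cert _ (eq (ι j)) (0≤1 ⊹ (0≤1 ⊹ 0≤1) ⊛ 0≤ι j)) (1≤hc j)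
  where
  eq : ∀ J → 2ℚ * (1ℚ + J) ≡ 1ℚ + (1ℚ + 2ℚ * J)
  eq = solve-∀ ring

-- A random clique grown greedily: from the current set A of candidates the process stops with
-- probability q/(|A| + q), and otherwise adds a uniformly random v ∈ A and continues with A ∩ N(v).
-- The bias q keeps every single vertex unlikely, and r bounds the number of steps.
module GreedyClique {n : ℕ} (adj : Fin n → Fin n → Bool) (adj-sym : ∀ u v → adj u v ≡ true → adj v u ≡ true)
  (adj-irrefl : ∀ v → adj v v ≡ false) (q iq : ℚ) (0<q : 0ℚ < q) (q*iq≡1 : q * iq ≡ 1ℚ) (0≤iq : 0ℚ ≤ iq) where

  0≤q : 0ℚ ≤ q
  0≤q = <⇒≤ 0<q

  V : List (Fin n)
  V = allFin n

  nbrs : Fin n → Subset n → Subset n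
  nbrs v A = tabulate λ w → lookup A w ∧ adj v w

  nbrs⊆ : ∀ v A w → lookup (nbrs v A) w ≡ true → lookup A w ≡ true × adj v w ≡ true
  nbrs⊆ v A w eq = ∧-split (lookup A w) (adj v w) (trans (sym (lookup∘tabulate (λ w → lookup A w ∧ adj v w) w)) eq)
    where
    ∧-split : ∀ a b → a ∧ b ≡ true → a ≡ true × b ≡ true
    ∧-split true b eq = refl , eq

  nbrs-intro : ∀ v A w → lookup A w ≡ true → adj v w ≡ true → lookup (nbrs v A) w ≡ true
  nbrs-intro v A w a b = trans (lookup∘tabulate (λ w → lookup A w ∧ adj v w) w) (cong₂ _∧_ a b)

  ν : Subset n → ℚ
  ν A = card A + q

  0<ν : ∀ A → 0ℚ < ν A
  0<ν A = subst (0ℚ <_) (+-comm q (card A)) (0<p+q 0<q (0≤card A))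

  iν : Subset n → ℚ
  iν A = proj₁ (inverse (0<ν A))

  0≤iν : ∀ A → 0ℚ ≤ iν A
  0≤iν A = <⇒≤ (proj₁ (proj₂ (inverse (0<ν A))))

  ν*iν≡1 : ∀ A → ν A * iν A ≡ 1ℚ
  ν*iν≡1 A = proj₂ (proj₂ (inverse (0<ν A)))

  elements : Subset n → List (Fin n)
  elements A = filter (λ v → lookup A v Bool.≟ true) V

  extend : ℚ → Fin n → ℚ × Subset n → ℚ × Subset n
  extend i v (p , K) = p * i , K [ v ]≔ true

  -- A finite distribution as a list of probabilities and outcomes. Outcomes may repeat, since only
  -- sums over the list and properties common to all its entries are used.
  dist : ℕ → Subset n → List (ℚ × Subset n)
  dist zero    A = (1ℚ , ⊥) ∷ []
  dist (suc r) A = (q * iν A , ⊥) ∷ concatMap (λ v → map (extend (iν A) v) (dist r (nbrs v A))) (elements A)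

  Clique : Subset n → Set
  Clique K = ∀ {u v} → lookup K u ≡ true → lookup K v ≡ true → u ≢ v → adj u v ≡ true

  record Grown (r : ℕ) (A : Subset n) (pK : ℚ × Subset n) : Set where
    field
      nonneg : 0ℚ ≤ proj₁ pK
      inside : ∀ v → lookup (proj₂ pK) v ≡ true → lookup A v ≡ true
      clique : Clique (proj₂ pK)
      small  : count (proj₂ pK) ≤ 2ℚ ^ r

  ∅-lookup : ∀ {v : Fin n} {X : Set} → lookup (⊥ {n}) v ≡ true → X
  ∅-lookup {v} eq with () ← trans (sym eq) (lookup-replicate v false)

  grown : ∀ r A {pK} → pK ∈ dist r A → Grown r A pK
  grown zero A (here refl) = record
    { nonneg = 0≤1 ; inside = λ v → ∅-lookup ; clique = ∅-lookup ; small = ≤-reflexive (count-∅ n) }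
  grown (suc r) A (here refl) = record
    { nonneg = 0≤q ⊛ 0≤iν A ; inside = λ v → ∅-lookup ; clique = ∅-lookup
    ; small = ≤-trans (≤-reflexive (count-∅ n)) (1≤^ (suc r) (≤-cert 1ℚ refl 0≤1)) }
  grown (suc r) A (there pK∈) = from (find (∈-concatMap⁻ (λ v → map (extend (iν A) v) (dist r (nbrs v A))) {xs = elements A} pK∈))
    where
    from : ∀ {pK} → (∃ λ v → v ∈ elements A × pK ∈ map (extend (iν A) v) (dist r (nbrs v A))) → Grown (suc r) A pK
    from {pK} (v , v∈ , pK∈) = extended (∈-map⁻ (extend (iν A) v) pK∈)
      where
      v∈A : lookup A v ≡ true
      v∈A = proj₂ (∈-filter⁻ (λ v → lookup A v Bool.≟ true) {xs = V} v∈)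
      extended : (∃ λ pK₀ → pK₀ ∈ dist r (nbrs v A) × pK ≡ extend (iν A) v pK₀) → Grown (suc r) A pK
      extended ((p , K) , K∈ , refl) = record
        { nonneg = IH.nonneg ⊛ 0≤iν A
        ; inside = inside′
        ; clique = λ {u} {w} → clique′ u w
        ; small  = ≤-trans (count-insert K v) (*-monoˡ (0≤1 ⊹ 0≤1) IH.small)
        }
        where
        module IH = Grown (grown r (nbrs v A) K∈)
        old : ∀ {u} → u ≢ v → lookup (K [ v ]≔ true) u ≡ true → lookup K u ≡ true
        old u≢v eq = trans (sym (lookup∘update′ u≢v K true)) eq
        inside′ : ∀ u → lookup (K [ v ]≔ true) u ≡ true → lookup A u ≡ true
        inside′ u u∈ with u Fin.≟ v
        ... | yes refl = v∈A
        ... | no u≢v   = proj₁ (nbrs⊆ v A u (IH.inside u (old u≢v u∈)))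
        clique′ : ∀ u w → lookup (K [ v ]≔ true) u ≡ true → lookup (K [ v ]≔ true) w ≡ true → u ≢ w → adj u w ≡ true
        clique′ u w u∈ w∈ u≢w with u Fin.≟ v | w Fin.≟ v
        ... | yes refl | yes refl = ⊥-elim (u≢w refl)
        ... | yes refl | no w≢v   = proj₂ (nbrs⊆ v A w (IH.inside w (old w≢v w∈)))
        ... | no u≢v   | yes refl = adj-sym v u (proj₂ (nbrs⊆ v A u (IH.inside u (old u≢v u∈))))
        ... | no u≢v   | no w≢v   = IH.clique (old u≢v u∈) (old w≢v w∈) u≢w

  expect : ∀ r A (f : Subset n → ℚ) → (∑[ pK ∈ dist (suc r) A ] proj₁ pK * f (proj₂ pK)) ≡
    q * iν A * f ⊥ + iν A * (∑[ v ∈ V ] χ (lookup A v) * (∑[ pK ∈ dist r (nbrs v A) ] proj₁ pK * f (proj₂ pK [ v ]≔ true)))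
  expect r A f = cong (q * iν A * f ⊥ +_) (trans (∑-concatMap _ (elements A) _) (trans
    (∑-cong (elements A) λ {v} _ → trans (∑-map (extend (iν A) v) (dist r (nbrs v A)) _)
      (trans (∑-cong (dist r (nbrs v A)) λ {pK} _ → eq (proj₁ pK) (iν A) (f (proj₂ pK [ v ]≔ true))) (∑-* (iν A) (dist r (nbrs v A)) _)))
    (trans (∑-* (iν A) (elements A) _) (cong (iν A *_) (∑-filter-true (lookup A) V _)))))
    where
    eq : ∀ p i x → p * i * x ≡ i * (p * x)
    eq = solve-∀ ring

  Pr : ℕ → Subset n → Subset n → ℚ
  Pr r A T = ∑[ pK ∈ dist r A ] proj₁ pK * χ (within T (proj₂ pK))

  0≤Pr : ∀ r A T → 0ℚ ≤ Pr r A T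
  0≤Pr r A T = 0≤∑ (dist r A) λ pK∈ → Grown.nonneg (grown r A pK∈) ⊛ 0≤χ _

  Pr-suc : ∀ r A T → Pr (suc r) A T ≡ q * iν A * χ (within T ⊥) +
    iν A * (∑[ v ∈ V ] χ (lookup A v) * Pr r (nbrs v A) (T [ v ]≔ false))
  Pr-suc r A T = trans (expect r A (λ K → χ (within T K))) (cong (λ s → q * iν A * χ (within T ⊥) + iν A * s)
    (∑-cong V λ {v} _ → cong (χ (lookup A v) *_) (∑-cong (dist r (nbrs v A)) λ {pK} _ → cong (λ b → proj₁ pK * χ b) (within-insert T (proj₂ pK) v))))

  total-mass : ∀ r A → ∑ (dist r A) proj₁ ≡ 1ℚ
  total-mass zero    A = +-identityʳ 1ℚ
  total-mass (suc r) A = trans (∑-cong (dist (suc r) A) λ {pK} _ → sym (*-identityʳ (proj₁ pK))) (trans (expect r A (λ _ → 1ℚ))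
    (trans (cong (λ s → q * iν A * 1ℚ + iν A * s) (∑-cong V λ {v} _ → trans (cong (χ (lookup A v) *_)
      (trans (∑-cong (dist r (nbrs v A)) λ {pK} _ → *-identityʳ (proj₁ pK)) (total-mass r (nbrs v A)))) (*-identityʳ _)))
    (trans (eq q (iν A) (card A)) (ν*iν≡1 A))))
    where
    eq : ∀ q i c → q * i * 1ℚ + i * c ≡ (c + q) * i
    eq = solve-∀ ring

  Pr-∅ : ∀ r A T → card T ≡ 0ℚ → Pr r A T ≡ 1ℚ
  Pr-∅ r A T card≡0 = trans (∑-cong (dist r A) λ {pK} _ → trans (cong (λ b → proj₁ pK * χ b)
    (lookup-within T (proj₂ pK) λ v v∈T → ⊥-elim (t≢f (trans (sym v∈T) (card-∅ T card≡0 v))))) (*-identityʳ (proj₁ pK))) (total-mass r A)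
    where
    t≢f : true ≢ false
    t≢f ()

  within-∅ : ∀ T j → card T ≡ ι (suc j) → within T ⊥ ≡ false
  within-∅ T j cardT = Bool.¬-not λ w → <-irrefl (sym (trans (sym cardT) (trans (∑-cong V λ {v} _ →
    cong χ (Bool.¬-not λ v∈T → ∅-lookup (within-lookup T ⊥ w v v∈T))) (∑-zero V)))) (0<ι j)

  -- Each of the `j` vertices has to be picked at one of `r` steps, and at any step a given vertex
  -- is picked with probability at most `1/q`.
  Pr-upper : ∀ r j A S → card S ≡ ι j → Pr r A S ≤ (ι r * iq) ^ j
  Pr-upper r       zero    A S cardS = ≤-reflexive (Pr-∅ r A S cardS)
  Pr-upper zero    (suc j) A S cardS = ≤-trans (≤-reflexive (trans (cong (λ b → 1ℚ * χ b + 0ℚ) (within-∅ S j cardS)) refl))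
    (0≤^ (suc j) (≤-refl ⊛ 0≤iq))
  Pr-upper (suc r) (suc j) A S cardS = begin
    Pr (suc r) A S
      ≡⟨ trans (Pr-suc r A S) (trans (cong (λ b → q * iν A * χ b + i * ∑ V F) (within-∅ S j cardS)) (eq₁ (q * iν A) (i * ∑ V F))) ⟩
    i * ∑ V F
      ≤⟨ *-monoˡ (0≤iν A) (∑-mono V λ {v} _ → pointwise v) ⟩
    i * (∑[ v ∈ V ] (χ (lookup S v) * U j + χ (lookup A v) * U (suc j)))
      ≡⟨ cong (i *_) (trans (∑-+ V _ _) (cong₂ _+_ (trans (∑-*ʳ (U j) V _) (cong (_* U j) cardS)) (∑-*ʳ (U (suc j)) V _))) ⟩
    i * (ι (suc j) * U j + card A * U (suc j))
      ≤⟨ ≤-cert _ (eq₂ i (ι (suc j)) (U j) (card A) (U (suc j)) iq) (p≤q⇒0≤q-p i≤iq ⊛ (0≤ι (suc j) ⊛ 0≤U j) ⊹ p≤q⇒0≤q-p i*card≤1 ⊛ 0≤U (suc j)) ⟩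
    iq * (ι (suc j) * U j) + U (suc j)
      ≡⟨ trans (cong₂ (λ a b → iq * (ι (suc j) * a) + b) (*-^ (ι r) iq j) (*-^ (ι r) iq (suc j))) (eq₃ iq (ι (suc j)) (ι r ^ j) (iq ^ j) (ι r ^ suc j)) ⟩
    (ι r ^ suc j + ι (suc j) * ι r ^ j) * iq ^ suc j
      ≤⟨ *-monoʳ (0≤^ (suc j) 0≤iq) (two-binomial-terms j (0≤ι r)) ⟩
    ι (suc r) ^ suc j * iq ^ suc j
      ≡⟨ sym (*-^ (ι (suc r)) iq (suc j)) ⟩
    (ι (suc r) * iq) ^ suc j ∎
    where
    open ≤-Reasoning
    i : ℚ
    i = iν A
    U : ℕ → ℚ
    U j = (ι r * iq) ^ j
    0≤U : ∀ j → 0ℚ ≤ U j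
    0≤U j = 0≤^ j (0≤ι r ⊛ 0≤iq)
    F : Fin n → ℚ
    F v = χ (lookup A v) * Pr r (nbrs v A) (S [ v ]≔ false)
    eq₁ : ∀ a b → a * 0ℚ + b ≡ b
    eq₁ = solve-∀ ring
    eq₂ : ∀ i J u c w iq → iq * (J * u) + w ≡ i * (J * u + c * w) + ((iq - i) * (J * u) + (1ℚ - i * c) * w)
    eq₂ = solve-∀ ring
    eq₃ : ∀ iq J a b c → iq * (J * (a * b)) + c * (iq * b) ≡ (c + J * a) * (iq * b)
    eq₃ = solve-∀ ring
    i*card≤1 : i * card A ≤ 1ℚ
    i*card≤1 = ≤-cert (q * i) (trans (sym (ν*iν≡1 A)) (eq (card A) q i)) (0≤q ⊛ 0≤iν A)
      where
      eq : ∀ c q i → (c + q) * i ≡ i * c + q * i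
      eq = solve-∀ ring
    i≤iq : i ≤ iq
    i≤iq = subst₂ _≤_ (trans (eq q i iq) (trans (cong (i *_) q*iq≡1) (*-identityʳ i))) (*-identityˡ iq)
      (*-monoʳ 0≤iq (≤-cert {q * i} (i * card A) (trans (sym (ν*iν≡1 A)) (eq′ (card A) q i)) (0≤iν A ⊛ 0≤card A)))
      where
      eq : ∀ q i j → q * i * j ≡ i * (q * j)
      eq = solve-∀ ring
      eq′ : ∀ c q i → (c + q) * i ≡ q * i + i * c
      eq′ = solve-∀ ring
    pointwise : ∀ v → F v ≤ χ (lookup S v) * U j + χ (lookup A v) * U (suc j)
    pointwise v = by (lookup S v) refl
      where
      by : ∀ s → lookup S v ≡ s → F v ≤ χ s * U j + χ (lookup A v) * U (suc j)
      by true v∈S = ≤-trans (*-mono (0≤χ (lookup A v)) (0≤U j) (χ≤1 (lookup A v)) (Pr-upper r j (nbrs v A) (S [ v ]≔ false) (card-delete′ S v v∈S cardS)))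
        (≤-cert _ refl (0≤χ (lookup A v) ⊛ 0≤U (suc j)))
      by false v∉S = ≤-trans (*-monoˡ (0≤χ (lookup A v)) (Pr-upper r (suc j) (nbrs v A) (S [ v ]≔ false) (trans (cong card (delete-absent S v v∉S)) cardS)))
        (≤-reflexive (eq₄ (U j) (χ (lookup A v) * U (suc j))))
        where
        eq₄ : ∀ a b → b ≡ 0ℚ * a + b
        eq₄ = solve-∀ ring

  card-nbrs : ∀ v A → card A - card (nbrs v A) ≡ (∑[ w ∈ V ] χ (lookup A w) * (1ℚ - χ (adj v w)))
  card-nbrs v A = trans (sym (∑-- V _ _)) (∑-cong V λ {w} _ → trans (cong (λ b → χ (lookup A w) - χ b) (lookup∘tabulate (λ w → lookup A w ∧ adj v w) w))
    (trans (cong (λ x → χ (lookup A w) - x) (χ-∧ (lookup A w) (adj v w))) (eq (χ (lookup A w)) (χ (adj v w)))))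
    where
    eq : ∀ a b → a - a * b ≡ a * (1ℚ - b)
    eq = solve-∀ ring

  card-nbrs≤ : ∀ v A → card (nbrs v A) ≤ card A
  card-nbrs≤ v A = card-mono (nbrs v A) A λ w w∈ → proj₁ (nbrs⊆ v A w w∈)

  -- Every candidate is adjacent to all of T or fails to be adjacent to some vertex of T.
  neighbour-count : ∀ A T → (∀ v → lookup T v ≡ true → lookup A v ≡ true) → card A ≤
    (∑[ v ∈ V ] χ (lookup T v) * (card A - card (nbrs v A))) + (∑[ w ∈ V ] χ (lookup A w) * χ (within T (nbrs w A)))
  neighbour-count A T T⊆A = subst (card A ≤_) (sym sum≡) (∑-mono V λ {w} _ → pointwise w)
    where
    misses : Fin n → ℚ
    misses w = ∑[ v ∈ V ] χ (lookup T v) * (1ℚ - χ (adj v w))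
    0≤misses : ∀ w {v} → v ∈ V → 0ℚ ≤ χ (lookup T v) * (1ℚ - χ (adj v w))
    0≤misses w {v} _ = 0≤χ (lookup T v) ⊛ p≤q⇒0≤q-p (χ≤1 (adj v w))
    eq : ∀ t a b → t * (a * b) ≡ a * (t * b)
    eq = solve-∀ ring
    sum≡ : (∑[ v ∈ V ] χ (lookup T v) * (card A - card (nbrs v A))) + (∑[ w ∈ V ] χ (lookup A w) * χ (within T (nbrs w A))) ≡
      (∑[ w ∈ V ] (χ (lookup A w) * misses w + χ (lookup A w) * χ (within T (nbrs w A))))
    sum≡ = trans (cong (_+ (∑[ w ∈ V ] χ (lookup A w) * χ (within T (nbrs w A)))) (trans
      (∑-cong V λ {v} _ → trans (cong (χ (lookup T v) *_) (card-nbrs v A)) (sym (∑-* (χ (lookup T v)) V _)))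
      (trans (∑-swap V V _) (∑-cong V λ {w} _ → trans (∑-cong V λ {v} _ → eq (χ (lookup T v)) (χ (lookup A w)) (1ℚ - χ (adj v w))) (∑-* (χ (lookup A w)) V _)))))
      (sym (∑-+ V _ _))
    pointwise : ∀ w → χ (lookup A w) ≤ χ (lookup A w) * misses w + χ (lookup A w) * χ (within T (nbrs w A))
    pointwise w = by-member (lookup A w) refl
      where
      bound : lookup A w ≡ true → ∀ c → within T (nbrs w A) ≡ c → 1ℚ ≤ misses w + χ c
      bound w∈A true  c≡ = ≤-cert (misses w) (+-comm (misses w) 1ℚ) (0≤∑ V (0≤misses w))
      bound w∈A false c≡ = let (v , v∈T , v∉) = not-within T (nbrs w A) c≡ in ≤-trans
        (subst (_≤ misses w) (cong₂ (λ a b → χ a * (1ℚ - χ b)) v∈T (missing v v∈T v∉)) (term≤∑ V (0≤misses w) (∈-allFin v)))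
        (≤-reflexive (sym (+-identityʳ (misses w))))
        where
        missing : ∀ v → lookup T v ≡ true → lookup (nbrs w A) v ≡ false → adj v w ≡ false
        missing v v∈T v∉ = Bool.¬-not λ vw → case trans (sym v∉) (nbrs-intro w A v (T⊆A v v∈T) (adj-sym v w vw)) of λ ()
      by-member : ∀ a → lookup A w ≡ a → χ a ≤ χ a * misses w + χ a * χ (within T (nbrs w A))
      by-member false _   = ≤-reflexive (eq₀ (misses w) (χ (within T (nbrs w A))))
        where
        eq₀ : ∀ a b → 0ℚ ≡ 0ℚ * a + 0ℚ * b
        eq₀ = solve-∀ ring
      by-member true  w∈A = subst (1ℚ ≤_) (cong₂ _+_ (sym (*-identityˡ (misses w))) (sym (*-identityˡ _))) (bound w∈A (within T (nbrs w A)) refl)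

  module Lower (ρ : ℚ) (0≤ρ : 0ℚ ≤ ρ) (contraction : ∀ A → ½ * q + card A ≤ ρ * ν A) where

    loss : ℕ → ℕ → ℚ
    loss r j = hc j * ρ ^ r * iq ^ j

    0≤loss : ∀ r j → 0ℚ ≤ loss r j
    0≤loss r j = ≤-trans 0≤1 (1≤hc j) ⊛ 0≤^ r 0≤ρ ⊛ 0≤^ j 0≤iq

    inverse-size : ∀ (A : Subset n) j → ∃ λ i → 0ℚ < i × (card A + ι (suc j) * q) * i ≡ 1ℚ
    inverse-size A j = inverse (subst (0ℚ <_) (+-comm (ι (suc j) * q) (card A)) (0<p+q (0<p*q (0<ι j) 0<q) (0≤card A)))

    ι*i≤iq : ∀ (A : Subset n) j i → 0ℚ ≤ i → (card A + ι j * q) * i ≡ 1ℚ → ι j * i ≤ iq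
    ι*i≤iq A j i 0≤i Mi≡1 = subst₂ _≤_ (trans (eq (ι j) q i iq) (trans (cong (ι j * i *_) q*iq≡1) (*-identityʳ _))) (*-identityˡ iq)
      (*-monoʳ 0≤iq (≤-cert {ι j * q * i} (card A * i) (trans (sym Mi≡1) (eq′ (card A) (ι j * q) i)) (0≤card A ⊛ 0≤i)))
      where
      eq : ∀ j q i k → j * q * i * k ≡ j * i * (q * k)
      eq = solve-∀ ring
      eq′ : ∀ c q i → (c + q) * i ≡ q * i + c * i
      eq′ = solve-∀ ring

    -- Used with the effective sizes M = |A| + (j + 1) q and M′ = |A ∩ N(v)| + j q: the bound to be proved for
    -- A ∩ N(v) is replaced by its tangent, which makes the sum over the vertices v of the clique linear.
    tangent : ∀ {a b M M′} j → 0ℚ < a → 0ℚ ≤ b → b * M ≡ ι (suc j) → a * M′ ≡ ι j → b ^ suc j * (M - M′) ≤ a ^ j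
    tangent {a} {b} {M} {M′} j 0<a 0≤b bM≡ aM′≡ = *-cancel 0<a (≤-cert _
      (trans (eq₁ (a ^ suc j) (b ^ suc j) (b ^ j * a) (ι j)) (cong (_+ D) (sym lhs≡))) (p≤q⇒0≤q-p (weighted-AM-GM j (<⇒≤ 0<a) 0≤b)))
      where
      D : ℚ
      D = a ^ suc j + ι j * b ^ suc j - (1ℚ + ι j) * (b ^ j * a)
      eq₁ : ∀ A B C J → A ≡ (C * (1ℚ + J) - B * J) + (A + J * B - (1ℚ + J) * C)
      eq₁ = solve-∀ ring
      eq₂ : ∀ a b B M M′ → a * (b * B * (M - M′)) ≡ B * a * (b * M) - b * B * (a * M′)
      eq₂ = solve-∀ ring
      lhs≡ : a * (b ^ suc j * (M - M′)) ≡ b ^ j * a * (1ℚ + ι j) - b ^ suc j * ι j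
      lhs≡ = trans (eq₂ a b (b ^ j) M M′) (cong₂ (λ x y → b ^ j * a * x - b ^ suc j * y) bM≡ aM′≡)

    -- The effective size |A| + j q charges the bias once for every vertex of `T` still to be
    -- caught. Picking a vertex of `T` lowers it by at least `q`; picking a common neighbour keeps
    -- `T` intact in a smaller candidate set.
    Pr-lower : ∀ r j A T i → (∀ v → lookup T v ≡ true → lookup A v ≡ true) → Clique T → card T ≡ ι j →
      0ℚ ≤ i → (card A + ι j * q) * i ≡ 1ℚ → (ι j * i) ^ j ≤ Pr r A T + loss r j
    Pr-lower r zero A T i T⊆A cliqueT cardT 0≤i Mi≡1 =
      ≤-cert (loss r 0) (cong (_+ loss r 0) (Pr-∅ r A T cardT)) (0≤loss r 0)
    -- When no steps remain, the loss alone dominates: each factor is at most `1/q`, and `hc` is at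
    -- least 1.
    Pr-lower zero (suc j) A T i T⊆A cliqueT cardT 0≤i Mi≡1 = ≤-trans (^-mono (suc j) (0≤ι (suc j) ⊛ 0≤i) (ι*i≤iq A (suc j) i 0≤i Mi≡1))
      (≤-cert _ (eq (Pr 0 A T) (hc (suc j)) (iq ^ suc j)) (0≤Pr 0 A T ⊹ p≤q⇒0≤q-p (1≤hc (suc j)) ⊛ 0≤^ (suc j) 0≤iq))
      where
      eq : ∀ p h x → p + h * 1ℚ * x ≡ x + (p + (h - 1ℚ) * x)
      eq = solve-∀ ring
    Pr-lower (suc r) (suc j) A T i T⊆A cliqueT cardT 0≤i Mi≡1 = begin
      X
        -- The process normalises by |A| + q, which is at most the effective size.
        ≤⟨ ≤-cert _ (absorb′ (ν*iν≡1 A)) (0≤iν A ⊛ (0≤X ⊛ (0≤ι j ⊛ 0≤q))) ⟩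
      i′ * (X * (card A + ι (suc j) * q))
        ≤⟨ *-monoˡ (0≤iν A) (*-monoˡ 0≤X (≤-trans (+-monoˡ-≤ (ι (suc j) * q) (neighbour-count A T T⊆A)) (≤-reflexive (eq₁ Σ₁ Σ₂ (ι (suc j) * q))))) ⟩
      i′ * (X * ((Σ₁ + ι (suc j) * q) + Σ₂))
        ≤⟨ *-monoˡ (0≤iν A) (≤-cert _ (eq₂ X Σ₁ (ι (suc j) * q) Σ₂ (ι (suc j) * loss r j) (card A) (loss r (suc j))) (p≤q⇒0≤q-p Σ₂≤card ⊛ 0≤loss r (suc j))) ⟩
      i′ * ((X * (Σ₁ + ι (suc j) * q) - ι (suc j) * loss r j + Σ₂ * (X - loss r (suc j))) + (ι (suc j) * loss r j + card A * loss r (suc j)))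
        ≤⟨ *-monoˡ (0≤iν A) (+-mono-≤ (≤-trans (≤-reflexive (sym sum-lower≡)) (∑-mono V λ {v} _ → vertex v)) (≤-reflexive losses≡)) ⟩
      i′ * (∑ V F + (½ * q + card A) * loss r (suc j))
        ≤⟨ *-monoˡ (0≤iν A) (+-monoʳ-≤ (∑ V F) (*-monoʳ (0≤loss r (suc j)) (contraction A))) ⟩
      i′ * (∑ V F + ρ * ν A * loss r (suc j))
        ≡⟨ trans (eq₃ i′ (∑ V F) ρ (ν A) (hc (suc j)) (ρ ^ r) (iq ^ suc j)) (trans (cong (λ u → i′ * ∑ V F + u * loss (suc r) (suc j)) (ν*iν≡1 A)) (cong (i′ * ∑ V F +_) (*-identityˡ _))) ⟩
      i′ * ∑ V F + loss (suc r) (suc j)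
        ≤⟨ +-monoˡ-≤ (loss (suc r) (suc j)) (≤-cert {i′ * ∑ V F} _ (trans (Pr-suc r A T) (+-comm (q * iν A * χ (within T ⊥)) (i′ * ∑ V F))) (0≤q ⊛ 0≤iν A ⊛ 0≤χ (within T ⊥))) ⟩
      Pr (suc r) A T + loss (suc r) (suc j) ∎
      where
      open ≤-Reasoning
      i′ X Σ₁ Σ₂ : ℚ
      i′ = iν A
      X = (ι (suc j) * i) ^ suc j
      0≤X : 0ℚ ≤ X
      0≤X = 0≤^ (suc j) (0≤ι (suc j) ⊛ 0≤i)
      Σ₁ = ∑[ v ∈ V ] χ (lookup T v) * (card A - card (nbrs v A))
      Σ₂ = ∑[ w ∈ V ] χ (lookup A w) * χ (within T (nbrs w A))
      F : Fin n → ℚ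
      F v = χ (lookup A v) * Pr r (nbrs v A) (T [ v ]≔ false)
      eq₁ : ∀ a b c → a + b + c ≡ (a + c) + b
      eq₁ = solve-∀ ring
      eq₂ : ∀ X a b c l n m → (X * (a + b) - l + c * (X - m)) + (l + n * m) ≡ X * ((a + b) + c) + (n - c) * m
      eq₂ = solve-∀ ring
      eq₃ : ∀ i s ρ v h p x → i * (s + ρ * v * (h * p * x)) ≡ i * s + v * i * (h * (ρ * p) * x)
      eq₃ = solve-∀ ring
      absorb′ : ν A * i′ ≡ 1ℚ → i′ * (X * (card A + ι (suc j) * q)) ≡ X + i′ * (X * (ι j * q))
      absorb′ eq = trans (eq₀ i′ X (card A) (ι j) q) (trans (cong (λ u → u * X + i′ * (X * (ι j * q))) eq) (cong (_+ i′ * (X * (ι j * q))) (*-identityˡ X)))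
        where
        eq₀ : ∀ i X c J q → i * (X * (c + (1ℚ + J) * q)) ≡ (c + q) * i * X + i * (X * (J * q))
        eq₀ = solve-∀ ring
      Σ₂≤card : Σ₂ ≤ card A
      Σ₂≤card = ∑-mono V λ {w} _ → subst (χ (lookup A w) * χ (within T (nbrs w A)) ≤_) (*-identityʳ _) (*-monoˡ (0≤χ (lookup A w)) (χ≤1 (within T (nbrs w A))))
      -- The recursion for `hc` is made for this: `j + 1` losses for one vertex fewer equal `½ * q`
      -- losses for `j + 1` vertices, and `contraction` absorbs that half.
      losses≡ : ι (suc j) * loss r j + card A * loss r (suc j) ≡ (½ * q + card A) * loss r (suc j)
      losses≡ = trans (cong (λ l → l + card A * loss r (suc j)) (trans (sym (*-identityˡ (ι (suc j) * loss r j))) (trans (cong (_* (ι (suc j) * loss r j)) (sym q*iq≡1)) (eq q iq (ι (suc j)) (hc j) (ρ ^ r) (iq ^ j)))))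
        (sym (*-distribʳ-+ (loss r (suc j)) (½ * q) (card A)))
        where
        eq : ∀ q k J h p x → q * k * (J * (h * p * x)) ≡ ½ * q * (2ℚ * J * h * p * (k * x))
        eq = solve-∀ ring
      gain : Fin n → ℚ
      gain v = X * (card A - card (nbrs v A) + q) - loss r j
      sum-lower≡ : (∑[ v ∈ V ] (χ (lookup T v) * gain v + χ (lookup A v) * χ (within T (nbrs v A)) * (X - loss r (suc j)))) ≡
        X * (Σ₁ + ι (suc j) * q) - ι (suc j) * loss r j + Σ₂ * (X - loss r (suc j))
      sum-lower≡ = trans (∑-+ V _ _) (cong₂ _+_ (trans (∑-cong V λ {v} _ → eq (χ (lookup T v)) X (card A - card (nbrs v A)) q (loss r j))
        (trans (∑-+ V _ _) (trans (cong₂ _+_ (∑-* X V _) (trans (∑-*ʳ (X * q - loss r j) V _) (cong (_* (X * q - loss r j)) cardT))) (eq′ X Σ₁ (ι (suc j)) q (loss r j)))))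
        (∑-*ʳ (X - loss r (suc j)) V _))
        where
        eq : ∀ t X d q l → t * (X * (d + q) - l) ≡ X * (t * d) + t * (X * q - l)
        eq = solve-∀ ring
        eq′ : ∀ X s J q l → X * s + J * (X * q - l) ≡ X * (s + J * q) - J * l
        eq′ = solve-∀ ring
      gain≤ : ∀ v → lookup T v ≡ true → gain v ≤ Pr r (nbrs v A) (T [ v ]≔ false)
      gain≤ v v∈T = ≤-cert (P + loss r j - Y) (eq P (loss r j) Y) (p≤q⇒0≤q-p (Y≤ j refl))
        where
        P Y : ℚ
        P = Pr r (nbrs v A) (T [ v ]≔ false)
        Y = X * (card A - card (nbrs v A) + q)
        eq : ∀ P l Y → P ≡ (Y - l) + (P + l - Y)
        eq = solve-∀ ring
        cardT′ : card (T [ v ]≔ false) ≡ ι j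
        cardT′ = card-delete′ T v v∈T cardT
        T′⊆ : ∀ u → lookup (T [ v ]≔ false) u ≡ true → lookup (nbrs v A) u ≡ true
        T′⊆ u u∈ = let (u∈T , u≢v) = ∈-delete T v u u∈ in nbrs-intro v A u (T⊆A u u∈T) (cliqueT v∈T u∈T (u≢v ∘ sym))
        cliqueT′ : Clique (T [ v ]≔ false)
        cliqueT′ {u} {w} u∈ w∈ = cliqueT (proj₁ (∈-delete T v u u∈)) (proj₁ (∈-delete T v w w∈))
        Y≤ : ∀ j′ → j′ ≡ j → Y ≤ P + loss r j
        -- For a single vertex the slope `ι j * iᵥ` would be 0 and `tangent` does not apply. The
        -- remaining set is empty, hence caught with probability 1.
        Y≤ zero    refl = ≤-trans (≤-cert (i * card (nbrs v A)) (trans (sym Mi≡1) (eq′ i (card A) (card (nbrs v A)) q)) (0≤i ⊛ 0≤card (nbrs v A)))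
          (≤-cert (loss r 0) (cong (_+ loss r 0) (Pr-∅ r (nbrs v A) (T [ v ]≔ false) cardT′)) (0≤loss r 0))
          where
          eq′ : ∀ i c d q → (c + (1ℚ + 0ℚ) * q) * i ≡ (1ℚ + 0ℚ) * i * 1ℚ * (c - d + q) + i * d
          eq′ = solve-∀ ring
        Y≤ (suc j″) refl = let (iᵥ , 0<iᵥ , Mᵥiᵥ≡1) = inverse-size (nbrs v A) j″ in ≤-trans
          (≤-trans (≤-reflexive (cong (X *_) (eq′ (card A) (card (nbrs v A)) q (ι j))))
            (tangent j (0<p*q (0<ι j″) 0<iᵥ) (0≤ι (suc j) ⊛ 0≤i) (scaled (ι (suc j)) i (card A + ι (suc j) * q) Mi≡1) (scaled (ι j) iᵥ (card (nbrs v A) + ι j * q) Mᵥiᵥ≡1)))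
          (Pr-lower r j (nbrs v A) (T [ v ]≔ false) iᵥ T′⊆ (λ {u} {w} → cliqueT′ {u} {w}) cardT′ (<⇒≤ 0<iᵥ) Mᵥiᵥ≡1)
          where
          eq′ : ∀ c d q J → c - d + q ≡ (c + (1ℚ + J) * q) - (d + J * q)
          eq′ = solve-∀ ring
          scaled : ∀ J i M → M * i ≡ 1ℚ → J * i * M ≡ J
          scaled J i M eq = trans (*-assoc J i M) (trans (cong (J *_) (trans (*-comm i M) eq)) (*-identityʳ J))
      common≤ : ∀ v → lookup T v ≡ false → within T (nbrs v A) ≡ true → X - loss r (suc j) ≤ Pr r (nbrs v A) (T [ v ]≔ false)
      common≤ v v∉T common = let (iᵥ , 0<iᵥ , Mᵥiᵥ≡1) = inverse-size (nbrs v A) j in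
        ≤-cert (Pr r (nbrs v A) (T [ v ]≔ false) + loss r (suc j) - X) (eq (Pr r (nbrs v A) (T [ v ]≔ false)) (loss r (suc j)) X) (p≤q⇒0≤q-p (≤-trans
          (^-mono (suc j) (0≤ι (suc j) ⊛ 0≤i) (*-monoˡ (0≤ι (suc j)) (i≤ iᵥ (<⇒≤ 0<iᵥ) Mᵥiᵥ≡1)))
          (subst (λ S → (ι (suc j) * iᵥ) ^ suc j ≤ Pr r (nbrs v A) S + loss r (suc j)) (sym (delete-absent T v v∉T))
            (Pr-lower r (suc j) (nbrs v A) T iᵥ (within-lookup T (nbrs v A) common) (λ {u} {w} → cliqueT {u} {w}) cardT (<⇒≤ 0<iᵥ) Mᵥiᵥ≡1))))
        where
        eq : ∀ P l X → P ≡ (X - l) + (P + l - X)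
        eq = solve-∀ ring
        i≤ : ∀ iᵥ → 0ℚ ≤ iᵥ → (card (nbrs v A) + ι (suc j) * q) * iᵥ ≡ 1ℚ → i ≤ iᵥ
        i≤ iᵥ 0≤iᵥ Mᵥiᵥ≡1 = subst₂ _≤_ (trans (eq′ (card (nbrs v A) + ι (suc j) * q) i iᵥ) (trans (cong (i *_) Mᵥiᵥ≡1) (*-identityʳ i))) (trans (cong (_* iᵥ) Mi≡1) (*-identityˡ iᵥ))
          (*-monoʳ 0≤iᵥ (*-monoʳ 0≤i (+-monoˡ-≤ (ι (suc j) * q) (card-nbrs≤ v A))))
          where
          eq′ : ∀ m i k → m * i * k ≡ i * (m * k)
          eq′ = solve-∀ ring
      vertex : ∀ v → χ (lookup T v) * gain v + χ (lookup A v) * χ (within T (nbrs v A)) * (X - loss r (suc j)) ≤ F v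
      vertex v = by (lookup T v) (lookup A v) (within T (nbrs v A)) refl refl refl
        where
        Pv : ℚ
        Pv = Pr r (nbrs v A) (T [ v ]≔ false)
        eq₄ : ∀ a b → 1ℚ * a + 1ℚ * 0ℚ * b ≡ a
        eq₄ = solve-∀ ring
        eq₅ : ∀ a b → 0ℚ * a + 1ℚ * 1ℚ * b ≡ b
        eq₅ = solve-∀ ring
        eq₆ : ∀ a b → 0ℚ * a + 1ℚ * 0ℚ * b ≡ 0ℚ
        eq₆ = solve-∀ ring
        eq₇ : ∀ a c b p → 0ℚ * a + 0ℚ * c * b ≡ 0ℚ * p
        eq₇ = solve-∀ ring
        by : ∀ t a c → lookup T v ≡ t → lookup A v ≡ a → within T (nbrs v A) ≡ c →
          χ t * gain v + χ a * χ c * (X - loss r (suc j)) ≤ χ a * Pv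
        by true  false c v∈T v∉A _ = case trans (sym (T⊆A v v∈T)) v∉A of λ ()
        -- A vertex of `T` adjacent to all of `T` would be adjacent to itself.
        by true  true  true v∈T _ common = case trans (sym (adj-irrefl v)) (proj₂ (nbrs⊆ v A v (within-lookup T (nbrs v A) common v v∈T))) of λ ()
        by true  true  false v∈T _ _ = subst₂ _≤_ (sym (eq₄ (gain v) (X - loss r (suc j)))) (sym (*-identityˡ Pv)) (gain≤ v v∈T)
        by false false c _ _ _ = ≤-reflexive (eq₇ (gain v) (χ c) (X - loss r (suc j)) Pv)
        by false true  true v∉T _ common = subst₂ _≤_ (sym (eq₅ (gain v) (X - loss r (suc j)))) (sym (*-identityˡ Pv)) (common≤ v v∉T common)
        by false true  false _ _ _ = subst₂ _≤_ (sym (eq₆ (gain v) (X - loss r (suc j)))) (sym (*-identityˡ Pv)) (0≤Pr r (nbrs v A) (T [ v ]≔ false))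

-- Transversals of the Turán graph

card≡∣∣ : ∀ {n} (A : Subset n) → card A ≡ ι ∣ A ∣
card≡∣∣ {zero}  []      = refl
card≡∣∣ {suc n} (b ∷ A) = trans (cong (χ b +_) (trans (cong (λ vs → ∑ vs (χ ∘ lookup (b ∷ A))) (sym (map-tabulate id suc)))
  (trans (∑-map suc (allFin n) _) (card≡∣∣ A)))) (∣∣-∷ b)
  where
  ∣∣-∷ : ∀ b → χ b + ι ∣ A ∣ ≡ ι ∣ b ∷ A ∣
  ∣∣-∷ true  = refl
  ∣∣-∷ false = +-identityˡ (ι ∣ A ∣)

ι-injective : ∀ {m n} → ι m ≡ ι n → m ≡ n
ι-injective eq = ℕ.≤-antisym (ι-cancel-≤ (≤-reflexive eq)) (ι-cancel-≤ (≤-reflexive (sym eq)))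

fromList : ∀ {n} → List (Fin n) → Subset n
fromList = foldr (λ v A → A [ v ]≔ true) ⊥

fromList⁻ : ∀ {n} (vs : List (Fin n)) v → lookup (fromList vs) v ≡ true → v ∈ vs
fromList⁻ []       v eq with () ← trans (sym eq) (lookup-replicate v false)
fromList⁻ (u ∷ vs) v eq with v Fin.≟ u
... | yes v≡u = here v≡u
... | no v≢u  = there (fromList⁻ vs v (trans (sym (lookup∘update′ v≢u (fromList vs) true)) eq))

fromList⁺ : ∀ {n} (vs : List (Fin n)) {v} → v ∈ vs → lookup (fromList vs) v ≡ true
fromList⁺ (u ∷ vs) (here refl) = lookup∘update u (fromList vs) true
fromList⁺ (u ∷ vs) {v} (there v∈) with v Fin.≟ u
... | yes refl = lookup∘update u (fromList vs) true
... | no v≢u   = trans (lookup∘update′ v≢u (fromList vs) true) (fromList⁺ vs v∈)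

card-fromList : ∀ {n} {vs : List (Fin n)} → Unique vs → card (fromList vs) ≡ ι (length vs)
card-fromList {n} [] = trans (∑-cong (allFin n) λ {v} _ → cong χ (lookup-replicate v false)) (∑-zero (allFin n))
card-fromList {vs = v ∷ vs} (v∉ ∷ uniq) = trans (card-delete (A [ v ]≔ true) v (lookup∘update v A true)) (cong (1ℚ +_)
  (trans (cong card (trans ([]≔-idempotent A v) (delete-absent A v (Bool.¬-not λ v∈ → All.lookup v∉ (fromList⁻ vs v v∈) refl)))) (card-fromList uniq)))
  where
  A : Subset _
  A = fromList vs

module _ {n m t : ℕ} .{{_ : NonZero t}} (1≤t : 1 ℕ.≤ t) (mt≤n : m ℕ.* t ℕ.≤ n) where

  -- In residue class `r`, the function `f` picks the vertex with quotient `f r`; the bound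
  -- `m * t ≤ n` keeps it in range.
  vertex< : (f : Fin t → Fin m) (r : Fin t) → toℕ r ℕ.+ toℕ (f r) ℕ.* t ℕ.< n
  vertex< f r = ℕ.<-≤-trans (ℕ.+-monoˡ-< (toℕ (f r) ℕ.* t) (Fin.toℕ<n r)) (ℕ.≤-trans (ℕ.*-monoˡ-≤ t (Fin.toℕ<n (f r))) mt≤n)

  vertex : (Fin t → Fin m) → Fin t → Fin n
  vertex f r = fromℕ< (vertex< f r)

  toℕ-vertex : ∀ f r → toℕ (vertex f r) ≡ toℕ r ℕ.+ toℕ (f r) ℕ.* t
  toℕ-vertex f r = Fin.toℕ-fromℕ< (vertex< f r)

  part : ∀ f r → toℕ (vertex f r) % t ≡ toℕ r
  part f r = trans (cong (_% t) (toℕ-vertex f r)) (trans ([m+kn]%n≡m%n (toℕ r) (toℕ (f r)) t) (m<n⇒m%n≡m (Fin.toℕ<n r)))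

  part-injective : ∀ {f r s} → toℕ (vertex f r) % t ≡ toℕ (vertex f s) % t → r ≡ s
  part-injective {f} {r} {s} eq = Fin.toℕ-injective (trans (sym (part f r)) (trans eq (part f s)))

  transversal : (Fin t → Fin m) → Subset n
  transversal f = fromList (List.tabulate (vertex f))

  vertex∈ : ∀ f r → lookup (transversal f) (vertex f r) ≡ true
  vertex∈ f r = fromList⁺ (List.tabulate (vertex f)) (∈-tabulate⁺ r)

  transversal-clique : ∀ f → IsTClique t (Turán n t) (transversal f)
  transversal-clique f = ((vertex f r₀ , lookup⇒[]= _ (transversal f) (vertex∈ f r₀)) , adjacent) ,
    ι-injective (trans (sym (card≡∣∣ (transversal f))) (trans (card-fromList (tabulate⁺ λ eq → part-injective {f} (cong (λ v → toℕ v % t) eq)))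
      (cong ι (length-tabulate (vertex f)))))
    where
    r₀ : Fin t
    r₀ = fromℕ< 1≤t
    adjacent : ∀ {x y} → x Subset.∈ transversal f → y Subset.∈ transversal f → x ≢ y → ¬ (toℕ x % t ≡ toℕ y % t)
    adjacent {x} {y} x∈ y∈ x≢y eq with ∈-tabulate⁻ (fromList⁻ (List.tabulate (vertex f)) x ([]=⇒lookup x∈)) | ∈-tabulate⁻ (fromList⁻ (List.tabulate (vertex f)) y ([]=⇒lookup y∈))
    ... | r , refl | s , refl = x≢y (cong (vertex f) (part-injective {f} eq))

  -- The two vertices chosen in part `r` both lie in `K`; if distinct they would be adjacent within
  -- one part.
  same-clique : ∀ {K} f g → IsClique (Turán n t) K → transversal f Subset.⊆ K → transversal g Subset.⊆ K → ∀ r → f r ≡ g r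
  same-clique f g (_ , adjacent) f⊆K g⊆K r with vertex f r Fin.≟ vertex g r
  ... | yes eq = Fin.toℕ-injective (ℕ.*-cancelʳ-≡ _ _ t (ℕ.+-cancelˡ-≡ (toℕ r) _ _ (trans (sym (toℕ-vertex f r)) (trans (cong toℕ eq) (toℕ-vertex g r)))))
  ... | no ne  = ⊥-elim (adjacent (f⊆K (lookup⇒[]= _ (transversal f) (vertex∈ f r))) (g⊆K (lookup⇒[]= _ (transversal g) (vertex∈ g r))) ne
                   (trans (part f r) (sym (part g r))))

  -- Sending each of the m ^ t transversals to the position of a member containing it is injective,
  -- by `same-clique`.
  cover-size : ∀ C → IsTCliqueCover t (Turán n t) C → m ℕ.^ t ℕ.≤ length C
  cover-size C (cliques , covers) = Fin.injective⇒≤ {f = λ x → index (place x)} injective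
    where
    place : ∀ x → Any (λ K → transversal (Fin.finToFun {m} {t} x) Subset.⊆ K) C
    place x = covers _ (transversal-clique (Fin.finToFun x))
    funToFin-cong : ∀ {a b} {f g : Fin a → Fin b} → (∀ r → f r ≡ g r) → Fin.funToFin f ≡ Fin.funToFin g
    funToFin-cong {zero}  eq = refl
    funToFin-cong {suc a} eq = cong₂ Fin.combine (eq zero) (funToFin-cong (eq ∘ suc))
    injective : Injective _≡_ _≡_ (λ x → index (place x))
    injective {x} {y} eq = trans (sym (Fin.funToFin-finToFin {t} {m} x)) (trans (funToFin-cong (same-clique _ _
      (All.lookupAny cliques (place x) .proj₁) (All.lookupAny cliques (place x) .proj₂)
      (subst (λ i → transversal (Fin.finToFun {m} {t} y) Subset.⊆ List.lookup C i) (sym eq) (lookup-index (place y)))))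
      (Fin.funToFin-finToFin {t} {m} y))

-- Assembling the cover

subsets-complete : ∀ {n} (T : Subset n) → T ∈ subsets n
subsets-complete []          = here refl
subsets-complete (false ∷ T) = ∈-++⁺ˡ (∈-map⁺ (false ∷_) (subsets-complete T))
subsets-complete (true ∷ T)  = ∈-++⁺ʳ _ (∈-map⁺ (true ∷_) (subsets-complete T))

subsets-unique : ∀ n → Unique (subsets n)
subsets-unique zero    = All.[] ∷ []
subsets-unique (suc n) = ++⁺ (map⁺ (λ { refl → refl }) (subsets-unique n)) (map⁺ (λ { refl → refl }) (subsets-unique n))
  λ (∈₁ , ∈₂) → heads (proj₂ (proj₂ (∈-map⁻ (false ∷_) ∈₁))) (proj₂ (proj₂ (∈-map⁻ (true ∷_) ∈₂)))
  where
  heads : {T : Subset (suc n)} {A B : Subset n} → T ≡ false ∷ A → T ≡ true ∷ B → Data.Empty.⊥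
  heads refl ()

within-antisym : ∀ {n} (T K : Subset n) → within T K ≡ true → within K T ≡ true → T ≡ K
within-antisym []          []          _ _ = refl
within-antisym (true ∷ T)  (true ∷ K)  p q = cong (true ∷_) (within-antisym T K p q)
within-antisym (false ∷ T) (false ∷ K) p q = cong (false ∷_) (within-antisym T K p q)

size-nonempty : ∀ {n s} (T : Subset n) → ∣ T ∣ ≡ suc s → Nonempty T
size-nonempty (true ∷ T)  eq = zero , here
size-nonempty (false ∷ T) eq = let (v , v∈) = size-nonempty T eq in suc v , there v∈

card-insert : ∀ {n} (T : Subset n) v → lookup T v ≡ false → card (T [ v ]≔ true) ≡ 1ℚ + card T
card-insert T v v∉T = trans (card-delete (T [ v ]≔ true) v (Vec.lookup∘update v T true))
  (cong (λ S → 1ℚ + card S) (trans (Vec.[]≔-idempotent T v) (delete-absent T v v∉T)))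

χ-within-insert : ∀ {n} (T T′ K : Subset n) v → lookup T′ v ≡ true → χ (within T K) * χ (within T′ K) ≤ χ (within (T [ v ]≔ true) K)
χ-within-insert T T′ K v v∈T′ with within T K in T⊆K | within T′ K in T′⊆K
... | false | b = subst (_≤ χ (within (T [ v ]≔ true) K)) (sym (*-zeroˡ (χ b))) (0≤χ _)
... | true | false = 0≤χ (within (T [ v ]≔ true) K)
... | true | true  = ≤-reflexive (cong χ (sym (lookup-within (T [ v ]≔ true) K inserted)))
  where
  inserted : ∀ u → lookup (T [ v ]≔ true) u ≡ true → lookup K u ≡ true
  inserted u u∈ with u Fin.≟ v
  ... | yes refl = within-lookup T′ K T′⊆K v v∈T′
  ... | no u≢v   = within-lookup T K T⊆K u (trans (sym (Vec.lookup∘update′ u≢v T true)) u∈)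

-- Choice of the constants and construction of the cover

module Parameters (t-1 : ℕ) (ε : ℚ) (0<ε : 0ℚ < ε) (ε≤1 : ε ≤ 1ℚ) where

  t : ℕ
  t = suc t-1

  0≤ε : 0ℚ ≤ ε
  0≤ε = <⇒≤ 0<ε

  ¼ : ℚ
  ¼ = ½ * ½

  0<¼ : 0ℚ < ¼
  0<¼ = positive⁻¹ ¼

  δ iδ i₁ β ρ : ℚ
  0<δ : 0ℚ < ¼ * ε * proj₁ (inverse (0<ι t-1))
  0<δ = 0<p*q (0<p*q 0<¼ 0<ε) (proj₁ (proj₂ (inverse (0<ι t-1))))
  -- With `t δ = ε/4` the bias `q = δ y` costs only the factor `(1 + δ)^-t ≥ 1 - ε/4`.
  δ = ¼ * ε * proj₁ (inverse (0<ι t-1))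
  0≤δ : 0ℚ ≤ δ
  0≤δ = <⇒≤ 0<δ
  tδ≡ : ι t * δ ≡ ¼ * ε
  tδ≡ = trans (eq (ι t) (¼ * ε) _) (trans (cong (¼ * ε *_) (proj₂ (proj₂ (inverse (0<ι t-1))))) (*-identityʳ _))
    where
    eq : ∀ a b c → a * (b * c) ≡ b * (a * c)
    eq = solve-∀ ring
  δ≤1 : δ ≤ 1ℚ
  δ≤1 = ≤-trans (≤-cert (ι t-1 * δ) (eq (ι t-1) δ) (0≤ι t-1 ⊛ 0≤δ)) (subst (_≤ 1ℚ) (sym tδ≡)
    (≤-cert _ (eq′ ε) (<⇒≤ 0<¼ ⊛ p≤q⇒0≤q-p ε≤1 ⊹ nonNegative⁻¹ (1ℚ - ¼))))
    where
    eq : ∀ a d → (1ℚ + a) * d ≡ d + a * d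
    eq = solve-∀ ring
    eq′ : ∀ e → 1ℚ ≡ ½ * ½ * e + (½ * ½ * (1ℚ - e) + (1ℚ - ½ * ½))
    eq′ = solve-∀ ring
  iδ = proj₁ (inverse 0<δ)
  0≤iδ : 0ℚ ≤ iδ
  0≤iδ = <⇒≤ (proj₁ (proj₂ (inverse 0<δ)))
  0<1+δ : 0ℚ < 1ℚ + δ
  0<1+δ = 0<p+q 0<1 0≤δ
  i₁ = proj₁ (inverse 0<1+δ)
  0≤i₁ : 0ℚ ≤ i₁
  0≤i₁ = <⇒≤ (proj₁ (proj₂ (inverse 0<1+δ)))
  i₁-spec : (1ℚ + δ) * i₁ ≡ 1ℚ
  i₁-spec = proj₂ (proj₂ (inverse 0<1+δ))
  i₁^t≥ : 1ℚ - ¼ * ε ≤ i₁ ^ t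
  i₁^t≥ = subst (λ d → 1ℚ - d ≤ i₁ ^ t) tδ≡ (≤-trans (bernoulli⁻ t δ≤1) (^-mono t (p≤q⇒0≤q-p δ≤1)
    (≤-cert (i₁ * (δ * δ)) (trans (eq δ i₁) (trans (cong (λ u → u * (1ℚ - δ) + i₁ * (δ * δ)) i₁-spec) (cong (_+ i₁ * (δ * δ)) (*-identityˡ (1ℚ - δ))))) (0≤i₁ ⊛ sq-nonneg δ))))
    where
    eq : ∀ d i → i ≡ (1ℚ + d) * i * (1ℚ - d) + i * (d * d)
    eq = solve-∀ ring

  0<t+δ : 0ℚ < ι t + δ
  0<t+δ = 0<p+q (0<ι t-1) 0≤δ
  -- The largest `β` with `½ q + |A| ≤ (1 - β)(|A| + q)` for all |A| up to `t y`.
  β = ½ * δ * proj₁ (inverse 0<t+δ)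
  0<β : 0ℚ < β
  0<β = 0<p*q (0<p*q (positive⁻¹ ½) 0<δ) (proj₁ (proj₂ (inverse 0<t+δ)))
  β-spec : β * (ι t + δ) ≡ ½ * δ
  β-spec = trans (eq (½ * δ) _ (ι t + δ)) (trans (cong (½ * δ *_) (proj₂ (proj₂ (inverse 0<t+δ)))) (*-identityʳ _))
    where
    eq : ∀ a i d → a * i * d ≡ a * (d * i)
    eq = solve-∀ ring
  β≤1 : β ≤ 1ℚ
  β≤1 = *-cancel 0<t+δ (subst (_≤ (ι t + δ) * 1ℚ) (trans (sym β-spec) (*-comm β (ι t + δ)))
    (≤-cert _ (eq (ι t) δ) (0≤ι t ⊹ nonNegative⁻¹ ½ ⊛ 0≤δ)))
    where
    eq : ∀ t d → (t + d) * 1ℚ ≡ ½ * d + (t + ½ * d)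
    eq = solve-∀ ring
  ρ = 1ℚ - β
  0≤ρ : 0ℚ ≤ ρ
  0≤ρ = p≤q⇒0≤q-p β≤1

  0<hciδ : 0ℚ < hc t * iδ ^ t
  0<hciδ = 0<p*q (<-≤-trans 0<1 (1≤hc t)) (0<^ t (proj₁ (proj₂ (inverse 0<δ))))
  decay : ∃ λ r → ρ ^ r ≤ ¼ * ε * proj₁ (inverse 0<hciδ)
  decay = geometric-decay 0<β β≤1 (0<p*q (0<p*q 0<¼ 0<ε) (proj₁ (proj₂ (inverse 0<hciδ))))
  r : ℕ
  r = proj₁ decay
  relative-loss : ℚ
  relative-loss = hc t * ρ ^ r * iδ ^ t
  relative-loss≤ : relative-loss ≤ ¼ * ε
  relative-loss≤ = ≤-trans (≤-reflexive (eq (hc t) (ρ ^ r) (iδ ^ t))) (≤-trans (*-monoˡ (<⇒≤ 0<hciδ) (proj₂ decay))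
    (≤-reflexive (trans (eq′ (hc t * iδ ^ t) (¼ * ε) _) (trans (cong (¼ * ε *_) (proj₂ (proj₂ (inverse 0<hciδ)))) (*-identityʳ _)))))
    where
    eq : ∀ h p x → h * p * x ≡ h * x * p
    eq = solve-∀ ring
    eq′ : ∀ a b c → a * (b * c) ≡ b * (a * c)
    eq′ = solve-∀ ring
  -- Bias and truncation each cost at most `ε/4`, and `(1 + ε)(1 - ε/2) ≥ 1` for `ε ≤ 1`. This is
  -- why inflating the weight by `1 + ε` lifts all degrees to at least 1.
  1≤[1+ε][i₁^t-loss] : 1ℚ ≤ (1ℚ + ε) * (i₁ ^ t - relative-loss)
  1≤[1+ε][i₁^t-loss] = ≤-cert _ (eq ε (i₁ ^ t) relative-loss) ((0≤1 ⊹ 0≤ε) ⊛ (p≤q⇒0≤q-p i₁^t≥ ⊹ p≤q⇒0≤q-p relative-loss≤)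
    ⊹ nonNegative⁻¹ ½ ⊛ (0≤ε ⊛ p≤q⇒0≤q-p ε≤1))
    where
    eq : ∀ e x l → (1ℚ + e) * (x - l) ≡ 1ℚ + ((1ℚ + e) * ((x - (1ℚ - ½ * ½ * e)) + (½ * ½ * e - l)) + ½ * (e * (1ℚ - e)))
    eq = solve-∀ ring

  k : ℚ
  k = 2ℚ ^ r
  nib = nibble {k} {ε} (1≤^ r (≤-cert 1ℚ refl 0≤1)) 0<ε
  κ : ℚ
  κ = proj₁ nib
  0<κ : 0ℚ < κ
  0<κ = proj₁ (proj₂ nib)
  c₀ : ℚ
  -- Codegrees turn out to be at most `c₀ / y`. In the threshold for `y` below, `c₀` makes this at
  -- most `κ`, and the extra 1 makes the total weight large enough.
  c₀ = (1ℚ + ε) * (ι r * iδ) ^ suc t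
  0≤c₀ : 0ℚ ≤ c₀
  0≤c₀ = (0≤1 ⊹ 0≤ε) ⊛ 0≤^ (suc t) (0≤ι r ⊛ 0≤iδ)
  threshold : ∃ λ y₀ → proj₁ (inverse 0<κ) * (c₀ + 1ℚ) ≤ ι y₀
  threshold = archimedean _
  y₀ : ℕ
  y₀ = proj₁ threshold

  module Construction (n y-1 : ℕ) (y₀≤y : y₀ ℕ.≤ suc y-1) (n≤ty : n ℕ.≤ t ℕ.* suc y-1) (G : Graph n) (adj? : ∀ u v → Dec (Adj G u v)) where

    y iy q iq : ℚ
    y = ι (suc y-1)
    0<y : 0ℚ < y
    0<y = 0<ι y-1
    0≤y : 0ℚ ≤ y
    0≤y = <⇒≤ 0<y
    iy = proj₁ (inverse 0<y)
    0≤iy : 0ℚ ≤ iy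
    0≤iy = <⇒≤ (proj₁ (proj₂ (inverse 0<y)))
    y*iy≡1 : y * iy ≡ 1ℚ
    y*iy≡1 = proj₂ (proj₂ (inverse 0<y))
    q = δ * y
    iq = iδ * iy
    q*iq≡1 : q * iq ≡ 1ℚ
    q*iq≡1 = trans (eq δ y iδ iy) (trans (cong₂ _*_ (proj₂ (proj₂ (inverse 0<δ))) y*iy≡1) refl)
      where
      eq : ∀ a b c d → a * b * (c * d) ≡ a * c * (b * d)
      eq = solve-∀ ring
    0≤q : 0ℚ ≤ q
    0≤q = 0≤δ ⊛ 0≤y
    0≤iq : 0ℚ ≤ iq
    0≤iq = 0≤iδ ⊛ 0≤iy
    y^t*iy^t≡1 : y ^ t * iy ^ t ≡ 1ℚ
    y^t*iy^t≡1 = trans (sym (*-^ y iy t)) (trans (cong (_^ t) y*iy≡1) (1^ t))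

    κy≥ : c₀ + 1ℚ ≤ κ * y
    κy≥ = subst (_≤ κ * y) (trans (sym (*-assoc κ _ (c₀ + 1ℚ))) (trans (cong (_* (c₀ + 1ℚ)) (proj₂ (proj₂ (inverse 0<κ)))) (*-identityˡ _)))
      (*-monoˡ (<⇒≤ 0<κ) (≤-trans (proj₂ threshold) (ι-mono y₀≤y)))

    adj : Fin n → Fin n → Bool
    adj u v = does (adj? u v)

    adj⁻ : ∀ {u v} → adj u v ≡ true → Adj G u v
    adj⁻ {u} {v} eq with adj? u v
    ... | yes uv = uv

    adj-sym : ∀ u v → adj u v ≡ true → adj v u ≡ true
    adj-sym u v eq = dec-true (adj? v u) (Graph.sym G (adj⁻ eq))

    adj-irrefl : ∀ v → adj v v ≡ false
    adj-irrefl v = dec-false (adj? v v) (irrefl G)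

    open GreedyClique adj adj-sym adj-irrefl q iq (0<p*q 0<δ 0<y) q*iq≡1 0≤iq using (dist; Pr; Pr-upper; grown; module Grown; module Lower; total-mass; Clique)

    full : Subset n
    full = replicate n true

    card≤ty : ∀ (A : Subset n) → card A ≤ ι t * y
    card≤ty A = ≤-trans (≤-reflexive (card≡∣∣ A)) (≤-trans (ι-mono (ℕ.≤-trans (∣p∣≤n A) n≤ty)) (≤-reflexive (ι-* t (suc y-1))))

    contraction : ∀ (A : Subset n) → ½ * q + card A ≤ ρ * (card A + q)
    contraction A = ≤-cert _ (trans (eq β δ y (card A) (ι t)) (cong (λ u → (½ * (δ * y) + card A) + ((½ * δ - u) * y + β * (ι t * y - card A))) β-spec′))
      (≤-reflexive (sym (eq′ δ y)) ⊹ <⇒≤ 0<β ⊛ p≤q⇒0≤q-p (card≤ty A))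
      where
      β-spec′ : β * (ι t + δ) ≡ ½ * δ
      β-spec′ = β-spec
      eq : ∀ b d y a t → (1ℚ - b) * (a + d * y) ≡ (½ * (d * y) + a) + ((½ * d - b * (t + d)) * y + b * (t * y - a))
      eq = solve-∀ ring
      eq′ : ∀ d y → (½ * d - ½ * d) * y ≡ 0ℚ
      eq′ = solve-∀ ring

    open Lower ρ 0≤ρ contraction using (Pr-lower; loss)

    W₀ : ℚ
    W₀ = (1ℚ + ε) * y ^ t
    0≤W₀ : 0ℚ ≤ W₀
    0≤W₀ = (0≤1 ⊹ 0≤ε) ⊛ 0≤^ t 0≤y

    clique? : (T : Subset n) → Dec (Clique T × ∣ T ∣ ≡ t)
    clique? T = map′ (λ { (c , s) → (λ {u} {v} → c u v) , s }) (λ { (c , s) → (λ u v → c {u} {v}) , s })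
      (Fin.all? (λ u → Fin.all? λ v → (lookup T u Bool.≟ true) →-dec ((lookup T v Bool.≟ true) →-dec (¬? (u Fin.≟ v) →-dec (adj u v Bool.≟ true)))) ×-dec (∣ T ∣ ℕ.≟ t))

    ps : List (Subset n)
    -- Filtering for a negation to be `false` matches the form of `∑-filter-≤`.
    ps = filter (λ T → not (does (clique? T)) Bool.≟ false) (subsets n)

    ps⁻ : ∀ {T} → T ∈ ps → Clique T × ∣ T ∣ ≡ t
    ps⁻ {T} T∈ = decided (clique? T) (proj₂ (∈-filter⁻ (λ T → not (does (clique? T)) Bool.≟ false) {xs = subsets n} T∈))
      where
      decided : {X : Set} (d : Dec X) → not (does d) ≡ false → X
      decided (yes x) _ = x
      decided (no _) ()

    ps⁺ : ∀ {T} → Clique T × ∣ T ∣ ≡ t → T ∈ ps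
    ps⁺ {T} p = ∈-filter⁺ (λ T → not (does (clique? T)) Bool.≟ false) (subsets-complete T) (cong not (dec-true (clique? T) p))

    open Thinning {Subset n} {Subset n} (Vec.≡-dec Bool._≟_)

    block : ℚ × Subset n → Block
    block (p , K) = W₀ * p , K , λ T → within T K

    xs : List Block
    xs = map block (dist r full)

    from : ∀ {A} → A ∈ xs → ∃ λ pK → pK ∈ dist r full × A ≡ block pK
    from = ∈-map⁻ block

    degree≡ : ∀ (u : Subset n → ℚ) → (∑[ A ∈ xs ] weight A * u (tag A)) ≡ W₀ * (∑[ pK ∈ dist r full ] proj₁ pK * u (proj₂ pK))
    degree≡ u = trans (∑-map block (dist r full) _) (trans (∑-cong (dist r full) λ {pK} _ → *-assoc W₀ (proj₁ pK) _) (∑-* W₀ (dist r full) _))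

    -- Of two distinct t-cliques, one has a vertex outside the other. A clique containing both
    -- contains that t-set `S` with the vertex added, and `Pr-upper` for `t + 1` vertices beats the
    -- total weight of order `y ^ t` by a factor `y`.
    codeg-small : ∀ {T T′} → T ∈ ps → T′ ∈ ps → T′ ≢ T → System.codeg mem xs weight T T′ ≤ κ
    codeg-small {T} {T′} T∈ T′∈ T′≢T = by (within T′ T) (within T T′) refl refl
      where
      codeg≤ : ∀ S v → lookup S v ≡ false → ∣ S ∣ ≡ t → (∀ K → χ (within T K) * χ (within T′ K) ≤ χ (within (S [ v ]≔ true) K)) → System.codeg mem xs weight T T′ ≤ κ
      codeg≤ S v v∉S ∣S∣ le = begin
        System.codeg mem xs weight T T′
          ≡⟨ trans (∑-map block (dist r full) _) (trans (∑-cong (dist r full) λ {pK} _ → *-assoc W₀ (proj₁ pK) _) (∑-* W₀ (dist r full) _)) ⟩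
        W₀ * (∑[ pK ∈ dist r full ] proj₁ pK * (χ (within T (proj₂ pK)) * χ (within T′ (proj₂ pK))))
          ≤⟨ *-monoˡ 0≤W₀ (∑-mono (dist r full) λ {pK} pK∈ → *-monoˡ (Grown.nonneg (grown r full pK∈)) (le (proj₂ pK))) ⟩
        W₀ * Pr r full (S [ v ]≔ true)
          ≤⟨ *-monoˡ 0≤W₀ (Pr-upper r (suc t) full (S [ v ]≔ true) (trans (card-insert S v v∉S) (cong (1ℚ +_) (trans (card≡∣∣ S) (cong ι ∣S∣))))) ⟩
        W₀ * (ι r * iq) ^ suc t
          ≡⟨ trans (cong (W₀ *_) (trans (cong (_^ suc t) (sym (*-assoc (ι r) iδ iy))) (*-^ (ι r * iδ) iy (suc t)))) (trans (eq (1ℚ + ε) (y ^ t) ((ι r * iδ) ^ suc t) iy (iy ^ t))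
               (trans (cong (c₀ * iy *_) y^t*iy^t≡1) (*-identityʳ _))) ⟩
        c₀ * iy
          ≤⟨ *-monoʳ 0≤iy (≤-trans (≤-cert {c₀} 1ℚ refl 0≤1) κy≥) ⟩
        κ * y * iy
          ≡⟨ trans (*-assoc κ y iy) (trans (cong (κ *_) y*iy≡1) (*-identityʳ κ)) ⟩
        κ ∎
        where
        open ≤-Reasoning
        eq : ∀ e Y R i I → e * Y * (R * (i * I)) ≡ e * R * i * (Y * I)
        eq = solve-∀ ring
      by : ∀ a b → within T′ T ≡ a → within T T′ ≡ b → System.codeg mem xs weight T T′ ≤ κ
      by true  true  T′⊆T T⊆T′ = ⊥-elim (T′≢T (within-antisym T′ T T′⊆T T⊆T′))
      by false _     T′⊈T _    = let (v , v∈T′ , v∉T) = not-within T′ T T′⊈T in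
        codeg≤ T v v∉T (proj₂ (ps⁻ T∈)) λ K → χ-within-insert T T′ K v v∈T′
      by true  false _    T⊈T′ = let (v , v∈T , v∉T′) = not-within T T′ T⊈T′ in
        codeg≤ T′ v v∉T′ (proj₂ (ps⁻ T′∈)) λ K → subst (_≤ χ (within (T′ [ v ]≔ true) K)) (*-comm (χ (within T′ K)) (χ (within T K))) (χ-within-insert T′ T K v v∈T)

    admissible : Admissible Clique (λ K T → within T K ≡ true) ps k κ W₀ xs
    admissible = record
      { nonneg  = λ A∈ → case from A∈ of λ { (pK , pK∈ , refl) → 0≤W₀ ⊛ Grown.nonneg (grown r full pK∈) }
      ; size≤k  = λ A∈ → case from A∈ of λ { (pK , pK∈ , refl) → ≤-trans (∑-filter-≤ (λ T → not (does (clique? T))) (subsets n) λ {T} _ → 0≤χ (within T (proj₂ pK)))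
          (Grown.small (grown r full pK∈)) }
      ; codeg≤κ = codeg-small
      ; support = λ A∈ → case from A∈ of λ { (pK , pK∈ , refl) → λ eq → eq }
      ; tagged  = λ A∈ → case from A∈ of λ { (pK , pK∈ , refl) → Grown.clique (grown r full pK∈) }
      ; total   = trans (∑-map block (dist r full) weight) (trans (∑-* W₀ (dist r full) proj₁) (trans (cong (W₀ *_) (total-mass r full)) (*-identityʳ W₀)))
      }

    1≤deg : ∀ {T} → T ∈ ps → 1ℚ ≤ System.deg mem xs weight T
    1≤deg {T} T∈ = begin
      1ℚ
        ≤⟨ 1≤[1+ε][i₁^t-loss] ⟩
      (1ℚ + ε) * (i₁ ^ t - relative-loss)
        ≡⟨ sym (trans (cong (λ u → W₀ * (u - hc t * ρ ^ r * (iq ^ t))) (*-^ i₁ iy t)) (trans (cong (λ u → W₀ * (i₁ ^ t * iy ^ t - hc t * ρ ^ r * u)) (*-^ iδ iy t))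
             (trans (eq (1ℚ + ε) (y ^ t) (i₁ ^ t) (iy ^ t) (hc t * ρ ^ r) (iδ ^ t)) (trans (cong ((1ℚ + ε) * (i₁ ^ t - relative-loss) *_) y^t*iy^t≡1) (*-identityʳ _))))) ⟩
      W₀ * ((i₁ * iy) ^ t - loss r t)
        ≤⟨ *-monoˡ 0≤W₀ (≤-cert (Pr r full T - ((i₁ * iy) ^ t - loss r t)) (eq′ (Pr r full T) ((i₁ * iy) ^ t - loss r t)) (subst (0ℚ ≤_) (eq″ (Pr r full T) (loss r t) ((i₁ * iy) ^ t))
             (p≤q⇒0≤q-p (≤-trans (^-mono t (0≤i₁ ⊛ 0≤iy) i₁iy≤) (Pr-lower r t full T i (λ v _ → Vec.lookup-replicate v true) (λ {u} {v} → proj₁ (ps⁻ T∈) {u} {v})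
               (trans (card≡∣∣ T) (cong ι (proj₂ (ps⁻ T∈)))) (<⇒≤ 0<i) Mi≡1))))) ⟩
      W₀ * Pr r full T
        ≡⟨ sym (degree≡ λ K → χ (within T K)) ⟩
      (∑[ A ∈ xs ] weight A * χ (within T (tag A)))
        ≡⟨ trans (∑-map block (dist r full) _) (sym (∑-map block (dist r full) _)) ⟩
      System.deg mem xs weight T ∎
      where
      open ≤-Reasoning
      eq : ∀ e Y a I h d → e * Y * (a * I - h * (d * I)) ≡ e * (a - h * d) * (Y * I)
      eq = solve-∀ ring
      eq′ : ∀ p x → p ≡ x + (p - x)
      eq′ = solve-∀ ring
      eq″ : ∀ p l x → p + l - x ≡ p - (x - l)
      eq″ = solve-∀ ring
      M : ℚ
      M = card full + ι t * q
      0<M : 0ℚ < M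
      0<M = subst (0ℚ <_) (+-comm (ι t * q) (card full)) (0<p+q (0<p*q (0<ι t-1) (0<p*q 0<δ 0<y)) (0≤card full))
      i : ℚ
      i = proj₁ (inverse 0<M)
      0<i : 0ℚ < i
      0<i = proj₁ (proj₂ (inverse 0<M))
      Mi≡1 : M * i ≡ 1ℚ
      Mi≡1 = proj₂ (proj₂ (inverse 0<M))
      -- There are at most `t y` vertices and `q = δ y`, so the effective size `M` is at most
      -- `(1 + δ) t y`.
      1≤ : 1ℚ ≤ (1ℚ + δ) * y * (ι t * i)
      1≤ = subst (_≤ (1ℚ + δ) * y * (ι t * i)) Mi≡1 (≤-cert _ (eq‴ (card full) (ι t) δ y i) (p≤q⇒0≤q-p (card≤ty full) ⊛ <⇒≤ 0<i))
        where
        eq‴ : ∀ c t d y i → (1ℚ + d) * y * (t * i) ≡ (c + t * (d * y)) * i + (t * y - c) * i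
        eq‴ = solve-∀ ring
      i₁iy≤ : i₁ * iy ≤ ι t * i
      i₁iy≤ = subst₂ _≤_ (*-identityʳ (i₁ * iy)) (trans (eq₄ i₁ iy (1ℚ + δ) y (ι t * i)) (trans (cong₂ (λ a b → a * b * (ι t * i)) i₁-spec y*iy≡1) (*-identityˡ _)))
        (*-monoˡ (0≤i₁ ⊛ 0≤iy) 1≤)
        where
        eq₄ : ∀ a b c d x → a * b * (c * d * x) ≡ c * a * (d * b) * x
        eq₄ = solve-∀ ring

    thinned : Σ (List Block) λ xs′ → Admissible Clique (λ K T → within T K ≡ true) ps k κ W₀ xs′ × (∀ {T} → T ∈ ps → System.deg mem xs′ weight T ≡ 1ℚ)
    thinned = thin xs admissible 1≤deg

    xs′ : List Block
    xs′ = proj₁ thinned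

    module Adm = Admissible (proj₁ (proj₂ thinned))

    1≤κW₀ : 1ℚ ≤ κ * ∑ xs′ weight
    1≤κW₀ = subst (λ w → 1ℚ ≤ κ * w) (sym Adm.total) (≤-trans (≤-trans (≤-cert c₀ (+-comm c₀ 1ℚ) 0≤c₀) κy≥) (*-monoˡ (<⇒≤ 0<κ) y≤W₀))
      where
      1≤y : 1ℚ ≤ y
      1≤y = ≤-cert (ι y-1) refl (0≤ι y-1)
      y≤W₀ : y ≤ W₀
      y≤W₀ = ≤-trans (subst (_≤ y ^ t) (*-identityʳ y) (*-monoˡ 0≤y (1≤^ t-1 1≤y))) (≤-cert (ε * y ^ t) (eq ε (y ^ t)) (0≤ε ⊛ 0≤^ t 0≤y))
        where
        eq : ∀ e x → (1ℚ + e) * x ≡ x + e * x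
        eq = solve-∀ ring

    nibbled : Σ (List Block) λ L → Σ (List (Subset n)) λ rest → (∀ {B} → B ∈ L → B ∈ xs′) ×
      (∀ {T} → T ∈ ps → T ∈ rest ⊎ (∃ λ B → B ∈ L × mem B T ≡ true)) × ι (length L) + ι (length rest) ≤ (1ℚ + ε) * ∑ xs′ weight
    nibbled = proj₂ (proj₂ nib) mem xs′ ps weight (filter⁺ _ (subsets-unique n)) Adm.nonneg Adm.size≤k (proj₂ (proj₂ thinned)) Adm.codeg≤κ 1≤κW₀

    isClique : ∀ {K} → Nonempty K → Clique K → IsClique G K
    isClique {K} ne c = ne , λ {x} {y} x∈ y∈ x≢y → adj⁻ (c {x} {y} (Vec.[]=⇒lookup x∈) (Vec.[]=⇒lookup y∈) x≢y)

    module Collect (L : List Block) (rest : List (Subset n)) (W : ℚ)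
      (tagged : ∀ {B} → B ∈ L → Clique (tag B)) (support : ∀ {B} → B ∈ L → ∀ {T} → mem B T ≡ true → within T (tag B) ≡ true)
      (found : ∀ {T} → T ∈ ps → T ∈ rest ⊎ (∃ λ B → B ∈ L × mem B T ≡ true))
      (L+rest≤W : ι (length L) + ι (length rest) ≤ W) where

      big small cover : List (Subset n)
      -- The greedy process may stop at once, and the empty set is not a clique. Likewise the nibble
      -- does not promise that `rest` consists of t-cliques, whence the second filter; no t-clique
      -- loses its cover through either.
      big   = filter nonempty? (map tag L)
      small = filter clique? rest
      cover = big ++ small

      covers : IsTCliqueCover t G cover
      covers = All.tabulate (λ {K} K∈ → valid K (∈-++⁻ big K∈)) , covered
        where
        valid : ∀ K → K ∈ big ⊎ K ∈ small → IsClique G K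
        valid K (inj₁ K∈) = let (K∈map , ne) = ∈-filter⁻ nonempty? {xs = map tag L} K∈ in
          case ∈-map⁻ tag K∈map of λ { (B , B∈ , refl) → isClique ne (λ {u} {v} → tagged B∈ {u} {v}) }
        valid K (inj₂ K∈) = let (_ , (c , s)) = ∈-filter⁻ clique? {xs = rest} K∈ in isClique (size-nonempty K s) (λ {u} {v} → c {u} {v})
        covered : ∀ T → IsTClique t G T → Any (λ K → T Subset.⊆ K) cover
        covered T ((ne , adjacent) , ∣T∣) = place (found (ps⁺ T-clique))
          where
          T-clique : Clique T × ∣ T ∣ ≡ t
          T-clique = (λ {u} {v} u∈ v∈ u≢v → dec-true (adj? u v) (adjacent (Vec.lookup⇒[]= u T u∈) (Vec.lookup⇒[]= v T v∈) u≢v)) , ∣T∣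
          place : T ∈ rest ⊎ (∃ λ B → B ∈ L × mem B T ≡ true) → Any (λ K → T Subset.⊆ K) cover
          place (inj₁ T∈rest) = lose (∈-++⁺ʳ big (∈-filter⁺ clique? T∈rest T-clique)) (λ x∈ → x∈)
          place (inj₂ (B , B∈ , T∈B)) = lose (∈-++⁺ˡ (∈-filter⁺ nonempty? (∈-map⁺ tag B∈) (proj₁ ne , T⊆B (proj₂ ne)))) T⊆B
            where
            T⊆B : T Subset.⊆ tag B
            T⊆B {v} v∈ = Vec.lookup⇒[]= v (tag B) (within-lookup T (tag B) (support B∈ T∈B) v (Vec.[]=⇒lookup v∈))

      cover-length : ι (length cover) ≤ W
      cover-length = begin
        ι (length cover)                   ≡⟨ trans (cong ι (length-++ big {small})) (ι-+ (length big) (length small)) ⟩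
        ι (length big) + ι (length small)  ≤⟨ +-mono-≤ (ι-mono (ℕ.≤-trans (length-filter nonempty? (map tag L)) (ℕ.≤-reflexive (length-map tag L)))) (ι-mono (length-filter clique? rest)) ⟩
        ι (length L) + ι (length rest)     ≤⟨ L+rest≤W ⟩
        W                                  ∎
        where open ≤-Reasoning

    small-cover : Σ (List (Subset n)) λ C → IsTCliqueCover t G C × ι (length C) ≤ (1ℚ + ε) * ((1ℚ + ε) * y ^ t)
    small-cover = collect nibbled
      where
      collect : (Σ (List Block) λ L → Σ (List (Subset n)) λ rest → (∀ {B} → B ∈ L → B ∈ xs′) ×
          (∀ {T} → T ∈ ps → T ∈ rest ⊎ (∃ λ B → B ∈ L × mem B T ≡ true)) × ι (length L) + ι (length rest) ≤ (1ℚ + ε) * ∑ xs′ weight) →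
        Σ (List (Subset n)) λ C → IsTCliqueCover t G C × ι (length C) ≤ (1ℚ + ε) * ((1ℚ + ε) * y ^ t)
      collect (L , rest , L⊆ , found , L+rest≤) = Cl.cover , Cl.covers , Cl.cover-length
        where
        module Cl = Collect L rest ((1ℚ + ε) * W₀) (λ B∈ {u} {v} → Adm.tagged (L⊆ B∈) {u} {v}) (λ B∈ → Adm.support (L⊆ B∈)) found
          (subst (λ w → ι (length L) + ι (length rest) ≤ (1ℚ + ε) * w) Adm.total L+rest≤)

-- Passage to the inequality between integers

¬¬-finite : ∀ {n} {P : Fin n → Set} → (∀ i → ¬ ¬ P i) → ¬ ¬ (∀ i → P i)
¬¬-finite {zero}  ¬¬p ¬all = ¬all λ ()
¬¬-finite {suc n} ¬¬p ¬all = ¬¬p zero λ p₀ → ¬¬-finite (λ i → ¬¬p (suc i)) λ ps → ¬all λ { zero → p₀ ; (suc i) → ps i }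

-- The claim is an inequality between natural numbers, hence stable under double negation.
¬¬-decidable-adjacency : ∀ {n} (G : Graph n) → ¬ ¬ (∀ u v → Dec (Adj G u v))
¬¬-decidable-adjacency G = ¬¬-finite λ u → ¬¬-finite λ v → ¬¬-excluded-middle

module Bound (t-1 k : ℕ) where

  t : ℕ
  t = suc t-1

  c ε : ℚ
  c = 1ℚ + 2ℚ
  0<cK : 0ℚ < c * ι (suc (suc k))
  0<cK = 0<p*q (0<p+q 0<1 (0≤1 ⊹ 0≤1)) (0<ι (suc k))
  -- `ε = 1/(3 (k + 2))`, where 3 counts the factors `1 + ε` lost: to the inflated weight, to the
  -- nibble, and to rounding `n/t`.
  ε = proj₁ (inverse 0<cK)
  0<ε : 0ℚ < ε
  0<ε = proj₁ (proj₂ (inverse 0<cK))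
  0≤ε : 0ℚ ≤ ε
  0≤ε = <⇒≤ 0<ε
  ε-spec : c * ι (suc (suc k)) * ε ≡ 1ℚ
  ε-spec = proj₂ (proj₂ (inverse 0<cK))
  ε≤1 : ε ≤ 1ℚ
  ε≤1 = ≤-cert _ (trans (sym ε-spec) (eq (ι k) ε)) ((0≤1 ⊹ 0≤1 ⊹ 0≤1 ⊹ 0≤1 ⊹ 0≤1 ⊹ 0≤ck) ⊛ 0≤ε)
    where
    0≤ck : 0ℚ ≤ c * ι k
    0≤ck = (0≤1 ⊹ (0≤1 ⊹ 0≤1)) ⊛ 0≤ι k
    eq : ∀ k e → (1ℚ + 2ℚ) * (1ℚ + (1ℚ + k)) * e ≡ e + (1ℚ + 1ℚ + 1ℚ + 1ℚ + 1ℚ + (1ℚ + 2ℚ) * k) * e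
    eq = solve-∀ ring

  open Parameters t-1 ε 0<ε ε≤1 using (y₀; module Construction)

  m₀ n₀ : ℕ
  -- The second summand is `2 t / ε`, so that `t/m ≤ ε/2` for `m ≥ m₀`; it also excludes `m = 0`.
  m₀ = y₀ ℕ.+ 2 ℕ.* (3 ℕ.* (2 ℕ.+ k)) ℕ.* t
  n₀ = m₀ ℕ.* t

  -- The cover is built for the upper rounding `m + 1` of `n/t`, but the Turán graph only gives
  -- `m ^ t`. The ratio is at most `1/(1 - t/m) ≤ 1/(1 - ε/2) ≤ 1 + ε`.
  [1+m]^t≤ : ∀ m → m₀ ℕ.≤ m → ι (suc m) ^ t ≤ (1ℚ + ε) * ι m ^ t
  [1+m]^t≤ zero    m₀≤m = ⊥-elim (ℕ.<⇒≱ positive-m₀ (ℕ.≤-trans (ℕ.m≤n+m _ y₀) m₀≤m))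
    where
    positive-m₀ : 1 ℕ.≤ 2 ℕ.* (3 ℕ.* (2 ℕ.+ k)) ℕ.* t
    positive-m₀ = ℕ.s≤s ℕ.z≤n
  [1+m]^t≤ (suc m-1) m₀≤m = begin
    ι (suc m) ^ t
      ≡⟨ trans (cong (_^ t) (trans (cong (λ u → u + ι m) (sym m*i≡1)) (eq₁ (ι m) i))) (*-^ (1ℚ + i) (ι m) t) ⟩
    (1ℚ + i) ^ t * ι m ^ t
      ≤⟨ *-monoʳ (0≤^ t (0≤ι m)) (≤-cert {X} _ (eq₂ ε (ι t * i) X) (p≤q⇒0≤q-p ti≤½ε ⊛ (0≤X ⊛ (0≤1 ⊹ 0≤ε)) ⊹ 0≤½ ⊛ (0≤ε ⊛ p≤q⇒0≤q-p ε≤1) ⊛ 0≤X ⊹ (0≤1 ⊹ 0≤ε) ⊛ p≤q⇒0≤q-p (growth-bernoulli t 0≤i i≤1))) ⟩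
    (1ℚ + ε) * ι m ^ t ∎
    where
    open ≤-Reasoning
    m : ℕ
    m = suc m-1
    i X : ℚ
    i = proj₁ (inverse (0<ι m-1))
    0≤i : 0ℚ ≤ i
    0≤i = <⇒≤ (proj₁ (proj₂ (inverse (0<ι m-1))))
    m*i≡1 : ι m * i ≡ 1ℚ
    m*i≡1 = proj₂ (proj₂ (inverse (0<ι m-1)))
    X = (1ℚ + i) ^ t
    0≤X : 0ℚ ≤ X
    0≤X = 0≤^ t (0≤1 ⊹ 0≤i)
    0≤½ : 0ℚ ≤ ½
    0≤½ = nonNegative⁻¹ ½
    eq₁ : ∀ m i → m * i + m ≡ (1ℚ + i) * m
    eq₁ = solve-∀ ring
    eq₂ : ∀ e u X → 1ℚ + e ≡ X + ((½ * e - u) * (X * (1ℚ + e)) + ½ * (e * (1ℚ - e)) * X + (1ℚ + e) * (1ℚ - (1ℚ - u) * X))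
    eq₂ = solve-∀ ring
    i≤1 : i ≤ 1ℚ
    i≤1 = subst (i ≤_) m*i≡1 (≤-cert (ι m-1 * i) (eq (ι m-1) i) (0≤ι m-1 ⊛ 0≤i))
      where
      eq : ∀ m i → (1ℚ + m) * i ≡ i + m * i
      eq = solve-∀ ring
    6Kt≤m : 2ℚ * (c * ι (suc (suc k))) * ι t ≤ ι m
    6Kt≤m = ≤-trans (≤-reflexive (sym (trans (ι-* (2 ℕ.* (3 ℕ.* (2 ℕ.+ k))) t) (cong (_* ι t) (trans (ι-* 2 (3 ℕ.* (2 ℕ.+ k))) (cong (2ℚ *_) (ι-* 3 (2 ℕ.+ k))))))))
      (ι-mono (ℕ.≤-trans (ℕ.m≤n+m _ y₀) m₀≤m))
    ti≤½ε : ι t * i ≤ ½ * ε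
    ti≤½ε = subst₂ _≤_ (trans (eq (c * ι (suc (suc k))) (ι t) ε i) (trans (cong (_* (ι t * i)) ε-spec) (*-identityˡ _)))
      (trans (eq′ (ι m) ε i) (trans (cong (λ u → ½ * ε * u) m*i≡1) (*-identityʳ _)))
      (*-monoʳ (0≤½ ⊛ 0≤ε ⊛ 0≤i) 6Kt≤m)
      where
      eq : ∀ x t e i → 2ℚ * x * t * (½ * e * i) ≡ x * e * (t * i)
      eq = solve-∀ ring
      eq′ : ∀ m e i → m * (½ * e * i) ≡ ½ * e * (m * i)
      eq′ = solve-∀ ring

  -- The conclusion is the estimate with relative error `1/(k + 1)`, cleared of denominators. It
  -- follows from `(k + 2)(1 - 3 ε) = k + 1` and `(1 - 3 ε)(1 + ε)³ ≤ 1`.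
  bound : ∀ n → n₀ ℕ.≤ n → (G : Graph n) → (∀ u v → Dec (Adj G u v)) → ∀ a b → IsCov t G a → IsCov t (Turán n t) b →
    a ℕ.* suc k ℕ.≤ (suc k ℕ.+ 1) ℕ.* b
  bound n n₀≤n G adj? a b (_ , a-min) ((C , C-covers , ∣C∣≡b) , _) = ι-cancel-≤ (begin
    ι (a ℕ.* suc k)
      ≡⟨ trans (ι-* a (suc k)) (trans (eq₁ (ι a) (ι k)) (trans (cong (λ u → ι a * (ι (suc (suc k)) - u)) (sym ε-spec)) (eq₂ (ι a) (ι (suc (suc k))) c ε))) ⟩
    ι (suc (suc k)) * ((1ℚ - c * ε) * ι a)
      ≤⟨ *-monoˡ (0≤ι (suc (suc k))) (*-monoˡ 0≤1-cε ιa≤) ⟩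
    ι (suc (suc k)) * ((1ℚ - c * ε) * ((1ℚ + ε) * ((1ℚ + ε) * ((1ℚ + ε) * ι b))))
      ≤⟨ *-monoˡ (0≤ι (suc (suc k))) (≤-trans (≤-reflexive (eq₃ (1ℚ - c * ε) (1ℚ + ε) (ι b))) (subst ((1ℚ - c * ε) * (1ℚ + ε) ^ 3 * ι b ≤_) (*-identityˡ (ι b)) (*-monoʳ (0≤ι b) (growth-bernoulli 3 0≤ε ε≤1)))) ⟩
    ι (suc (suc k)) * ι b
      ≡⟨ trans (sym (ι-* (suc (suc k)) b)) (cong (λ s → ι (s ℕ.* b)) (sym (ℕ.+-comm (suc k) 1))) ⟩
    ι ((suc k ℕ.+ 1) ℕ.* b) ∎)
    where
    open ≤-Reasoning
    m : ℕ
    m = n ℕ./ t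
    m₀≤m : m₀ ℕ.≤ m
    m₀≤m = ℕ.≤-trans (ℕ.≤-reflexive (sym (m*n/n≡m m₀ t))) (/-monoˡ-≤ t n₀≤n)
    n≤t[1+m] : n ℕ.≤ t ℕ.* suc m
    n≤t[1+m] = ℕ.≤-trans (ℕ.≤-reflexive (m≡m%n+[m/n]*n n t)) (ℕ.≤-trans (ℕ.+-monoˡ-≤ (m ℕ.* t) (ℕ.<⇒≤ (m%n<n n t))) (ℕ.≤-reflexive (ℕ.*-comm (suc m) t)))
    open Construction n m (ℕ.≤-trans (ℕ.m≤m+n y₀ _) (ℕ.≤-trans m₀≤m (ℕ.n≤1+n m))) n≤t[1+m] G adj? using (small-cover)
    m^t≤b : ι m ^ t ≤ ι b
    m^t≤b = ≤-trans (≤-reflexive (sym (ι-^ m t))) (ι-mono (ℕ.≤-trans (cover-size {m = m} (ℕ.s≤s ℕ.z≤n) (m/n*n≤m n t) C C-covers) (ℕ.≤-reflexive ∣C∣≡b)))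
    ιa≤ : ι a ≤ (1ℚ + ε) * ((1ℚ + ε) * ((1ℚ + ε) * ι b))
    ιa≤ = ≤-trans (ι-mono (a-min (proj₁ small-cover) (proj₁ (proj₂ small-cover)))) (≤-trans (proj₂ (proj₂ small-cover)) (*-monoˡ (0≤1 ⊹ 0≤ε) (*-monoˡ (0≤1 ⊹ 0≤ε)
      (≤-trans ([1+m]^t≤ m m₀≤m) (*-monoˡ (0≤1 ⊹ 0≤ε) m^t≤b)))))
    0≤1-cε : 0ℚ ≤ 1ℚ - c * ε
    0≤1-cε = p≤q⇒0≤q-p (subst (c * ε ≤_) ε-spec (≤-cert (c * (ι (suc k) * ε)) (eq c (ι (suc k)) ε) ((0≤1 ⊹ (0≤1 ⊹ 0≤1)) ⊛ (0≤ι (suc k) ⊛ 0≤ε))))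
      where
      eq : ∀ c k e → c * (1ℚ + k) * e ≡ c * e + c * (k * e)
      eq = solve-∀ ring
    eq₁ : ∀ a k → a * (1ℚ + k) ≡ a * ((1ℚ + (1ℚ + k)) - 1ℚ)
    eq₁ = solve-∀ ring
    eq₂ : ∀ a K c e → a * (K - c * K * e) ≡ K * ((1ℚ - c * e) * a)
    eq₂ = solve-∀ ring
    eq₃ : ∀ x g b → x * (g * (g * (g * b))) ≡ x * (g * (g * (g * 1ℚ))) * b
    eq₃ = solve-∀ ring

theorem1p6 : (t : ℕ) → .{{_ : NonZero t}} → 2 ℕ.≤ t →
    (k : ℕ) → Σ ℕ λ n₀ → (n : ℕ) → n₀ ℕ.≤ n → (G : Graph n) →
    (a b : ℕ) → IsCov t G a → IsCov t (Turán n t) b →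
    a ℕ.* suc k ℕ.≤ (suc k ℕ.+ 1) ℕ.* b
theorem1p6 (suc t-1) 2≤t k = Bound.n₀ t-1 k , λ n n₀≤n G a b covG covT →
  decidable-stable (_ ℕ.≤? _) λ ¬le → ¬¬-decidable-adjacency G λ adj? → ¬le (Bound.bound t-1 k n n₀≤n G adj? a b covG covT)
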